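{- There exists an absolute constant $c>0$ such that the following holds. Let $p$ be an odd prime and let $A \subseteq \mathbb{F}_p$. Then there exist $a,b \in A$ such that \[ |\Delta_{(a,b)}(A \times A)| \geq c \min\{p, |A|^{3/2}\}, \] where $\Delta_{(a,b)}(A\times A) = \{ (a-c')^2 + (b-d)^2 : c',d \in A\} \subseteq \mathbb{F}_p$.
   Context: $\mathbb{F}_p$ denotes the finite field with $p$ elements. For $u=(u_1,u_2), v=(v_1,v_2) \in \mathbb{F}_p^2$, the algebraic distance is $\|u-v\| = (u_1-v_1)^2+(u_2-v_2)^2 \in \mathbb{F}_p$. For $E \subseteq \mathbb{F}_p^2$ and $u \in E$, the pinned distance set is $\Delta_u(E) = \{\|u-v\| : v \in E\}$. -}

module Defs where

open import Data.Nat using (ℕ; _+_; _*_; _∸_; _^_; _%_; NonZero)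
open import Data.Nat.Properties using (_≟_)
open import Data.Fin using (Fin; toℕ)
open import Data.Fin.Subset using (Subset; _∈_)
open import Data.Fin.Subset.Properties using (_∈?_)
open import Data.Fin.Properties using (any?)
open import Data.Product using (_×_; ∃)
open import Data.Vec using (tabulate)
open import Relation.Nullary using (does)
open import Relation.Nullary.Decidable using (_×-dec_)

-- Elements of 𝔽_p are represented by Fin p (residues 0 … p-1).
-- Algebraic distance ‖(a,b) - (c,d)‖ = (a-c)^2 + (b-d)^2 in 𝔽_p,
-- returned as the canonical residue in ℕ (value < p).
-- (a - c) is computed as a + (p ∸ c), which is congruent to a - c mod p.
dist : (p : ℕ) .{{_ : NonZero p}} → Fin p → Fin p → Fin p → Fin p → ℕ
dist p a b c d =
  ((toℕ a + (p ∸ toℕ c)) ^ 2 + (toℕ b + (p ∸ toℕ d)) ^ 2) % p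

pinnedΔ : (p : ℕ) .{{_ : NonZero p}} → Subset p → Fin p → Fin p → Subset p
pinnedΔ p A a b = tabulate λ t →
  does (any? λ c → any? λ d →
    (c ∈? A ×-dec d ∈? A) ×-dec (dist p a b c d ≟ toℕ t))

module Submission where

-- Passing to a subset we may assume |A| = h² and 40 h³ ≤ p. Suppose that every pin in A × A sees few distances, say
-- at most h³ / 41. By Cauchy–Schwarz there are many solutions of
-- (a − c)² + (b − d)² = (a − c′)² + (b − d′)², an equation of the shape a v′ + a′ v + w + w′ = 0 for the triples
-- (a, d, d′) and (b, c, c′), with v = 2(d′ − d) and w = d² − d′². A triple defines over 𝔽_p(τ) = 𝔽_{p²} a "red" line
-- {y = v + τ a, z = w + a s} and a "blue" line {s = v − τ a, z = − w − a y} in (s, y, z)-space, and the equation says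
-- that the red line of one triple meets the blue line of the other; τ makes the intersection points on a line distinct.
-- After pruning, every line has more than 18 h³ intersection points. Counting coefficients gives a nonzero polynomial of
-- degree less than 2 h³ in each variable vanishing on all lines, and replacing it by a z-derivative T we may assume T_z ≠ 0 on some red line.
-- Reds are straight, so (z_s)_s = 0 for the surface T = 0 along them, hence at more points of each blue line than the
-- degree allows, hence to first order along the blue lines: z_{ssy} = 0 on that red line. So the slopes z_y = − T_y / T_z
-- of the blue lines meeting it are an affine function of s, which makes almost all neighbours of a triple collinear.
-- But at most 2|A| neighbours are collinear.

-- The usual route through irreducible components and ruled surfaces is delicate in characteristic
-- p. Here `T` only has to vanish on all red lines while `T_z` does not vanish on one of them; a
-- nonzero polynomial vanishing on the red lines has such a z-derivative, since otherwise Taylor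
-- expansion in z would kill all its coefficients. Everything after that is one principle: a
-- polynomial on a line with more zeros than its degree vanishes together with its formal
-- derivative. The expressions involved are cubic in partial derivatives of `T`, each of degree at
-- most 6 h³ on a line, hence the demand for 18 h³ crossings. Affinity of the slope in s comes from
-- two first-order linear differential equations for polynomials; these have unique solutions
-- because 40 h³ ≤ p keeps all degrees below p. Vanishing is imposed on the red lines only and is
-- inherited by the blue ones at the crossings. For τ in 𝔽_p, v - τ a could agree for different
-- neighbours; outside 𝔽_p it records both v and a, while τ cancels from the incidence condition.

open import Defs
open import Data.Empty using (⊥)
open import Data.Fin using (Fin; zero; suc; toℕ)
import Data.Fin.Properties as Finₚ
open import Data.List using (List; []; _∷_; length; map; filter; cartesianProduct)
open import Data.List.Properties using (length-map)
open import Data.List.Relation.Unary.All as All using (All; []; _∷_)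
import Data.List.Relation.Unary.All.Properties as Allₚ
open import Data.List.Relation.Unary.AllPairs using ([]; _∷_)
open import Data.List.Relation.Unary.Any as Any using (here; there)
open import Data.List.Relation.Unary.Unique.Propositional using (Unique)
import Data.List.Relation.Unary.Unique.Propositional.Properties as Uniqueₚ
open import Data.Nat as ℕ using (ℕ; zero; suc; z≤n; s≤s; NonZero)
open import Data.Nat.Primality using (Prime; euclidsLemma; prime⇒nonTrivial)
import Data.Nat.Properties as ℕₚ
open import Data.Nat.Solver using (module +-*-Solver)
open import Data.Product using (∃; _,_; _×_; proj₁; proj₂; uncurry)
open import Data.Sum as Sum using (_⊎_; inj₁; inj₂; [_,_]′)
open import Function using (_∘_; Injective)
open import Relation.Binary.Definitions using (DecidableEquality; tri<; tri≈; tri>)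
open import Relation.Binary.PropositionalEquality hiding ([_]; J)
open import Relation.Nullary using (Dec; yes; no; ¬_; ¬?; contradiction)
open import Relation.Nullary.Decidable using (_×-dec_; dec-true; decidable-stable)
open import Relation.Unary using (Decidable)

-- Finite sums, double counting, and dense subgraphs.

module Counting where
  open import Data.Nat using (_+_; _*_; _≤_; _<_; _<?_)
  open import Data.Nat.Properties
  open import Data.List using (_++_)
  open import Data.List.Properties using (length-++)
  open import Data.List.Membership.Propositional using (_∈_; find)
  open import Data.List.Membership.Propositional.Properties using (∈-∃++; ∈-++⁺ˡ; ∈-++⁺ʳ; ∈-++⁻)

  private variable A B : Set

  ∑ : List A → (A → ℕ) → ℕ
  ∑ []       f = 0
  ∑ (x ∷ xs) f = f x + ∑ xs f


  ∑-cong : ∀ (xs : List A) {f g} → (∀ x → f x ≡ g x) → ∑ xs f ≡ ∑ xs g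
  ∑-cong []       eq = refl
  ∑-cong (x ∷ xs) eq = cong₂ _+_ (eq x) (∑-cong xs eq)

  ∑-mono : ∀ (xs : List A) {f g} → (∀ {x} → x ∈ xs → f x ≤ g x) → ∑ xs f ≤ ∑ xs g
  ∑-mono []       le = z≤n
  ∑-mono (x ∷ xs) le = +-mono-≤ (le (here refl)) (∑-mono xs (le ∘ there))

  ∑-+ : ∀ (xs : List A) f g → ∑ xs (λ x → f x + g x) ≡ ∑ xs f + ∑ xs g
  ∑-+ []       f g = refl
  ∑-+ (x ∷ xs) f g = trans (cong (f x + g x +_) (∑-+ xs f g))
    (solve 4 (λ a b c d → a :+ b :+ (c :+ d) := a :+ c :+ (b :+ d)) refl (f x) (g x) (∑ xs f) (∑ xs g))
    where open +-*-Solver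

  ∑-*ˡ : ∀ (xs : List A) c f → ∑ xs (λ x → c * f x) ≡ c * ∑ xs f
  ∑-*ˡ []       c f = sym (*-zeroʳ c)
  ∑-*ˡ (x ∷ xs) c f = trans (cong (c * f x +_) (∑-*ˡ xs c f)) (sym (*-distribˡ-+ c (f x) (∑ xs f)))

  ∑-const : ∀ (xs : List A) c → ∑ xs (λ _ → c) ≡ length xs * c
  ∑-const []       c = refl
  ∑-const (x ∷ xs) c = cong (c +_) (∑-const xs c)

  ∑-≤ : ∀ (xs : List A) {c f} → (∀ {x} → x ∈ xs → f x ≤ c) → ∑ xs f ≤ length xs * c
  ∑-≤ xs {c} le = ≤-trans (∑-mono xs le) (≤-reflexive (∑-const xs c))

  ∑-≥ : ∀ (xs : List A) {c f} → (∀ {x} → x ∈ xs → c ≤ f x) → length xs * c ≤ ∑ xs f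
  ∑-≥ xs {c} le = ≤-trans (≤-reflexive (sym (∑-const xs c))) (∑-mono xs le)

  ∑-++ : ∀ (xs ys : List A) f → ∑ (xs ++ ys) f ≡ ∑ xs f + ∑ ys f
  ∑-++ []       ys f = refl
  ∑-++ (x ∷ xs) ys f = trans (cong (f x +_) (∑-++ xs ys f)) (sym (+-assoc (f x) _ _))

  ∑-map : ∀ (g : A → B) xs f → ∑ (map g xs) f ≡ ∑ xs (f ∘ g)
  ∑-map g []       f = refl
  ∑-map g (x ∷ xs) f = cong (f (g x) +_) (∑-map g xs f)

  ∑-swap : ∀ (xs : List A) (ys : List B) (f : A → B → ℕ) → ∑ xs (λ x → ∑ ys (f x)) ≡ ∑ ys (λ y → ∑ xs (λ x → f x y))
  ∑-swap []       ys f = sym (trans (∑-const ys 0) (*-zeroʳ (length ys)))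
  ∑-swap (x ∷ xs) ys f = trans (cong (∑ ys (f x) +_) (∑-swap xs ys f)) (sym (∑-+ ys (f x) _))

  ∑-cartesian : ∀ (xs : List A) (ys : List B) f → ∑ (cartesianProduct xs ys) f ≡ ∑ xs (λ x → ∑ ys (λ y → f (x , y)))
  ∑-cartesian []       ys f = refl
  ∑-cartesian (x ∷ xs) ys f = trans (∑-++ (map (x ,_) ys) _ f) (cong₂ _+_ (∑-map (x ,_) ys f) (∑-cartesian xs ys f))

  ∑-* : ∀ (xs : List A) (ys : List B) f g → ∑ xs f * ∑ ys g ≡ ∑ xs (λ x → ∑ ys (λ y → f x * g y))
  ∑-* xs ys f g = trans (*-comm (∑ xs f) (∑ ys g)) (trans (sym (∑-*ˡ xs (∑ ys g) f))
    (∑-cong xs (λ x → trans (*-comm (∑ ys g) (f x)) (sym (∑-*ˡ ys (f x) g)))))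

  length-cartesian : ∀ (xs : List A) (ys : List B) → length (cartesianProduct xs ys) ≡ length xs * length ys
  length-cartesian []       ys = refl
  length-cartesian (x ∷ xs) ys = trans (length-++ (map (x ,_) ys)) (cong₂ _+_ (length-map (x ,_) ys) (length-cartesian xs ys))

  𝟙 : ∀ {P : Set} → Dec P → ℕ
  𝟙 (yes _) = 1
  𝟙 (no  _) = 0

  𝟙-yes : ∀ {P : Set} (d : Dec P) → P → 𝟙 d ≡ 1
  𝟙-yes (yes _) p = refl
  𝟙-yes (no ¬p) p = contradiction p ¬p

  𝟙-no : ∀ {P : Set} (d : Dec P) → ¬ P → 𝟙 d ≡ 0
  𝟙-no (yes p) ¬p = contradiction p ¬p
  𝟙-no (no _)  ¬p = refl

  𝟙-cong : ∀ {P Q : Set} (d : Dec P) (e : Dec Q) → (P → Q) → (Q → P) → 𝟙 d ≡ 𝟙 e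
  𝟙-cong (yes p) e f g = sym (𝟙-yes e (f p))
  𝟙-cong (no ¬p) e f g = sym (𝟙-no e (¬p ∘ g))

  length-filter≡∑ : ∀ {P : A → Set} (P? : Decidable P) xs → length (filter P? xs) ≡ ∑ xs (λ x → 𝟙 (P? x))
  length-filter≡∑ P? []       = refl
  length-filter≡∑ P? (x ∷ xs) with P? x
  ... | yes _ = cong suc (length-filter≡∑ P? xs)
  ... | no  _ = length-filter≡∑ P? xs

  ∑-zero : ∀ (xs : List A) {f} → (∀ {x} → x ∈ xs → f x ≡ 0) → ∑ xs f ≡ 0
  ∑-zero xs eq = n≤0⇒n≡0 (≤-trans (∑-≤ xs (λ x∈xs → ≤-reflexive (eq x∈xs))) (≤-reflexive (*-zeroʳ (length xs))))

  module _ (_≟_ : DecidableEquality A) where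

    ∑-𝟙-≤ : ∀ {xs} → Unique xs → ∀ y (f : A → ℕ) → ∑ xs (λ x → 𝟙 (y ≟ x) * f x) ≤ f y
    ∑-𝟙-≤ []                   y f = z≤n
    ∑-𝟙-≤ {xs = x ∷ xs} (x∉xs ∷ !xs) y f with y ≟ x
    ... | no  _    = ∑-𝟙-≤ !xs y f
    ... | yes refl = ≤-reflexive (trans (cong (1 * f x +_) (∑-zero xs (λ {z} z∈ → cong (_* f z) (𝟙-no (x ≟ z) (All.lookup x∉xs z∈)))))
      (trans (+-identityʳ _) (*-identityˡ (f x))))

    ∑-𝟙-≤1 : ∀ {xs} → Unique xs → ∀ y → ∑ xs (λ x → 𝟙 (y ≟ x)) ≤ 1
    ∑-𝟙-≤1 {xs} !xs y = ≤-trans (≤-reflexive (∑-cong xs (λ x → sym (*-identityʳ _)))) (∑-𝟙-≤ !xs y (λ _ → 1))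

    ∑-𝟙-≥1 : ∀ {xs y} → y ∈ xs → 1 ≤ ∑ xs (λ x → 𝟙 (y ≟ x))
    ∑-𝟙-≥1 {x ∷ xs} {y} (here refl) = ≤-trans (≤-reflexive (sym (𝟙-yes (y ≟ y) refl))) (m≤m+n _ _)
    ∑-𝟙-≥1 {x ∷ xs} {y} (there y∈) = ≤-trans (∑-𝟙-≥1 y∈) (m≤n+m _ _)

    length-fibres : ∀ {k} (key : B → A) U xs → (∀ {u} → u ∈ U → key u ∈ xs) →
      (∀ x → length (filter (λ u → key u ≟ x) U) ≤ k) → length U ≤ length xs * k
    length-fibres {k = k} key U xs key∈ fibre = begin
      length U                                      ≡⟨ sym (*-identityʳ _) ⟩
      length U * 1                                  ≤⟨ ∑-≥ U (λ u∈U → ∑-𝟙-≥1 (key∈ u∈U)) ⟩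
      ∑ U (λ u → ∑ xs (λ x → 𝟙 (key u ≟ x)))        ≡⟨ ∑-swap U xs _ ⟩
      ∑ xs (λ x → ∑ U (λ u → 𝟙 (key u ≟ x)))        ≡⟨ ∑-cong xs (λ x → sym (length-filter≡∑ (λ u → key u ≟ x) U)) ⟩
      ∑ xs (λ x → length (filter (λ u → key u ≟ x) U)) ≤⟨ ∑-≤ xs (λ {x} _ → fibre x) ⟩
      length xs * k                                 ∎
      where open ≤-Reasoning

  -- Meant for root sets of a quadratic, with `σ` exchanging the two roots: two further elements
  -- would both have to be `σ x`.
  length≤2 : ∀ (σ : A → A) {xs} → Unique xs → (∀ {x y} → x ∈ xs → y ∈ xs → y ≡ x ⊎ y ≡ σ x) → length xs ≤ 2
  length≤2 σ {[]}                _ _ = z≤n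
  length≤2 σ {x ∷ []}            _ _ = s≤s z≤n
  length≤2 σ {x ∷ y ∷ []}        _ _ = s≤s (s≤s z≤n)
  length≤2 σ {x ∷ y ∷ z ∷ xs} ((x≢y ∷ x≢z ∷ _) ∷ (y≢z ∷ _) ∷ _) two
    with two (here refl) (there (here refl)) | two (here refl) (there (there (here refl)))
  ... | inj₁ y≡x | _        = contradiction (sym y≡x) x≢y
  ... | inj₂ _   | inj₁ z≡x = contradiction (sym z≡x) x≢z
  ... | inj₂ y≡  | inj₂ z≡  = contradiction (trans y≡ (sym z≡)) y≢z

  2xy≤x²+y² : ∀ x y → 2 * (x * y) ≤ x * x + y * y
  2xy≤x²+y² x y with ≤-total x y
  ... | inj₁ x≤y with k , refl ← m≤n⇒∃[o]m+o≡n x≤y = ≤-trans (m≤m+n _ (k * k)) (≤-reflexive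
        (solve 2 (λ x k → con 2 :* (x :* (x :+ k)) :+ k :* k := x :* x :+ (x :+ k) :* (x :+ k)) refl x k))
    where open +-*-Solver
  ... | inj₂ y≤x with k , refl ← m≤n⇒∃[o]m+o≡n y≤x = ≤-trans (m≤m+n _ (k * k)) (≤-reflexive
        (solve 2 (λ y k → con 2 :* ((y :+ k) :* y) :+ k :* k := (y :+ k) :* (y :+ k) :+ y :* y) refl y k))
    where open +-*-Solver

  cauchy-schwarz : ∀ (xs : List A) f → ∑ xs f * ∑ xs f ≤ length xs * ∑ xs (λ x → f x * f x)
  cauchy-schwarz xs f = *-cancelˡ-≤ 2 (begin
    2 * (∑ xs f * ∑ xs f)                                ≡⟨ cong (2 *_) (∑-* xs xs f f) ⟩
    2 * ∑ xs (λ x → ∑ xs (λ y → f x * f y))              ≡⟨ sym (∑-*ˡ xs 2 _) ⟩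
    ∑ xs (λ x → 2 * ∑ xs (λ y → f x * f y))              ≡⟨ ∑-cong xs (λ x → sym (∑-*ˡ xs 2 _)) ⟩
    ∑ xs (λ x → ∑ xs (λ y → 2 * (f x * f y)))            ≤⟨ ∑-mono xs (λ {x} _ → ∑-mono xs (λ {y} _ → 2xy≤x²+y² (f x) (f y))) ⟩
    ∑ xs (λ x → ∑ xs (λ y → f x * f x + f y * f y))      ≡⟨ ∑-cong xs (λ x → trans (∑-+ xs _ _) (cong (_+ S) (∑-const xs _))) ⟩
    ∑ xs (λ x → length xs * (f x * f x) + S)             ≡⟨ trans (∑-+ xs _ _) (cong₂ _+_ (∑-*ˡ xs (length xs) _) (∑-const xs S)) ⟩
    length xs * S + length xs * S                        ≡⟨ solve 1 (λ a → a :+ a := con 2 :* a) refl (length xs * S) ⟩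
    2 * (length xs * S)                                  ∎)
    where
    open ≤-Reasoning
    open +-*-Solver
    S = ∑ xs (λ x → f x * f x)

  -- Cauchy-Schwarz for the fibre sizes `r t`: they sum to at least the number of points, and their
  -- squares count the pairs with equal image.
  energy : ∀ (_≟_ : DecidableEquality B) (xs : List A) (ts : List B) (f : A → B) → Unique ts → (∀ {x} → x ∈ xs → f x ∈ ts) →
    length xs * length xs ≤ length ts * ∑ xs (λ x → ∑ xs (λ y → 𝟙 (f x ≟ f y)))
  energy _≟_ xs ts f !ts f∈ = begin
    length xs * length xs                       ≤⟨ *-mono-≤ size size ⟩
    ∑ ts r * ∑ ts r                             ≤⟨ cauchy-schwarz ts r ⟩
    length ts * ∑ ts (λ t → r t * r t)          ≡⟨ cong (length ts *_) (trans (∑-cong ts (λ t → ∑-* xs xs _ _))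
                                                     (trans (∑-swap ts xs _) (∑-cong xs (λ x → ∑-swap ts xs _)))) ⟩
    length ts * ∑ xs (λ x → ∑ xs (λ y → ∑ ts (λ t → 𝟙 (f x ≟ t) * 𝟙 (f y ≟ t))))
      ≤⟨ *-monoʳ-≤ (length ts) (∑-mono xs (λ {x} _ → ∑-mono xs (λ {y} _ →
           ≤-trans (∑-𝟙-≤ _≟_ !ts (f x) (λ t → 𝟙 (f y ≟ t))) (≤-reflexive (𝟙-cong (f y ≟ f x) (f x ≟ f y) sym sym))))) ⟩
    length ts * ∑ xs (λ x → ∑ xs (λ y → 𝟙 (f x ≟ f y))) ∎
    where
    open ≤-Reasoning
    r = λ t → ∑ xs (λ x → 𝟙 (f x ≟ t))
    size : length xs ≤ ∑ ts r
    size = ≤-trans (≤-reflexive (sym (*-identityʳ _)))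
      (≤-trans (∑-≥ xs (λ x∈ → ∑-𝟙-≥1 _≟_ (f∈ x∈))) (≤-reflexive (∑-swap xs ts _)))

  unique-remove : ∀ (xs : List A) {y ys} → Unique (xs ++ y ∷ ys) → Unique (xs ++ ys)
  unique-remove []       (_ ∷ !ys)     = !ys
  unique-remove (x ∷ xs) (x∉ ∷ !rest) =
    Allₚ.++⁺ (Allₚ.++⁻ˡ xs x∉) (All.tail (Allₚ.++⁻ʳ xs x∉)) ∷ unique-remove xs !rest

  ∑-remove : ∀ (xs : List A) {y ys} f → ∑ (xs ++ y ∷ ys) f ≡ f y + ∑ (xs ++ ys) f
  ∑-remove []       f = refl
  ∑-remove (x ∷ xs) {y} f = trans (cong (f x +_) (∑-remove xs f))
    (solve 3 (λ a b c → a :+ (b :+ c) := b :+ (a :+ c)) refl (f x) (f y) _)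
    where open +-*-Solver

  ∈-remove : ∀ (xs : List A) {x y ys} → x ∈ xs ++ ys → x ∈ xs ++ y ∷ ys
  ∈-remove xs x∈ with ∈-++⁻ xs x∈
  ... | inj₁ x∈xs = ∈-++⁺ˡ x∈xs
  ... | inj₂ x∈ys = ∈-++⁺ʳ xs (there x∈ys)

  length-remove : ∀ (xs : List A) {y ys} → length (xs ++ y ∷ ys) ≡ suc (length (xs ++ ys))
  length-remove []       = refl
  length-remove (x ∷ xs) = cong suc (length-remove xs)

  -- Vertices of degree at most t are deleted one at a time.
  module Core (adj : A → A → ℕ) (adj-sym : ∀ x y → adj x y ≡ adj y x) (t : ℕ) where

    degree : List A → A → ℕ
    degree V x = ∑ V (adj x)

    record Dense (V : List A) : Set where
      field
        core      : List A
        core⊆     : ∀ {x} → x ∈ core → x ∈ V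
        unique    : Unique V → Unique core
        length≤   : length core ≤ length V
        vertex    : ∃ λ x → x ∈ core
        degree>   : ∀ {x} → x ∈ core → t < degree core x

    -- Deleting `y` removes its row and, by symmetry, an equal column. A loop at `y` would be
    -- counted twice on the right, hence only an inequality.
    remove-edges : ∀ xs y ys → let V = xs ++ y ∷ ys ; V₀ = xs ++ ys in
      ∑ V (degree V) ≤ 2 * degree V y + ∑ V₀ (degree V₀)
    remove-edges xs y ys = begin
      ∑ V (degree V)                                         ≡⟨ ∑-remove xs (degree V) ⟩
      degree V y + ∑ V₀ (degree V)                           ≡⟨ cong (degree V y +_) (trans (∑-cong V₀ (λ x → ∑-remove xs (adj x))) (∑-+ V₀ _ _)) ⟩
      degree V y + (∑ V₀ (λ x → adj x y) + ∑ V₀ (degree V₀)) ≤⟨ +-monoʳ-≤ (degree V y) (+-monoˡ-≤ _ (begin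
          ∑ V₀ (λ x → adj x y)     ≡⟨ ∑-cong V₀ (λ x → adj-sym x y) ⟩
          ∑ V₀ (adj y)             ≤⟨ m≤n+m _ _ ⟩
          adj y y + ∑ V₀ (adj y)   ≡⟨ sym (∑-remove xs (adj y)) ⟩
          degree V y               ∎)) ⟩
      degree V y + (degree V y + ∑ V₀ (degree V₀))           ≡⟨ solve 2 (λ d e → d :+ (d :+ e) := con 2 :* d :+ e) refl (degree V y) _ ⟩
      2 * degree V y + ∑ V₀ (degree V₀)                      ∎
      where
      open ≤-Reasoning
      open +-*-Solver
      V = xs ++ y ∷ ys
      V₀ = xs ++ ys

    -- The inequality survives a deletion: the left side drops by 2 t, the right side by at most 2
    -- t. Its strictness rules out the empty list, so the process stops at a nonempty core. `n` is
    -- fuel for termination.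
    dense-core : ∀ n V → length V ≤ n → 2 * t * length V < ∑ V (degree V) → Dense V
    dense-core n V len edges with All.all? (λ x → t <? degree V x) V
    dense-core n (x ∷ V) len edges | yes degree> = record
      { core = x ∷ V ; core⊆ = λ x∈ → x∈ ; unique = λ ! → ! ; length≤ = ≤-refl
      ; vertex = x , here refl ; degree> = All.lookup degree> }
    dense-core n V len edges | no ¬all with y , y∈V , ¬degree> ← find (Allₚ.¬All⇒Any¬ (λ x → t <? degree V x) V ¬all)
      with xs , ys , refl ← ∈-∃++ y∈V | n
    ... | zero  = contradiction (subst (_≤ 0) (length-remove xs) len) λ ()
    ... | suc m = record
      { core = core ; core⊆ = ∈-remove xs ∘ core⊆ ; unique = unique ∘ unique-remove xs
      ; length≤ = ≤-trans length≤ (≤-trans (n≤1+n _) (≤-reflexive (sym (length-remove xs))))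
      ; vertex = vertex ; degree> = degree> }
      where
      open ≤-Reasoning
      open +-*-Solver
      V₀ = xs ++ ys
      edges₀ : 2 * t * length V₀ < ∑ V₀ (degree V₀)
      edges₀ = +-cancelˡ-< (2 * t) _ _ (begin-strict
        2 * t + 2 * t * length V₀                      ≡⟨ solve 2 (λ t l → con 2 :* t :+ con 2 :* t :* l := con 2 :* t :* (con 1 :+ l)) refl t (length V₀) ⟩
        2 * t * suc (length V₀)                        ≡⟨ cong (2 * t *_) (sym (length-remove xs)) ⟩
        2 * t * length (xs ++ y ∷ ys)                  <⟨ edges ⟩
        ∑ (xs ++ y ∷ ys) (degree (xs ++ y ∷ ys))       ≤⟨ remove-edges xs y ys ⟩
        2 * degree (xs ++ y ∷ ys) y + ∑ V₀ (degree V₀) ≤⟨ +-monoˡ-≤ _ (*-monoʳ-≤ 2 (≮⇒≥ ¬degree>)) ⟩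
        2 * t + ∑ V₀ (degree V₀)                       ∎)
      open Dense (dense-core m V₀ (≤-pred (subst (_≤ suc m) (length-remove xs) len)) edges₀)

module PinnedDistances where
  open import Algebra.Bundles using (CommutativeRing)
  open import Algebra.Structures using (IsCommutativeRing)
  open import Algebra.Solver.Ring.AlmostCommutativeRing
    using (AlmostCommutativeRing; fromCommutativeRing; _-Raw-AlmostCommutative⟶_)
  import Algebra.Solver.Ring as RingSolver
  import Algebra.Properties.Ring as RingProperties
  import Algebra.Properties.Semiring.Mult as SemiringMult
  open import Data.Fin as Fin using (punchIn; punchOut; combine; remQuot; _↑ˡ_; _↑ʳ_)
  open import Data.Integer as ℤ using (ℤ; -[1+_]) renaming (+_ to pos)
  import Data.Integer.Properties as ℤₚ
  open import Data.List using (applyUpTo; lookup; tabulate)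
  open import Data.List.Properties using (length-applyUpTo; length-tabulate)
  open import Data.List.Membership.Propositional using (_∈_; find)
  open import Data.List.Membership.Propositional.Properties using (∈-filter⁻; ∈-applyUpTo⁻; ∈-map⁻; ∈-cartesianProduct⁻)
  import Data.List.Relation.Unary.Any.Properties as Anyₚ
  open import Data.Maybe using (Maybe; nothing; just)
  open import Data.Nat.DivMod using (_mod_; _%_; m%n<n; m<n⇒m%n≡m; %-distribˡ-+; %-distribˡ-*; n%n≡0)
  open import Data.Nat.Divisibility using (_∣_; m%n≡0⇒n∣m; ∣⇒≤)
  open import Data.Product.Properties using (≡-dec)
  open Counting

  -- Fields with decidable equality, and a ring solver over them.

  record Field : Set₁ where
    infix  4 _≟_
    infix  8 -_
    infixl 7 _*_
    infixl 6 _+_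
    field
      Carrier           : Set
      _+_ _*_           : Carrier → Carrier → Carrier
      -_                : Carrier → Carrier
      0# 1#             : Carrier
      isCommutativeRing : IsCommutativeRing _≡_ _+_ _*_ -_ 0# 1#
      1≢0               : 1# ≢ 0#
      _≟_               : DecidableEquality Carrier
      inverse           : ∀ x → x ≢ 0# → ∃ λ y → x * y ≡ 1#

  module FieldTheory (𝔽 : Field) where
    open Field 𝔽 public
    open ≡-Reasoning
    open IsCommutativeRing isCommutativeRing public
      using (+-assoc; +-comm; +-identityˡ; +-identityʳ; -‿inverseˡ; -‿inverseʳ;
             *-assoc; *-comm; *-identityˡ; *-identityʳ; distribˡ; distribʳ; zeroˡ; zeroʳ)

    private
      commutativeRing : CommutativeRing _ _
      commutativeRing = record { isCommutativeRing = isCommutativeRing }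

      module R where
        open RingProperties (CommutativeRing.ring commutativeRing) public
        open SemiringMult (CommutativeRing.semiring commutativeRing) public

    ι : ℕ → Carrier
    ι n = n R.× 1#

    ι-+ : ∀ m n → ι (m ℕ.+ n) ≡ ι m + ι n
    ι-+ = R.×-homo-+ 1#

    ι-* : ∀ m n → ι (m ℕ.* n) ≡ ι m * ι n
    ι-* = R.×1-homo-*

    private
      -- Integer coefficients let the ring solver collect and cancel terms in an arbitrary field.
      ιℤ : ℤ → Carrier
      ιℤ (pos n)    = ι n
      ιℤ -[1+ n ] = - ι (suc n)

      cancel-1 : ∀ x y → x + - y ≡ (1# + x) + - (1# + y)
      cancel-1 x y = sym (begin
        (1# + x) + - (1# + y)       ≡⟨ cong₂ _+_ (+-comm 1# x) (sym (R.-‿+-comm 1# y)) ⟩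
        (x + 1#) + (- 1# + - y)     ≡⟨ +-assoc x 1# _ ⟩
        x + (1# + (- 1# + - y))     ≡⟨ cong (x +_) (sym (+-assoc 1# (- 1#) (- y))) ⟩
        x + ((1# + - 1#) + - y)     ≡⟨ cong (λ z → x + (z + - y)) (-‿inverseʳ 1#) ⟩
        x + (0# + - y)              ≡⟨ cong (x +_) (+-identityˡ _) ⟩
        x + - y                     ∎)

      ιℤ-⊖ : ∀ m n → ιℤ (m ℤ.⊖ n) ≡ ι m + - ι n
      ιℤ-⊖ m       zero    = sym (trans (cong (ι m +_) R.-0#≈0#) (+-identityʳ _))
      ιℤ-⊖ zero    (suc n) = sym (+-identityˡ _)
      ιℤ-⊖ (suc m) (suc n) = begin
        ιℤ (suc m ℤ.⊖ suc n)    ≡⟨ cong ιℤ (ℤₚ.[1+m]⊖[1+n]≡m⊖n m n) ⟩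
        ιℤ (m ℤ.⊖ n)            ≡⟨ ιℤ-⊖ m n ⟩
        ι m + - ι n             ≡⟨ cancel-1 _ _ ⟩
        ι (suc m) + - ι (suc n) ∎

      ιℤ-+ : ∀ i j → ιℤ (i ℤ.+ j) ≡ ιℤ i + ιℤ j
      ιℤ-+ (pos m)    (pos n)    = ι-+ m n
      ιℤ-+ (pos m)    -[1+ n ] = ιℤ-⊖ m (suc n)
      ιℤ-+ -[1+ m ] (pos n)    = trans (ιℤ-⊖ n (suc m)) (+-comm _ _)
      ιℤ-+ -[1+ m ] -[1+ n ] = begin
        - ι (suc (suc (m ℕ.+ n)))       ≡⟨ cong (λ k → - ι k) (sym (ℕₚ.+-suc (suc m) n)) ⟩
        - ι (suc m ℕ.+ suc n)           ≡⟨ cong -_ (ι-+ (suc m) (suc n)) ⟩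
        - (ι (suc m) + ι (suc n))       ≡⟨ sym (R.-‿+-comm _ _) ⟩
        - ι (suc m) + - ι (suc n)       ∎

      ιℤ-neg : ∀ i → ιℤ (ℤ.- i) ≡ - ιℤ i
      ιℤ-neg (pos zero)  = sym R.-0#≈0#
      ιℤ-neg (pos (suc n)) = refl
      ιℤ-neg -[1+ n ]  = sym (R.-‿involutive _)

      ιℤ-*-pos : ∀ m j → ιℤ (pos m ℤ.* j) ≡ ι m * ιℤ j
      ιℤ-*-pos m (pos n)    = trans (cong ιℤ (sym (ℤₚ.pos-* m n))) (ι-* m n)
      ιℤ-*-pos m -[1+ n ] = begin
        ιℤ (pos m ℤ.* ℤ.- (pos (suc n)))     ≡⟨ cong ιℤ (sym (ℤₚ.neg-distribʳ-* (pos m) (pos (suc n)))) ⟩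
        ιℤ (ℤ.- (pos m ℤ.* pos (suc n)))     ≡⟨ ιℤ-neg (pos m ℤ.* pos (suc n)) ⟩
        - ιℤ (pos m ℤ.* pos (suc n))         ≡⟨ cong -_ (ιℤ-*-pos m (pos (suc n))) ⟩
        - (ι m * ι (suc n))            ≡⟨ R.-‿distribʳ-* _ _ ⟩
        ι m * - ι (suc n)              ∎

      ιℤ-* : ∀ i j → ιℤ (i ℤ.* j) ≡ ιℤ i * ιℤ j
      ιℤ-* (pos m)    j = ιℤ-*-pos m j
      ιℤ-* -[1+ m ] j = begin
        ιℤ (ℤ.- (pos (suc m)) ℤ.* j)       ≡⟨ cong ιℤ (sym (ℤₚ.neg-distribˡ-* (pos (suc m)) j)) ⟩
        ιℤ (ℤ.- (pos (suc m) ℤ.* j))       ≡⟨ ιℤ-neg (pos (suc m) ℤ.* j) ⟩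
        - ιℤ (pos (suc m) ℤ.* j)           ≡⟨ cong -_ (ιℤ-*-pos (suc m) j) ⟩
        - (ι (suc m) * ιℤ j)           ≡⟨ R.-‿distribˡ-* _ _ ⟩
        - ι (suc m) * ιℤ j             ∎

      almostCommutativeRing : AlmostCommutativeRing _ _
      almostCommutativeRing = fromCommutativeRing commutativeRing

      ℤ⟶𝔽 : CommutativeRing.rawRing ℤₚ.+-*-commutativeRing -Raw-AlmostCommutative⟶ almostCommutativeRing
      ℤ⟶𝔽 = record
        { ⟦_⟧ = ιℤ ; +-homo = ιℤ-+ ; *-homo = ιℤ-* ; -‿homo = ιℤ-neg
        ; 0-homo = refl ; 1-homo = +-identityʳ 1# }

      ιℤ-≟ : ∀ i j → Maybe (ιℤ i ≡ ιℤ j)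
      ιℤ-≟ i j with i ℤ.≟ j
      ... | yes eq = just (cong ιℤ eq)
      ... | no  _  = nothing

    open RingSolver (CommutativeRing.rawRing ℤₚ.+-*-commutativeRing) almostCommutativeRing ℤ⟶𝔽 ιℤ-≟ public
      using (solve; _:=_; _:+_; _:*_; _:-_; :-_; con)

    *-cancel-0 : ∀ {x y} → x ≢ 0# → x * y ≡ 0# → y ≡ 0#
    *-cancel-0 {x} {y} x≢0 xy≡0 with x⁻¹ , xx⁻¹≡1 ← inverse x x≢0 = begin
      y               ≡⟨ sym (*-identityˡ y) ⟩
      1# * y          ≡⟨ cong (_* y) (sym xx⁻¹≡1) ⟩
      x * x⁻¹ * y     ≡⟨ solve 3 (λ x z y → x :* z :* y := z :* (x :* y)) refl x x⁻¹ y ⟩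
      x⁻¹ * (x * y)   ≡⟨ cong (x⁻¹ *_) xy≡0 ⟩
      x⁻¹ * 0#        ≡⟨ zeroʳ x⁻¹ ⟩
      0#              ∎

    *-≢0 : ∀ {x y} → x ≢ 0# → y ≢ 0# → x * y ≢ 0#
    *-≢0 x≢0 y≢0 xy≡0 = y≢0 (*-cancel-0 x≢0 xy≡0)

    x-y≡0⇒x≡y : ∀ {x y} → x + - y ≡ 0# → x ≡ y
    x-y≡0⇒x≡y {x} {y} eq = begin
      x               ≡⟨ solve 2 (λ x y → x := x :- y :+ y) refl x y ⟩
      x + - y + y     ≡⟨ cong (_+ y) eq ⟩
      0# + y          ≡⟨ +-identityˡ y ⟩
      y               ∎

    affine-injective : ∀ {c m x y} → m ≢ 0# → c + m * x ≡ c + m * y → x ≡ y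
    affine-injective {c} {m} {x} {y} m≢0 eq = x-y≡0⇒x≡y (*-cancel-0 m≢0 (begin
      m * (x + - y)                 ≡⟨ solve 4 (λ c m x y → m :* (x :- y) := c :+ m :* x :- (c :+ m :* y)) refl c m x y ⟩
      c + m * x + - (c + m * y)     ≡⟨ cong (_+ - (c + m * y)) eq ⟩
      c + m * y + - (c + m * y)     ≡⟨ -‿inverseʳ _ ⟩
      0#                            ∎))

    affine-constant : ∀ {c m} → m ≡ 0# → ∀ x → c + m * x ≡ c
    affine-constant {c} refl x = trans (cong (c +_) (zeroˡ x)) (+-identityʳ c)

  -- Linear algebra: nontrivial solutions of underdetermined systems.

  module Sums (𝔽 : Field) where
    open FieldTheory 𝔽
    open ≡-Reasoning

    Σ : ∀ n → (Fin n → Carrier) → Carrier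
    Σ zero    f = 0#
    Σ (suc n) f = f zero + Σ n (f ∘ suc)

    Σ-cong : ∀ n {f g} → (∀ i → f i ≡ g i) → Σ n f ≡ Σ n g
    Σ-cong zero    eq = refl
    Σ-cong (suc n) eq = cong₂ _+_ (eq zero) (Σ-cong n (eq ∘ suc))

    Σ-zero : ∀ n {f} → (∀ i → f i ≡ 0#) → Σ n f ≡ 0#
    Σ-zero zero    eq = refl
    Σ-zero (suc n) eq = trans (cong₂ _+_ (eq zero) (Σ-zero n (eq ∘ suc))) (+-identityˡ 0#)

    Σ-+ : ∀ n f g → Σ n (λ i → f i + g i) ≡ Σ n f + Σ n g
    Σ-+ zero    f g = sym (+-identityˡ 0#)
    Σ-+ (suc n) f g = trans (cong (f zero + g zero +_) (Σ-+ n (f ∘ suc) (g ∘ suc)))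
      (solve 4 (λ a b c d → a :+ b :+ (c :+ d) := a :+ c :+ (b :+ d)) refl (f zero) (g zero) _ _)

    Σ-*ˡ : ∀ n c f → Σ n (λ i → c * f i) ≡ c * Σ n f
    Σ-*ˡ zero    c f = sym (zeroʳ c)
    Σ-*ˡ (suc n) c f = trans (cong (c * f zero +_) (Σ-*ˡ n c (f ∘ suc))) (sym (distribˡ c _ _))

    Σ-split : ∀ m n f → Σ (m ℕ.+ n) f ≡ Σ m (λ i → f (i ↑ˡ n)) + Σ n (λ j → f (m ↑ʳ j))
    Σ-split zero    n f = sym (+-identityˡ _)
    Σ-split (suc m) n f = trans (cong (f zero +_) (Σ-split m n (f ∘ suc))) (sym (+-assoc _ _ _))

    Σ-combine : ∀ m n f → Σ (m ℕ.* n) f ≡ Σ m (λ i → Σ n (λ j → f (combine i j)))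
    Σ-combine zero    n f = refl
    Σ-combine (suc m) n f = trans (Σ-split n (m ℕ.* n) f)
      (cong (Σ n (λ j → f (j ↑ˡ (m ℕ.* n))) +_) (Σ-combine m n (λ k → f (n ↑ʳ k))))

    -- One step of fraction-free Gaussian elimination.
    module Elimination {m n} (R : Fin (suc m) → Fin (suc n) → Carrier) (k₀ : Fin (suc m)) where
      pivot : Carrier
      pivot = R k₀ zero

      eliminated : Fin m → Fin n → Carrier
      eliminated k i = pivot * R (punchIn k₀ k) (suc i) + - (R (punchIn k₀ k) zero * R k₀ (suc i))

      module _ (x : Fin n → Carrier) where
        tail : Fin (suc m) → Carrier
        tail k = Σ n (λ i → R k (suc i) * x i)

        -- Scaling the old solution by `pivot` avoids division; the new first entry is then what the
        -- pivot row requires.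
        extended : Fin (suc n) → Carrier
        extended zero    = - tail k₀
        extended (suc i) = pivot * x i

        extended-row : ∀ k → Σ (suc n) (λ i → R k i * extended i) ≡ R k zero * - tail k₀ + pivot * tail k
        extended-row k = cong (R k zero * - tail k₀ +_) (trans
          (Σ-cong n (λ i → solve 3 (λ r c x → r :* (c :* x) := c :* (r :* x)) refl (R k (suc i)) pivot (x i)))
          (Σ-*ˡ n pivot _))

        eliminated-row : ∀ k → Σ n (λ i → eliminated k i * x i) ≡
          pivot * tail (punchIn k₀ k) + - R (punchIn k₀ k) zero * tail k₀
        eliminated-row k = trans
          (Σ-cong n (λ i → solve 5 (λ c r s q x →
            (c :* r :- s :* q) :* x := c :* (r :* x) :+ :- s :* (q :* x)) refl
            pivot (R (punchIn k₀ k) (suc i)) (R (punchIn k₀ k) zero) (R k₀ (suc i)) (x i)))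
          (trans (Σ-+ n _ _) (cong₂ _+_ (Σ-*ˡ n pivot _) (Σ-*ˡ n (- R (punchIn k₀ k) zero) _)))

        extended-orthogonal : (∀ k → Σ n (λ i → eliminated k i * x i) ≡ 0#) →
          ∀ k → Σ (suc n) (λ i → R k i * extended i) ≡ 0#
        extended-orthogonal orthogonal k with k₀ Finₚ.≟ k
        ... | yes refl = trans (extended-row k₀)
          (solve 2 (λ c p → c :* :- p :+ c :* p := con (pos 0)) refl pivot (tail k₀))
        ... | no k₀≢k  = trans (extended-row k) (trans
          (solve 4 (λ r p c q → r :* :- p :+ c :* q := c :* q :+ :- r :* p) refl (R k zero) (tail k₀) pivot (tail k))
          (subst (λ k → pivot * tail k + - R k zero * tail k₀ ≡ 0#) (Finₚ.punchIn-punchOut k₀≢k)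
            (trans (sym (eliminated-row (punchOut k₀≢k))) (orthogonal (punchOut k₀≢k)))))

    -- If the first column vanishes, the first unit vector is a solution. Otherwise elimination with
    -- a pivot removes one equation and one unknown, which preserves the strict inequality.
    kernel : ∀ {m n} → m ℕ.< n → (R : Fin m → Fin n → Carrier) →
      ∃ λ (x : Fin n → Carrier) → (∃ λ i → x i ≢ 0#) × (∀ k → Σ n (λ i → R k i * x i) ≡ 0#)
    kernel {m} {suc n} m<n R with Finₚ.any? (λ k → ¬? (R k zero ≟ 0#))
    ... | no ¬pivot = e₀ , (zero , 1≢0) , orthogonal
      where
      e₀ : Fin (suc n) → Carrier
      e₀ zero    = 1#
      e₀ (suc i) = 0#
      orthogonal : ∀ k → Σ (suc n) (λ i → R k i * e₀ i) ≡ 0#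
      orthogonal k = begin
        R k zero * 1# + Σ n (λ i → R k (suc i) * 0#)  ≡⟨ cong₂ _+_ (*-identityʳ _) (Σ-zero n (λ i → zeroʳ _)) ⟩
        R k zero + 0#                                 ≡⟨ +-identityʳ _ ⟩
        R k zero                                      ≡⟨ decidable-stable (R k zero ≟ 0#) (λ ≢0 → ¬pivot (k , ≢0)) ⟩
        0#                                            ∎
    kernel {suc m} {suc n} (s≤s m<n) R | yes (k₀ , pivot≢0)
      with x , (i , xᵢ≢0) , orthogonal ← kernel m<n (Elimination.eliminated R k₀) =
        extended x , (suc i , *-≢0 pivot≢0 xᵢ≢0) , extended-orthogonal x orthogonal
      where open Elimination R k₀

  -- Polynomials in one variable with their formal derivatives.

  module Polynomials (𝔽 : Field) where
    open FieldTheory 𝔽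
    open Sums 𝔽
    open ≡-Reasoning

    eval eval′ : List Carrier → Carrier → Carrier
    eval []       x = 0#
    eval (c ∷ cs) x = c + x * eval cs x
    eval′ []       x = 0#
    eval′ (c ∷ cs) x = eval cs x + x * eval′ cs x

    infixl 6 _⊞_
    _⊞_ : List Carrier → List Carrier → List Carrier
    []       ⊞ ds       = ds
    (c ∷ cs) ⊞ []       = c ∷ cs
    (c ∷ cs) ⊞ (d ∷ ds) = c + d ∷ cs ⊞ ds

    infixl 7 _⊠_
    _⊠_ : List Carrier → List Carrier → List Carrier
    []       ⊠ ds = []
    (c ∷ cs) ⊠ ds = map (c *_) ds ⊞ (0# ∷ cs ⊠ ds)

    derivative : List Carrier → List Carrier
    derivative []       = []
    derivative (c ∷ cs) = cs ⊞ (0# ∷ derivative cs)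

    eval-⊞ : ∀ cs ds x → eval (cs ⊞ ds) x ≡ eval cs x + eval ds x
    eval-⊞ []       ds       x = sym (+-identityˡ _)
    eval-⊞ (c ∷ cs) []       x = sym (+-identityʳ _)
    eval-⊞ (c ∷ cs) (d ∷ ds) x = trans (cong (λ t → c + d + x * t) (eval-⊞ cs ds x))
      (solve 5 (λ c d x p q → c :+ d :+ x :* (p :+ q) := c :+ x :* p :+ (d :+ x :* q)) refl c d x _ _)

    eval′-⊞ : ∀ cs ds x → eval′ (cs ⊞ ds) x ≡ eval′ cs x + eval′ ds x
    eval′-⊞ []       ds       x = sym (+-identityˡ _)
    eval′-⊞ (c ∷ cs) []       x = sym (+-identityʳ _)
    eval′-⊞ (c ∷ cs) (d ∷ ds) x = trans (cong₂ (λ s t → s + x * t) (eval-⊞ cs ds x) (eval′-⊞ cs ds x))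
      (solve 5 (λ x p q r s → p :+ q :+ x :* (r :+ s) := p :+ x :* r :+ (q :+ x :* s)) refl x _ _ _ _)

    eval-scale : ∀ c ds x → eval (map (c *_) ds) x ≡ c * eval ds x
    eval-scale c []       x = sym (zeroʳ c)
    eval-scale c (d ∷ ds) x = trans (cong (λ t → c * d + x * t) (eval-scale c ds x))
      (solve 4 (λ c d x p → c :* d :+ x :* (c :* p) := c :* (d :+ x :* p)) refl c d x _)

    eval′-scale : ∀ c ds x → eval′ (map (c *_) ds) x ≡ c * eval′ ds x
    eval′-scale c []       x = sym (zeroʳ c)
    eval′-scale c (d ∷ ds) x = trans (cong₂ (λ s t → s + x * t) (eval-scale c ds x) (eval′-scale c ds x))
      (solve 4 (λ c x p q → c :* p :+ x :* (c :* q) := c :* (p :+ x :* q)) refl c x _ _)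

    eval-⊠ : ∀ cs ds x → eval (cs ⊠ ds) x ≡ eval cs x * eval ds x
    eval-⊠ []       ds x = sym (zeroˡ _)
    eval-⊠ (c ∷ cs) ds x = trans (eval-⊞ (map (c *_) ds) _ x)
      (trans (cong₂ (λ s t → s + (0# + x * t)) (eval-scale c ds x) (eval-⊠ cs ds x))
      (solve 4 (λ c x p q → c :* q :+ (con (pos 0) :+ x :* (p :* q)) := (c :+ x :* p) :* q) refl c x _ _))

    eval′-⊠ : ∀ cs ds x → eval′ (cs ⊠ ds) x ≡ eval′ cs x * eval ds x + eval cs x * eval′ ds x
    eval′-⊠ []       ds x = solve 2 (λ p q → con (pos 0) := con (pos 0) :* p :+ con (pos 0) :* q) refl _ _
    eval′-⊠ (c ∷ cs) ds x = trans (eval′-⊞ (map (c *_) ds) _ x)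
      (trans (cong₂ _+_ (eval′-scale c ds x) (cong₂ (λ s t → s + x * t) (eval-⊠ cs ds x) (eval′-⊠ cs ds x)))
      (solve 6 (λ c x p p′ q q′ → c :* q′ :+ (p :* q :+ x :* (p′ :* q :+ p :* q′))
         := (p :+ x :* p′) :* q :+ (c :+ x :* p) :* q′) refl c x (eval cs x) _ _ _))

    eval-derivative : ∀ cs x → eval (derivative cs) x ≡ eval′ cs x
    eval-derivative []       x = refl
    eval-derivative (c ∷ cs) x = trans (eval-⊞ cs _ x)
      (cong (eval cs x +_) (trans (+-identityˡ _) (cong (x *_) (eval-derivative cs x))))

    length-⊞ : ∀ {n} cs ds → length cs ℕ.≤ n → length ds ℕ.≤ n → length (cs ⊞ ds) ℕ.≤ n
    length-⊞ []       ds       p       q       = q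
    length-⊞ (c ∷ cs) []       p       q       = p
    length-⊞ (c ∷ cs) (d ∷ ds) (s≤s p) (s≤s q) = s≤s (length-⊞ cs ds p q)

    length-⊠ : ∀ {m n} cs ds → length cs ℕ.≤ m → length ds ℕ.≤ suc n → length (cs ⊠ ds) ℕ.≤ m ℕ.+ n
    length-⊠ []       ds p q = z≤n
    length-⊠ {suc m} {n} (c ∷ cs) ds (s≤s p) q = length-⊞ (map (c *_) ds) _
      (ℕₚ.≤-trans (ℕₚ.≤-reflexive (length-map (c *_) ds)) (ℕₚ.≤-trans q (s≤s (ℕₚ.m≤n+m n m))))
      (s≤s (length-⊠ cs ds p q))

    length-derivative : ∀ cs → length (derivative cs) ℕ.≤ length cs
    length-derivative []       = z≤n
    length-derivative (c ∷ cs) = length-⊞ cs _ (ℕₚ.n≤1+n _) (s≤s (length-derivative cs))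

    -- (x · eval cs x − r · eval cs r) / (x − r)
    quotient : Carrier → List Carrier → List Carrier
    quotient r []       = []
    quotient r (c ∷ cs) = eval (c ∷ cs) r ∷ quotient r cs

    length-quotient : ∀ r cs → length (quotient r cs) ≡ length cs
    length-quotient r []       = refl
    length-quotient r (c ∷ cs) = cong suc (length-quotient r cs)

    quotient-* : ∀ r cs x → (x + - r) * eval (quotient r cs) x ≡ x * eval cs x + - (r * eval cs r)
    quotient-* r []       x = solve 2 (λ x r → (x :- r) :* con (pos 0) := x :* con (pos 0) :- r :* con (pos 0)) refl x r
    quotient-* r (c ∷ cs) x = begin
      (x + - r) * (eval (c ∷ cs) r + x * eval (quotient r cs) x)
        ≡⟨ solve 4 (λ x r e q → (x :- r) :* (e :+ x :* q) := (x :- r) :* e :+ x :* ((x :- r) :* q)) refl x r _ _ ⟩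
      (x + - r) * eval (c ∷ cs) r + x * ((x + - r) * eval (quotient r cs) x)
        ≡⟨ cong (λ t → (x + - r) * eval (c ∷ cs) r + x * t) (quotient-* r cs x) ⟩
      _ ≡⟨ solve 5 (λ x r c p q → (x :- r) :* (c :+ r :* q) :+ x :* (x :* p :- r :* q)
             := x :* (c :+ x :* p) :- r :* (c :+ r :* q)) refl x r c (eval cs x) (eval cs r) ⟩
      x * eval (c ∷ cs) x + - (r * eval (c ∷ cs) r) ∎

    eval-zeros : ∀ {cs} → All (_≡ 0#) cs → ∀ x → eval cs x ≡ 0#
    eval-zeros []            x = refl
    eval-zeros (refl ∷ zs) x = trans (cong (λ t → 0# + x * t) (eval-zeros zs x)) (trans (+-identityˡ _) (zeroʳ x))

    eval′-zeros : ∀ {cs} → All (_≡ 0#) cs → ∀ x → eval′ cs x ≡ 0#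
    eval′-zeros []           x = refl
    eval′-zeros (_ ∷ zs) x = trans (cong₂ (λ s t → s + x * t) (eval-zeros zs x) (eval′-zeros zs x))
      (trans (+-identityˡ _) (zeroʳ x))

    -- Division is undone from the leading coefficient downwards: once the tail is zero, the head of
    -- the quotient is `c` itself.
    quotient-zeros : ∀ r cs → All (_≡ 0#) (quotient r cs) → All (_≡ 0#) cs
    quotient-zeros r []       []            = []
    quotient-zeros r (c ∷ cs) (eq ∷ zeros) = c≡0 ∷ zeros′
      where
      zeros′ : All (_≡ 0#) cs
      zeros′ = quotient-zeros r cs zeros
      c≡0 : c ≡ 0#
      c≡0 = trans (sym (trans (cong (λ t → c + r * t) (eval-zeros zeros′ r))
        (solve 2 (λ c r → c :+ r :* con (pos 0) := c) refl c r))) eq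

    -- Each root is divided out; the remaining ones stay roots of the quotient because x - r is
    -- nonzero there.
    roots⇒zeros : ∀ cs rs → Unique rs → All (λ r → eval cs r ≡ 0#) rs → length cs ℕ.≤ length rs → All (_≡ 0#) cs
    roots⇒zeros []       rs       _            _              _       = []
    roots⇒zeros (c ∷ cs) (r ∷ rs) (r∉rs ∷ !rs) (r-root ∷ roots) (s≤s le) = c≡0 ∷ zeros
      where
      root-of-quotient : ∀ {s} → r ≢ s → eval (c ∷ cs) s ≡ 0# → eval (quotient r cs) s ≡ 0#
      root-of-quotient {s} r≢s s-root = *-cancel-0 (λ s-r≡0 → r≢s (sym (x-y≡0⇒x≡y s-r≡0))) (begin
        (s + - r) * eval (quotient r cs) s      ≡⟨ quotient-* r cs s ⟩
        s * eval cs s + - (r * eval cs r)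
          ≡⟨ solve 3 (λ c p q → p :- q := c :+ p :- (c :+ q)) refl c _ _ ⟩
        eval (c ∷ cs) s + - eval (c ∷ cs) r     ≡⟨ cong₂ (λ p q → p + - q) s-root r-root ⟩
        0# + - 0#                               ≡⟨ -‿inverseʳ 0# ⟩
        0#                                      ∎)
      zeros : All (_≡ 0#) cs
      zeros = quotient-zeros r cs (roots⇒zeros (quotient r cs) rs !rs
        (All.zipWith (λ (r≢s , s-root) → root-of-quotient r≢s s-root) (r∉rs , roots))
        (ℕₚ.≤-trans (ℕₚ.≤-reflexive (length-quotient r cs)) le))
      c≡0 : c ≡ 0#
      c≡0 = trans (sym (trans (cong (λ t → c + r * t) (eval-zeros zeros r))
        (solve 2 (λ c r → c :+ r :* con (pos 0) := c) refl c r))) r-root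

    -- f′ is the derivative of the coefficient list: over a finite field the function f alone does not determine it.
    record Poly (d : ℕ) (f f′ : Carrier → Carrier) : Set where
      constructor poly
      field
        coefficients : List Carrier
        degree       : length coefficients ℕ.≤ suc d
        evaluation   : ∀ x → f x ≡ eval coefficients x
        derivation   : ∀ x → f′ x ≡ eval′ coefficients x

    Poly-cong : ∀ {d f f′ g g′} → (∀ x → g x ≡ f x) → (∀ x → g′ x ≡ f′ x) → Poly d f f′ → Poly d g g′
    Poly-cong g≗f g′≗f′ (poly c d e e′) = poly c d (λ x → trans (g≗f x) (e x)) (λ x → trans (g′≗f′ x) (e′ x))

    Poly-weaken : ∀ {d e f f′} → d ℕ.≤ e → Poly d f f′ → Poly e f f′
    Poly-weaken d≤e (poly c d e e′) = poly c (ℕₚ.≤-trans d (s≤s d≤e)) e e′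

    Poly-const : ∀ {d} c → Poly d (λ _ → c) (λ _ → 0#)
    Poly-const c = poly (c ∷ []) (s≤s z≤n)
      (λ x → solve 2 (λ c x → c := c :+ x :* con (pos 0)) refl c x)
      (λ x → solve 1 (λ x → con (pos 0) := con (pos 0) :+ x :* con (pos 0)) refl x)

    Poly-linear : ∀ c a → Poly 1 (λ x → c + a * x) (λ _ → a)
    Poly-linear c a = poly (c ∷ a ∷ []) (s≤s (s≤s z≤n))
      (λ x → solve 3 (λ c a x → c :+ a :* x := c :+ x :* (a :+ x :* con (pos 0))) refl c a x)
      (λ x → solve 2 (λ a x → a := a :+ x :* con (pos 0) :+ x :* (con (pos 0) :+ x :* con (pos 0))) refl a x)

    Poly-+ : ∀ {d f f′ g g′} → Poly d f f′ → Poly d g g′ → Poly d (λ x → f x + g x) (λ x → f′ x + g′ x)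
    Poly-+ (poly c d e e′) (poly c₁ d₁ e₁ e₁′) = poly (c ⊞ c₁) (length-⊞ c c₁ d d₁)
      (λ x → trans (cong₂ _+_ (e x) (e₁ x)) (sym (eval-⊞ c c₁ x)))
      (λ x → trans (cong₂ _+_ (e′ x) (e₁′ x)) (sym (eval′-⊞ c c₁ x)))

    Poly-* : ∀ {d₁ d₂ f f′ g g′} → Poly d₁ f f′ → Poly d₂ g g′ →
      Poly (d₁ ℕ.+ d₂) (λ x → f x * g x) (λ x → f′ x * g x + f x * g′ x)
    Poly-* (poly c d e e′) (poly c₁ d₁ e₁ e₁′) = poly (c ⊠ c₁) (length-⊠ c c₁ d d₁)
      (λ x → trans (cong₂ _*_ (e x) (e₁ x)) (sym (eval-⊠ c c₁ x)))
      (λ x → trans (cong₂ _+_ (cong₂ _*_ (e′ x) (e₁ x)) (cong₂ _*_ (e x) (e₁′ x))) (sym (eval′-⊠ c c₁ x)))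

    Poly-scale : ∀ {d f f′} c → Poly d f f′ → Poly d (λ x → c * f x) (λ x → c * f′ x)
    Poly-scale c (poly cs d e e′) = poly (map (c *_) cs) (ℕₚ.≤-trans (ℕₚ.≤-reflexive (length-map (c *_) cs)) d)
      (λ x → trans (cong (c *_) (e x)) (sym (eval-scale c cs x)))
      (λ x → trans (cong (c *_) (e′ x)) (sym (eval′-scale c cs x)))

    Poly-neg : ∀ {d f f′} → Poly d f f′ → Poly d (λ x → - f x) (λ x → - f′ x)
    Poly-neg P = Poly-cong (λ x → neg _) (λ x → neg _) (Poly-scale (- 1#) P)
      where
      neg : ∀ x → - x ≡ - 1# * x
      neg x = trans (cong -_ (sym (*-identityˡ x))) (solve 2 (λ o x → :- (o :* x) := :- o :* x) refl 1# x)

    Poly-Σ : ∀ {d} n {f f′ : Fin n → Carrier → Carrier} → (∀ i → Poly d (f i) (f′ i)) →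
      Poly d (λ x → Σ n (λ i → f i x)) (λ x → Σ n (λ i → f′ i x))
    Poly-Σ zero    P = Poly-const 0#
    Poly-Σ (suc n) P = Poly-+ (P zero) (Poly-Σ n (P ∘ suc))

    -- It is the coefficients that vanish, so the formal derivative vanishes too. This is the device
    -- that turns zeros on a line into first-order information along it.
    Poly-vanish : ∀ {d f f′} → Poly d f f′ → ∀ rs → Unique rs → All (λ r → f r ≡ 0#) rs → d ℕ.< length rs →
      (∀ x → f x ≡ 0#) × (∀ x → f′ x ≡ 0#)
    Poly-vanish (poly c d e e′) rs !rs roots d<rs = (λ x → trans (e x) (eval-zeros zeros x)) , (λ x → trans (e′ x) (eval′-zeros zeros x))
      where
      zeros : All (_≡ 0#) c
      zeros = roots⇒zeros c rs !rs (All.map (λ {r} eq → trans (sym (e r)) eq) roots) (ℕₚ.≤-trans d d<rs)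

    -- Polynomials of degree below the characteristic.

    module Characteristic (q : ℕ) (char : ∀ {k} → 0 ℕ.< k → k ℕ.< q → ι k ≢ 0#) where

      ι-injective : ∀ {i j} → i ℕ.< j → j ℕ.< q → ι i ≢ ι j
      ι-injective {i} {j} i<j j<q eq = char (ℕₚ.m<n⇒0<n∸m i<j) (ℕₚ.≤-<-trans (ℕₚ.m∸n≤m j i) j<q) (begin
        ι (j ℕ.∸ i)               ≡⟨ solve 2 (λ k i → k := i :+ k :- i) refl (ι (j ℕ.∸ i)) (ι i) ⟩
        ι i + ι (j ℕ.∸ i) + - ι i ≡⟨ cong (_+ - ι i) (sym (ι-+ i (j ℕ.∸ i))) ⟩
        ι (i ℕ.+ (j ℕ.∸ i)) + - ι i ≡⟨ cong (λ k → ι k + - ι i) (ℕₚ.m+[n∸m]≡n (ℕₚ.<⇒≤ i<j)) ⟩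
        ι j + - ι i               ≡⟨ cong (λ t → t + - ι i) (sym eq) ⟩
        ι i + - ι i               ≡⟨ -‿inverseʳ _ ⟩
        0#                        ∎)

      nonzeros : ℕ → List Carrier
      nonzeros = applyUpTo (ι ∘ suc)

      nonzeros-unique : ∀ {n} → n ℕ.< q → Unique (nonzeros n)
      nonzeros-unique {n} n<q = Uniqueₚ.applyUpTo⁺₁ (ι ∘ suc) n
        (λ i<j j<n → ι-injective (s≤s i<j) (ℕₚ.≤-<-trans j<n n<q))

      nonzeros-≢0 : ∀ {n} → n ℕ.< q → All (_≢ 0#) (nonzeros n)
      nonzeros-≢0 {n} n<q = Allₚ.applyUpTo⁺₁ (ι ∘ suc) n (λ i<n → char (s≤s z≤n) (ℕₚ.≤-<-trans i<n n<q))

      -- Allows a factor `x` to be cancelled from an identity: the elements `ι 1`, ..., `ι (suc d)`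
      -- are distinct, nonzero and enough in number.
      Poly-vanish-0 : ∀ {d f f′} → Poly d f f′ → suc d ℕ.< q → (∀ x → x ≢ 0# → f x ≡ 0#) → ∀ x → f x ≡ 0#
      Poly-vanish-0 {d} P d<q away = proj₁ (Poly-vanish P (nonzeros (suc d)) (nonzeros-unique d<q)
        (All.map (λ {x} → away x) (nonzeros-≢0 d<q)) (ℕₚ.≤-reflexive (sym (length-applyUpTo (ι ∘ suc) (suc d)))))

      -- Decided by d + 1 test points, so the field itself need not be enumerated.
      Poly-zero? : ∀ {d f f′} → Poly d f f′ → suc d ℕ.< q → (∀ x → f x ≡ 0#) ⊎ (∃ λ x → f x ≢ 0#)
      Poly-zero? {d} {f} P d<q with All.all? (λ x → f x ≟ 0#) (nonzeros (suc d))
      ... | yes roots = inj₁ (proj₁ (Poly-vanish P (nonzeros (suc d)) (nonzeros-unique d<q) roots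
                          (ℕₚ.≤-reflexive (sym (length-applyUpTo (ι ∘ suc) (suc d))))))
      ... | no ¬roots = inj₂ (_ , proj₂ (proj₂ (find (Allₚ.¬All⇒Any¬ (λ x → f x ≟ 0#) _ ¬roots))))

      -- If H = xʳ (c + …), the coefficient of xʳ⁻¹ in H′ M − H P is r c M(0); as 0 < r < q this forces c = 0.
      private
        ode-coefficients : ∀ {e M M′ P P′} → Poly e M M′ → Poly e P P′ → M 0# ≢ 0# →
          ∀ r cs → suc (suc (length cs ℕ.+ e)) ℕ.< q → suc r ℕ.+ length cs ℕ.≤ q →
          (∀ x → (ι (suc r) * eval cs x + x * eval′ cs x) * M x ≡ x * eval cs x * P x) → All (_≡ 0#) cs
        ode-coefficients pM pP M0≢0 r [] bound bound′ eq = []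
        ode-coefficients {e} {M} {M′} {P} {P′} pM pP M0≢0 r (c ∷ cs) bound bound′ eq = c≡0 ∷
          ode-coefficients pM pP M0≢0 (suc r) cs (ℕₚ.<-trans (ℕₚ.n<1+n _) bound)
            (subst (ℕ._≤ q) (ℕₚ.+-suc (suc r) (length cs)) bound′) (λ x → x-y≡0⇒x≡y (reduced x))
          where
          r≢0 : ι (suc r) ≢ 0#
          r≢0 = char (s≤s z≤n) (ℕₚ.<-≤-trans (ℕₚ.m<m+n (suc r) (s≤s z≤n)) bound′)
          c≡0 : c ≡ 0#
          c≡0 = *-cancel-0 r≢0 (*-cancel-0 M0≢0 (begin
            M 0# * (ι (suc r) * c)
              ≡⟨ solve 6 (λ m r c p q s → m :* (r :* c)
                   := (r :* (c :+ con (pos 0) :* p) :+ con (pos 0) :* q) :* m) refl (M 0#) (ι (suc r)) c (eval cs 0#) (eval′ (c ∷ cs) 0#) 0# ⟩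
            (ι (suc r) * eval (c ∷ cs) 0# + 0# * eval′ (c ∷ cs) 0#) * M 0#
              ≡⟨ eq 0# ⟩
            0# * eval (c ∷ cs) 0# * P 0#
              ≡⟨ solve 2 (λ p q → con (pos 0) :* p :* q := con (pos 0)) refl _ _ ⟩
            0# ∎))
          -- The same equation one power of `x` higher: since `c` is zero, the given equation is `x`
          -- times this one.
          difference : Carrier → Carrier
          difference x = (ι (suc (suc r)) * eval cs x + x * eval′ cs x) * M x + - (x * eval cs x * P x)
          away : ∀ x → x ≢ 0# → difference x ≡ 0#
          away x x≢0 = *-cancel-0 x≢0 (begin
            x * difference x
              ≡⟨ solve 7 (λ o x r g g′ m p →
                   x :* (((o :+ r) :* g :+ x :* g′) :* m :- x :* g :* p) :=
                   (r :* (con (pos 0) :+ x :* g) :+ x :* (o :* g :+ x :* g′)) :* m :- x :* (con (pos 0) :+ x :* g) :* p)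
                   refl 1# x (ι (suc r)) (eval cs x) (eval′ cs x) (M x) (P x) ⟩
            (ι (suc r) * (0# + x * eval cs x) + x * (1# * eval cs x + x * eval′ cs x)) * M x
              + - (x * (0# + x * eval cs x) * P x)
              ≡⟨ cong₂ (λ c g → (ι (suc r) * (c + x * eval cs x) + x * (g + x * eval′ cs x)) * M x
                   + - (x * (c + x * eval cs x) * P x)) (sym c≡0) (*-identityˡ _) ⟩
            (ι (suc r) * eval (c ∷ cs) x + x * eval′ (c ∷ cs) x) * M x + - (x * eval (c ∷ cs) x * P x)
              ≡⟨ cong (_+ - (x * eval (c ∷ cs) x * P x)) (eq x) ⟩
            x * eval (c ∷ cs) x * P x + - (x * eval (c ∷ cs) x * P x)
              ≡⟨ -‿inverseʳ _ ⟩
            0# ∎)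
          n : ℕ
          n = length cs
          pG : Poly n (eval cs) (eval′ cs)
          pG = poly cs (ℕₚ.n≤1+n _) (λ _ → refl) (λ _ → refl)
          pG′ : Poly n (eval′ cs) (eval′ (derivative cs))
          pG′ = poly (derivative cs) (ℕₚ.≤-trans (length-derivative cs) (ℕₚ.n≤1+n _))
            (λ x → sym (eval-derivative cs x)) (λ _ → refl)
          pX : Poly 1 (λ x → x) (λ _ → 1#)
          pX = Poly-cong (λ x → trans (sym (*-identityˡ x)) (sym (+-identityˡ _))) (λ _ → refl) (Poly-linear 0# 1#)
          reduced : ∀ x → difference x ≡ 0#
          reduced = Poly-vanish-0 (Poly-+
              (Poly-* (Poly-+ (Poly-weaken (ℕₚ.n≤1+n n) (Poly-scale (ι (suc (suc r))) pG)) (Poly-* pX pG′)) pM)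
              (Poly-neg (Poly-* (Poly-* pX pG) pP)))
            (ℕₚ.<-trans (ℕₚ.n<1+n _) bound) away

      -- Uniqueness for a linear equation that is regular at 0, proved coefficient by coefficient.
      -- The degree bound is essential in characteristic p: for M = 1 and P = 0 the polynomial xᵖ is
      -- a nonzero solution.
      ode-unique : ∀ {d e H H′ M M′ P P′} → Poly d H H′ → Poly e M M′ → Poly e P P′ →
        suc (suc (d ℕ.+ e)) ℕ.< q → (∀ x → H′ x * M x ≡ H x * P x) → M 0# ≢ 0# → H 0# ≡ 0# → ∀ x → H x ≡ 0#
      ode-unique (poly [] _ ev _) pM pP bound eq M0≢0 H0≡0 x = ev x
      ode-unique {d} {e} {H} {H′} {M} {M′} {P} (poly (c ∷ cs) (s≤s len) ev ev′) pM pP bound eq M0≢0 H0≡0 x =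
        trans (ev x) (eval-zeros (c≡0 ∷ zeros) x)
        where
        c≡0 : c ≡ 0#
        c≡0 = begin
          c                    ≡⟨ solve 2 (λ c t → c := c :+ con (pos 0) :* t) refl c _ ⟩
          c + 0# * eval cs 0#  ≡⟨ sym (ev 0#) ⟩
          H 0#                 ≡⟨ H0≡0 ⟩
          0#                   ∎
        zeros : All (_≡ 0#) cs
        zeros = ode-coefficients pM pP M0≢0 0 cs
          (ℕₚ.≤-<-trans (s≤s (s≤s (ℕₚ.+-monoˡ-≤ e len))) bound)
          (ℕₚ.≤-trans (s≤s len) (ℕₚ.≤-trans (s≤s (ℕₚ.≤-trans (ℕₚ.m≤m+n d e) (ℕₚ.n≤1+n _))) (ℕₚ.<⇒≤ bound)))
          (λ x → begin
            ((1# + 0#) * eval cs x + x * eval′ cs x) * M x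
              ≡⟨ cong (λ t → (t + x * eval′ cs x) * M x) (trans (cong (_* eval cs x) (+-identityʳ 1#)) (*-identityˡ _)) ⟩
            eval′ (c ∷ cs) x * M x            ≡⟨ cong (_* M x) (sym (ev′ x)) ⟩
            H′ x * M x                        ≡⟨ eq x ⟩
            H x * P x                         ≡⟨ cong (_* P x) (trans (ev x) (cong (_+ x * eval cs x) c≡0)) ⟩
            (0# + x * eval cs x) * P x        ≡⟨ cong (_* P x) (+-identityˡ _) ⟩
            x * eval cs x * P x               ∎)

  unique-map : ∀ {A B : Set} (f : A → B) {xs} → (∀ {x y} → x ∈ xs → y ∈ xs → f x ≡ f y → x ≡ y) →
    Unique xs → Unique (map f xs)
  unique-map f inj []           = []
  unique-map f inj (x∉xs ∷ !xs) =
    Allₚ.map⁺ (All.tabulate (λ y∈xs fx≡fy → All.lookup x∉xs y∈xs (inj (here refl) (there y∈xs) fx≡fy)))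
    ∷ unique-map f (λ x∈ y∈ → inj (there x∈) (there y∈)) !xs

  -- Bracketed like the degree of f · (g · k) as `Poly-*` builds it.
  treble : ℕ → ℕ
  treble n = n ℕ.+ (n ℕ.+ n)

  -- Polynomials in s, y, z and their partial derivatives along lines.

  module Jets (𝔽 : Field) (q : ℕ)
    (char : ∀ {k} → 0 ℕ.< k → k ℕ.< q → FieldTheory.ι 𝔽 k ≢ Field.0# 𝔽) where
    open FieldTheory 𝔽
    open Sums 𝔽
    open Polynomials 𝔽
    open Characteristic q char

    -- pw α i is the α-th derivative of xⁱ.
    pw : ℕ → ℕ → Carrier → Carrier
    pw zero    zero    x = 1#
    pw (suc α) zero    x = 0#
    pw zero    (suc i) x = x * pw zero i x
    pw (suc α) (suc i) x = x * pw (suc α) i x + ι (suc α) * pw α i x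

    pw-< : ∀ {α i} x → i ℕ.< α → pw α i x ≡ 0#
    pw-< {suc α} {zero}  x _         = refl
    pw-< {suc α} {suc i} x (s≤s i<α) =
      trans (cong₂ (λ s t → x * s + ι (suc α) * t) (pw-< x (ℕₚ.m<n⇒m<1+n i<α)) (pw-< x i<α))
      (solve 2 (λ x k → x :* con (pos 0) :+ k :* con (pos 0) := con (pos 0)) refl x _)

    pw-diagonal : ∀ {α} x → α ℕ.< q → pw α α x ≢ 0#
    pw-diagonal {zero}  x α<q eq = 1≢0 eq
    pw-diagonal {suc α} x α<q eq = *-≢0 (char (s≤s z≤n) α<q) (pw-diagonal x (ℕₚ.<-trans (ℕₚ.n<1+n α) α<q))
      (trans (sym (trans (cong (λ t → x * t + ι (suc α) * pw α α x) (pw-< x (ℕₚ.n<1+n α)))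
        (solve 2 (λ x t → x :* con (pos 0) :+ t := t) refl x _))) eq)

    Poly-pw : ∀ α i {u a} → Poly 1 u (λ _ → a) → Poly i (λ t → pw α i (u t)) (λ t → a * pw (suc α) i (u t))
    Poly-pw zero    zero    {a = a} U = Poly-cong (λ _ → refl) (λ _ → zeroʳ a) (Poly-const 1#)
    Poly-pw (suc α) zero    {a = a} U = Poly-cong (λ _ → refl) (λ _ → zeroʳ a) (Poly-const 0#)
    Poly-pw zero (suc i) {u} {a} U = Poly-cong (λ _ → refl)
      (λ t → solve 4 (λ a x p p′ → a :* (x :* p′ :+ con (pos 1) :* p) := a :* p :+ x :* (a :* p′)) refl
        a (u t) (pw zero i (u t)) (pw 1 i (u t)))
      (Poly-* U (Poly-pw zero i U))
    Poly-pw (suc α) (suc i) {u} {a} U = Poly-cong (λ _ → refl)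
      (λ t → trans (cong (λ k → a * (u t * pw (suc (suc α)) i (u t) + k * pw (suc α) i (u t))) (ι-+ 1 (suc α)))
        (solve 5 (λ a x p p′ k → a :* (x :* p′ :+ (con (pos 1) :+ k) :* p) := a :* p :+ x :* (a :* p′) :+ k :* (a :* p))
          refl a (u t) (pw (suc α) i (u t)) (pw (suc (suc α)) i (u t)) (ι (suc α))))
      (Poly-+ (Poly-* U (Poly-pw (suc α) i U))
              (Poly-weaken (ℕₚ.n≤1+n i) (Poly-scale (ι (suc α)) (Poly-pw α i U))))

    Σ-pw : ∀ n (c : Fin n → Carrier) t → Σ n (λ i → pw 0 (toℕ i) t * c i) ≡ eval (tabulate c) t
    Σ-pw zero    c t = refl
    Σ-pw (suc n) c t = cong₂ _+_ (*-identityˡ (c zero))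
      (trans (Σ-cong n (λ i → *-assoc t _ _)) (trans (Σ-*ˡ n t _) (cong (t *_) (Σ-pw n (c ∘ suc) t))))

    Σ-pw-roots : ∀ n (c : Fin n → Carrier) rs → Unique rs → n ℕ.≤ length rs →
      (∀ {t} → t ∈ rs → Σ n (λ i → pw 0 (toℕ i) t * c i) ≡ 0#) → ∀ i → c i ≡ 0#
    Σ-pw-roots n c rs !rs n≤rs roots = Allₚ.tabulate⁻ (roots⇒zeros (tabulate c) rs !rs
      (All.tabulate (λ {t} t∈rs → trans (sym (Σ-pw n c t)) (roots t∈rs)))
      (ℕₚ.≤-trans (ℕₚ.≤-reflexive (length-tabulate c)) n≤rs))

    Σ-single : ∀ n f (i : Fin n) → (∀ j → j ≢ i → f j ≡ 0#) → Σ n f ≡ f i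
    Σ-single (suc n) f zero    zs = trans (cong (f zero +_) (Σ-zero n (λ j → zs (suc j) (λ ())))) (+-identityʳ _)
    Σ-single (suc n) f (suc i) zs = trans (cong₂ _+_ (zs zero (λ ()))
      (Σ-single n (f ∘ suc) i (λ j j≢i → zs (suc j) (j≢i ∘ Finₚ.suc-injective)))) (+-identityˡ _)

    -- The system is triangular with the factorials γ! on the diagonal, which are nonzero below `q`.
    -- It is solved from the highest coefficient down; `descend m` covers the top `m` indices.
    taylor : ∀ n (c : Fin n → Carrier) z → n ℕ.≤ q →
      (∀ {γ} → γ ℕ.< n → Σ n (λ k → pw γ (toℕ k) z * c k) ≡ 0#) → ∀ k → c k ≡ 0#
    taylor n c z n≤q jets k = descend n k (ℕₚ.m≤n+m n (toℕ k))
      where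
      descend : ∀ m k → n ℕ.≤ toℕ k ℕ.+ m → c k ≡ 0#
      descend zero    k n≤k = contradiction (Finₚ.toℕ<n k) (ℕₚ.≤⇒≯ (subst (n ℕ.≤_) (ℕₚ.+-identityʳ _) n≤k))
      descend (suc m) k n≤k+1+m = *-cancel-0 (pw-diagonal z (ℕₚ.<-≤-trans (Finₚ.toℕ<n k) n≤q))
        (trans (sym (Σ-single n _ k others)) (jets (Finₚ.toℕ<n k)))
        where
        others : ∀ j → j ≢ k → pw (toℕ k) (toℕ j) z * c j ≡ 0#
        others j j≢k with ℕₚ.<-cmp (toℕ j) (toℕ k)
        ... | tri< j<k _ _ = trans (cong (_* c j) (pw-< z j<k)) (zeroˡ (c j))
        ... | tri≈ _ j≡k _ = contradiction (Finₚ.toℕ-injective j≡k) j≢k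
        ... | tri> _ _ k<j = trans (cong (_ *_) (descend m j
          (ℕₚ.≤-trans n≤k+1+m (subst (ℕ._≤ toℕ j ℕ.+ m) (sym (ℕₚ.+-suc (toℕ k) m)) (ℕₚ.+-monoˡ-≤ m k<j))))) (zeroʳ _)

    module Box (D : ℕ) (coeff : Fin D → Fin D → Fin D → Carrier) where

      Jy : ℕ → Fin D → Fin D → Carrier → Carrier
      Jy β k i y = Σ D (λ j → pw β (toℕ j) y * coeff k i j)

      Js : ℕ → ℕ → Fin D → Carrier → Carrier → Carrier
      Js α β k s y = Σ D (λ i → pw α (toℕ i) s * Jy β k i y)

      -- J α β γ = ∂ₛ^α ∂_y^β ∂_z^γ of Σ coeff k i j · sⁱ yʲ zᵏ.
      J : ℕ → ℕ → ℕ → Carrier → Carrier → Carrier → Carrier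
      J α β γ s y z = Σ D (λ k → pw γ (toℕ k) z * Js α β k s y)

      Poly-power : ∀ α (i : Fin D) {u a} → Poly 1 u (λ _ → a) →
        Poly D (λ t → pw α (toℕ i) (u t)) (λ t → a * pw (suc α) (toℕ i) (u t))
      Poly-power α i U = Poly-weaken (ℕₚ.<⇒≤ (Finₚ.toℕ<n i)) (Poly-pw α (toℕ i) U)

      module _ {s y z a b c} (S : Poly 1 s (λ _ → a)) (Y : Poly 1 y (λ _ → b)) (Z : Poly 1 z (λ _ → c)) where

        Poly-Jy : ∀ β k i → Poly D (λ t → Jy β k i (y t)) (λ t → b * Jy (suc β) k i (y t))
        Poly-Jy β k i = Poly-cong (λ _ → refl)
          (λ t → trans (sym (Σ-*ˡ D b _)) (Σ-cong D (λ j →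
            solve 3 (λ b p c → b :* (p :* c) := c :* (b :* p)) refl b _ _)))
          (Poly-Σ D (λ j → Poly-cong (λ t → *-comm _ _) (λ t → refl) (Poly-scale (coeff k i j) (Poly-power β j Y))))

        Poly-Js : ∀ α β k → Poly (D ℕ.+ D) (λ t → Js α β k (s t) (y t))
          (λ t → a * Js (suc α) β k (s t) (y t) + b * Js α (suc β) k (s t) (y t))
        Poly-Js α β k = Poly-cong (λ _ → refl)
          (λ t → sym (trans (Σ-+ D _ _) (cong₂ _+_
            (trans (Σ-cong D (λ i → *-assoc a _ _)) (Σ-*ˡ D a _))
            (trans (Σ-cong D (λ i → solve 3 (λ b p c → p :* (b :* c) := b :* (p :* c)) refl b _ _)) (Σ-*ˡ D b _)))))
          (Poly-Σ D (λ i → Poly-* (Poly-power α i S) (Poly-Jy β k i)))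

        Poly-J : ∀ α β γ → Poly (treble D) (λ t → J α β γ (s t) (y t) (z t))
          (λ t → c * J α β (suc γ) (s t) (y t) (z t) +
                 (a * J (suc α) β γ (s t) (y t) (z t) + b * J α (suc β) γ (s t) (y t) (z t)))
        Poly-J α β γ = Poly-cong (λ _ → refl)
          (λ t → sym (trans (Σ-+ D _ _) (cong₂ _+_
            (trans (Σ-cong D (λ k → *-assoc c _ _)) (Σ-*ˡ D c _))
            (trans (Σ-cong D (λ k → solve 5 (λ a b p x y → p :* (a :* x :+ b :* y) := a :* (p :* x) :+ b :* (p :* y)) refl a b _ _ _))
              (trans (Σ-+ D _ _) (cong₂ _+_ (Σ-*ˡ D a _) (Σ-*ˡ D b _)))))))
          (Poly-Σ D (λ k → Poly-* (Poly-power γ k Z) (Poly-Js α β k)))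

  -- The polynomial method for red and blue lines.

  module Incidence (𝔽 : Field) where
    open FieldTheory 𝔽
    open Sums 𝔽
    open Polynomials 𝔽

    -- `few-lines` compares the interpolation conditions, 1 + 3D for each red line, with the D³
    -- coefficients. `nb-large` asks for more crossings than the degree 9D of an expression cubic in
    -- partial derivatives.
    module Configuration (q : ℕ) (char : ∀ {k} → 0 ℕ.< k → k ℕ.< q → ι k ≢ 0#)
      {X : Set} (a v w : X → Carrier) (τ : Carrier) (V : List X) (nb : X → List X) (D : ℕ)
      (nb⊆V : ∀ {x x′} → x ∈ V → x′ ∈ nb x → x′ ∈ V)
      (crossing : ∀ {x x′} → x ∈ V → x′ ∈ nb x → a x * v x′ + a x′ * v x + (w x + w x′) ≡ 0#)
      (nb-unique : ∀ {x} → x ∈ V → Unique (nb x))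
      (s-injective : ∀ {x x₁ x₂} → x ∈ V → x₁ ∈ nb x → x₂ ∈ nb x →
        v x₁ + - (τ * a x₁) ≡ v x₂ + - (τ * a x₂) → x₁ ≡ x₂)
      (y-injective : ∀ {x x₁ x₂} → x ∈ V → x₁ ∈ nb x → x₂ ∈ nb x →
        v x₁ + τ * a x₁ ≡ v x₂ + τ * a x₂ → x₁ ≡ x₂)
      (nb-large : ∀ {x} → x ∈ V → treble (treble D) ℕ.< length (nb x))
      (q-large : 2 ℕ.+ treble (treble D) ℕ.< q)
      (few-lines : length V ℕ.* suc (treble D) ℕ.< D ℕ.* (D ℕ.* D))
      where
      open Characteristic q char
      open Jets 𝔽 q char
      open ≡-Reasoning

      private
        E : ℕ
        E = treble D

        s y : X → Carrier
        s x = v x + - (τ * a x)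
        y x = v x + τ * a x

        E≤3E : E ℕ.≤ treble E
        E≤3E = ℕₚ.m≤m+n E (E ℕ.+ E)

        D≤3E : D ℕ.≤ treble E
        D≤3E = ℕₚ.≤-trans (ℕₚ.m≤m+n D _) E≤3E

        1+E<q : suc E ℕ.< q
        1+E<q = ℕₚ.<-trans (s≤s (s≤s E≤3E)) q-large

      -- The red line of `x` meets the blue line of a neighbour `x′` at parameter `s x′`, and these
      -- parameters are distinct.
      vanish-at-s : ∀ {f f′ x} → Poly (treble E) f f′ → x ∈ V → (∀ {x′} → x′ ∈ nb x → f (s x′) ≡ 0#) →
        (∀ t → f t ≡ 0#) × (∀ t → f′ t ≡ 0#)
      vanish-at-s {x = x} P x∈V roots = Poly-vanish P (map s (nb x)) (unique-map s (s-injective x∈V) (nb-unique x∈V))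
        (Allₚ.map⁺ (All.tabulate roots)) (ℕₚ.<-≤-trans (nb-large x∈V) (ℕₚ.≤-reflexive (sym (length-map s (nb x)))))

      vanish-at-y : ∀ {f f′ x} → Poly (treble E) f f′ → x ∈ V → (∀ {x′} → x′ ∈ nb x → f (y x′) ≡ 0#) →
        (∀ t → f t ≡ 0#) × (∀ t → f′ t ≡ 0#)
      vanish-at-y {x = x} P x∈V roots = Poly-vanish P (map y (nb x)) (unique-map y (y-injective x∈V) (nb-unique x∈V))
        (Allₚ.map⁺ (All.tabulate roots)) (ℕₚ.<-≤-trans (nb-large x∈V) (ℕₚ.≤-reflexive (sym (length-map y (nb x)))))

      module Surface (coeff : Fin D → Fin D → Fin D → Carrier) where
        open Box D coeff

        -- Partial derivatives on the red line {(t, y x, w x + a x · t)} and on the blue line {(s x, t, − w x − a x · t)}.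
        -- The red line of x meets the blue line of x′ if and only if a x · v x′ + a x′ · v x + w x + w x′ = 0.
        red blue : ℕ → ℕ → ℕ → X → Carrier → Carrier
        red  α β γ x t = J α β γ t (y x) (w x + a x * t)
        blue α β γ x t = J α β γ (s x) t (- w x + - a x * t)

        -- Both heights contain the term - τ a a′, so τ cancels and `crossing` remains.
        heights : ∀ {x x′} → x ∈ V → x′ ∈ nb x → w x + a x * s x′ ≡ - w x′ + - a x′ * y x
        heights {x} {x′} x∈V x′∈nb = x-y≡0⇒x≡y (trans
          (solve 7 (λ a v w a′ v′ w′ τ → w :+ a :* (v′ :- τ :* a′) :- (:- w′ :+ :- a′ :* (v :+ τ :* a))
            := a :* v′ :+ a′ :* v :+ (w :+ w′)) refl (a x) (v x) (w x) (a x′) (v x′) (w x′) τ) (crossing x∈V x′∈nb))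

        heights′ : ∀ {x x′} → x ∈ V → x′ ∈ nb x → w x′ + a x′ * s x ≡ - w x + - a x * y x′
        heights′ {x} {x′} x∈V x′∈nb = x-y≡0⇒x≡y (trans
          (solve 7 (λ a v w a′ v′ w′ τ → w′ :+ a′ :* (v :- τ :* a) :- (:- w :+ :- a :* (v′ :+ τ :* a′))
            := a :* v′ :+ a′ :* v :+ (w :+ w′)) refl (a x) (v x) (w x) (a x′) (v x′) (w x′) τ) (crossing x∈V x′∈nb))

        blue⇒red : ∀ {x x′} (P : (ℕ → ℕ → ℕ → Carrier) → Set) → x ∈ V → x′ ∈ nb x →
          P (λ α β γ → blue α β γ x′ (y x)) → P (λ α β γ → red α β γ x (s x′))
        blue⇒red {x} {x′} P x∈V x′∈nb = subst (λ z → P (λ α β γ → J α β γ (s x′) (y x) z)) (sym (heights x∈V x′∈nb))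

        red⇒blue′ : ∀ {x x′} (P : (ℕ → ℕ → ℕ → Carrier) → Set) → x ∈ V → x′ ∈ nb x →
          P (λ α β γ → red α β γ x′ (s x)) → P (λ α β γ → blue α β γ x (y x′))
        red⇒blue′ {x} {x′} P x∈V x′∈nb = subst (λ z → P (λ α β γ → J α β γ (s x) (y x′) z)) (heights′ x∈V x′∈nb)

        -- ∂ʳ m = ∂ₛ + m ∂_z and ∂ᵇ m = ∂_y + m ∂_z, acting on families of partial derivatives.
        ∂ʳ ∂ʳ² ∂ᵇ : Carrier → (ℕ → ℕ → ℕ → Carrier) → ℕ → ℕ → ℕ → Carrier
        ∂ʳ  m f α β γ = f (suc α) β γ + m * f α β (suc γ)
        ∂ᵇ  m f α β γ = f α (suc β) γ + m * f α β (suc γ)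
        ∂ʳ² m f α β γ = ∂ʳ m f (suc α) β γ + m * ∂ʳ m f α β (suc γ)

        Poly-red : ∀ x {u} → Poly 1 u (λ _ → 1#) → ∀ α β γ →
          Poly E (λ t → red α β γ x (u t)) (λ t → ∂ʳ (a x) (λ α β γ → red α β γ x (u t)) α β γ)
        Poly-red x {u} U α β γ = Poly-cong (λ _ → refl)
          (λ t → trans (+-comm _ _) (cong (a x * red α β (suc γ) x (u t) +_)
            (sym (trans (cong₂ _+_ (*-identityˡ _) (zeroˡ _)) (+-identityʳ _)))))
          (Poly-J U (Poly-const (y x)) height α β γ)
          where
          height : Poly 1 (λ t → w x + a x * u t) (λ _ → a x)
          height = Poly-cong (λ _ → refl) (λ _ → sym (trans (+-identityˡ _) (*-identityʳ _)))
            (Poly-+ (Poly-const (w x)) (Poly-scale (a x) U))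

        Poly-id : Poly 1 (λ t → t) (λ _ → 1#)
        Poly-id = Poly-cong (λ t → trans (sym (*-identityˡ t)) (sym (+-identityˡ _))) (λ _ → refl) (Poly-linear 0# 1#)

        Poly-blue : ∀ x α β γ → Poly E (blue α β γ x) (λ t → ∂ᵇ (- a x) (λ α β γ → blue α β γ x t) α β γ)
        Poly-blue x α β γ = Poly-cong (λ _ → refl)
          (λ t → trans (+-comm _ _) (cong (- a x * blue α β (suc γ) x t +_)
            (sym (trans (cong₂ _+_ (zeroˡ _) (*-identityˡ _)) (+-identityˡ _)))))
          (Poly-J (Poly-const (s x)) Poly-id (Poly-linear (- w x) (- a x)) α β γ)

        Poly-∂ʳ-red : ∀ x {u} → Poly 1 u (λ _ → 1#) → ∀ α β γ →
          Poly E (λ t → ∂ʳ (a x) (λ α β γ → red α β γ x (u t)) α β γ) (λ t → ∂ʳ² (a x) (λ α β γ → red α β γ x (u t)) α β γ)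
        Poly-∂ʳ-red x U α β γ = Poly-+ (Poly-red x U (suc α) β γ) (Poly-scale (a x) (Poly-red x U α β (suc γ)))

        Poly-∂ʳ²-red : ∀ x {u} → Poly 1 u (λ _ → 1#) → ∀ α β γ → ∃ λ f′ →
          Poly E (λ t → ∂ʳ² (a x) (λ α β γ → red α β γ x (u t)) α β γ) f′
        Poly-∂ʳ²-red x U α β γ = _ , Poly-+ (Poly-∂ʳ-red x U (suc α) β γ) (Poly-scale (a x) (Poly-∂ʳ-red x U α β (suc γ)))

        Poly-∂ʳ-blue : ∀ m x α β γ → Poly E (λ t → ∂ʳ m (λ α β γ → blue α β γ x t) α β γ)
          (λ t → ∂ʳ m (∂ᵇ (- a x) (λ α β γ → blue α β γ x t)) α β γ)
        Poly-∂ʳ-blue m x α β γ = Poly-+ (Poly-blue x (suc α) β γ) (Poly-scale m (Poly-blue x α β (suc γ)))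

        Poly-∂ʳ²-blue : ∀ m x α β γ → Poly E (λ t → ∂ʳ² m (λ α β γ → blue α β γ x t) α β γ)
          (λ t → ∂ʳ² m (∂ᵇ (- a x) (λ α β γ → blue α β γ x t)) α β γ)
        Poly-∂ʳ²-blue m x α β γ = Poly-+ (Poly-∂ʳ-blue m x (suc α) β γ) (Poly-scale m (Poly-∂ʳ-blue m x α β (suc γ)))

        module Level (g : ℕ) (vanishing : ∀ x → x ∈ V → ∀ t → red 0 0 g x t ≡ 0#) where

          ∂red : ∀ {x} → x ∈ V → ∀ t → ∂ʳ (a x) (λ α β γ → red α β γ x t) 0 0 g ≡ 0#
          ∂red {x} x∈V = proj₂ (vanish-at-s (Poly-weaken E≤3E (Poly-red x Poly-id 0 0 g)) x∈V (λ _ → vanishing _ x∈V _))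

          ∂²red : ∀ {x} → x ∈ V → ∀ t → ∂ʳ² (a x) (λ α β γ → red α β γ x t) 0 0 g ≡ 0#
          ∂²red {x} x∈V = proj₂ (vanish-at-s (Poly-weaken E≤3E (Poly-∂ʳ-red x Poly-id 0 0 g)) x∈V (λ _ → ∂red x∈V _))

          -- Nothing was imposed on blue lines. Each is crossed by the red lines of its neighbours
          -- in more points than the degree, so `T` and its derivative vanish along it.
          ∂blue : ∀ {x} → x ∈ V → ∀ t → ∂ᵇ (- a x) (λ α β γ → blue α β γ x t) 0 0 g ≡ 0#
          ∂blue {x} x∈V = proj₂ (vanish-at-y (Poly-weaken E≤3E (Poly-blue x 0 0 g)) x∈V
            (λ x′∈nb → red⇒blue′ (λ f → f 0 0 g ≡ 0#) x∈V x′∈nb (vanishing _ (nb⊆V x∈V x′∈nb) _)))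

          -- With T = ∂_z^g of the surface polynomial: T_z² D² T − 2 T_z (D T_z) (D T) + T_zz (D T)² for D = ∂ₛ + m ∂_z; it does not depend on m.
          flec : Carrier → (ℕ → ℕ → ℕ → Carrier) → Carrier
          flec m f = ∂ʳ² m f 0 0 g * (f 0 0 (suc g) * f 0 0 (suc g))
            + - (∂ʳ m f 0 0 (suc g) * (∂ʳ m f 0 0 g * f 0 0 (suc g)))
            + - (∂ʳ m f 0 0 (suc g) * (∂ʳ m f 0 0 g * f 0 0 (suc g)))
            + f 0 0 (suc (suc g)) * (∂ʳ m f 0 0 g * ∂ʳ m f 0 0 g)

          -- Up to the factor - T_z³ this is z_ss of the implicit surface. Using slope `m` means
          -- replacing z by z - m s, which leaves the second derivative unchanged.
          flec-slope : ∀ m m′ f → flec m f ≡ flec m′ f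
          flec-slope m m′ f = solve 8 (λ m m′ ss sz zz s z o →
            let D  = λ m → s :+ m :* z
                Dz = λ m → sz :+ m :* zz
                D² = λ m → ss :+ m :* sz :+ m :* Dz m
                F  = λ m → D² m :* (z :* z) :+ :- (Dz m :* (D m :* z)) :+ :- (Dz m :* (D m :* z)) :+ zz :* (D m :* D m)
            in F m := F m′) refl
            m m′ (f 2 0 g) (f 1 0 (suc g)) (f 0 0 (suc (suc g))) (f 1 0 g) (f 0 0 (suc g)) 0#

          flec-zero : ∀ m f → ∂ʳ m f 0 0 g ≡ 0# → ∂ʳ² m f 0 0 g ≡ 0# → flec m f ≡ 0#
          flec-zero m f D≡0 D²≡0 = trans (cong₂ (λ p r → r * (z * z) + - (Dz * (p * z)) + - (Dz * (p * z)) + zz * (p * p)) D≡0 D²≡0)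
            (solve 3 (λ z Dz zz → let p = con (pos 0) in
              p :* (z :* z) :+ :- (Dz :* (p :* z)) :+ :- (Dz :* (p :* z)) :+ zz :* (p :* p) := con (pos 0)) refl z Dz zz)
            where
            z  = f 0 0 (suc g)
            zz = f 0 0 (suc (suc g))
            Dz = ∂ʳ m f 0 0 (suc g)

          -- The product rule applied to `flec`, arranged as `Poly-+` and `Poly-*` produce it; `f′`
          -- stands for the derivatives of the family `f`.
          flec′ : Carrier → (f f′ : ℕ → ℕ → ℕ → Carrier) → Carrier
          flec′ m f f′ =
            ∂ʳ² m f′ 0 0 g * (z * z) + ∂ʳ² m f 0 0 g * (z′ * z + z * z′)
            + - (Dz′ * (∂ʳ m f 0 0 g * z) + Dz * (∂ʳ m f′ 0 0 g * z + ∂ʳ m f 0 0 g * z′))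
            + - (Dz′ * (∂ʳ m f 0 0 g * z) + Dz * (∂ʳ m f′ 0 0 g * z + ∂ʳ m f 0 0 g * z′))
            + (zz′ * (∂ʳ m f 0 0 g * ∂ʳ m f 0 0 g) + zz * (∂ʳ m f′ 0 0 g * ∂ʳ m f 0 0 g + ∂ʳ m f 0 0 g * ∂ʳ m f′ 0 0 g))
            where
            z   = f 0 0 (suc g)
            z′  = f′ 0 0 (suc g)
            zz  = f 0 0 (suc (suc g))
            zz′ = f′ 0 0 (suc (suc g))
            Dz  = ∂ʳ m f 0 0 (suc g)
            Dz′ = ∂ʳ m f′ 0 0 (suc g)

          Poly-flec-blue : ∀ m x → Poly (treble E) (λ t → flec m (λ α β γ → blue α β γ x t))
            (λ t → flec′ m (λ α β γ → blue α β γ x t) (∂ᵇ (- a x) (λ α β γ → blue α β γ x t)))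
          Poly-flec-blue m x = Poly-+ (Poly-+ (Poly-+ (Poly-* pD² (Poly-* pz pz)) pDzDz) pDzDz) (Poly-* pzz (Poly-* pD pD))
            where
            pD²   = Poly-∂ʳ²-blue m x 0 0 g
            pD    = Poly-∂ʳ-blue m x 0 0 g
            pz    = Poly-blue x 0 0 (suc g)
            pzz   = Poly-blue x 0 0 (suc (suc g))
            pDzDz = Poly-neg (Poly-* (Poly-∂ʳ-blue m x 0 0 (suc g)) (Poly-* pD pz))

          -- At each crossing the fixed slope `m` may be exchanged for that of the red line, along
          -- which DT = D²T = 0. So `flec`, of degree at most 3E, has more than 3E zeros on the blue
          -- line.
          flec-blue : ∀ {x} → x ∈ V → ∀ m t → flec′ m (λ α β γ → blue α β γ x t) (∂ᵇ (- a x) (λ α β γ → blue α β γ x t)) ≡ 0#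
          flec-blue {x} x∈V m = proj₂ (vanish-at-y (Poly-flec-blue m x) x∈V (λ {x′} x′∈nb →
            red⇒blue′ (λ f → flec m f ≡ 0#) x∈V x′∈nb (let x′∈V = nb⊆V x∈V x′∈nb in
              trans (flec-slope m (a x′) (λ α β γ → red α β γ x′ (s x)))
                (flec-zero (a x′) (λ α β γ → red α β γ x′ (s x)) (∂red x′∈V (s x)) (∂²red x′∈V (s x))))))

          -- Terms keeping an undifferentiated DT or D²T drop out, among them everything that comes
          -- from T_zz (DT)².
          flec′-zero : ∀ m f f′ → ∂ʳ m f 0 0 g ≡ 0# → ∂ʳ² m f 0 0 g ≡ 0# → flec′ m f f′ ≡ 0# →
            f 0 0 (suc g) * (∂ʳ² m f′ 0 0 g * f 0 0 (suc g)
              + - (∂ʳ m f 0 0 (suc g) * (∂ʳ m f′ 0 0 g + ∂ʳ m f′ 0 0 g))) ≡ 0#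
          flec′-zero m f f′ D≡0 D²≡0 eq = trans
            (solve 8 (λ z z′ zz zz′ Dz Dz′ D′ D²′ → let o = con (pos 0) in
              z :* (D²′ :* z :- Dz :* (D′ :+ D′)) :=
              D²′ :* (z :* z) :+ o :* (z′ :* z :+ z :* z′)
              :+ :- (Dz′ :* (o :* z) :+ Dz :* (D′ :* z :+ o :* z′))
              :+ :- (Dz′ :* (o :* z) :+ Dz :* (D′ :* z :+ o :* z′))
              :+ (zz′ :* (o :* o) :+ zz :* (D′ :* o :+ o :* D′))) refl z z′ zz zz′ Dz Dz′ D′ (∂ʳ² m f′ 0 0 g))
            (trans (sym (cong₂ (λ D D² → ∂ʳ² m f′ 0 0 g * (z * z) + D² * (z′ * z + z * z′)
              + - (Dz′ * (D * z) + Dz * (D′ * z + D * z′)) + - (Dz′ * (D * z) + Dz * (D′ * z + D * z′))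
              + (zz′ * (D * D) + zz * (D′ * D + D * D′))) D≡0 D²≡0)) eq)
            where
            z   = f 0 0 (suc g)
            z′  = f′ 0 0 (suc g)
            zz  = f 0 0 (suc (suc g))
            zz′ = f′ 0 0 (suc (suc g))
            Dz  = ∂ʳ m f 0 0 (suc g)
            Dz′ = ∂ʳ m f′ 0 0 (suc g)
            D′  = ∂ʳ m f′ 0 0 g

          -- With M = T_z and N = T_y along a red line, W = N′ M − N M′; the equation W′ M = 2 M′ W says (N / M)″ = 0.
          W W′ : Carrier → (ℕ → ℕ → ℕ → Carrier) → Carrier
          W  m f = ∂ʳ m f 0 1 g * f 0 0 (suc g) + - (f 0 1 g * ∂ʳ m f 0 0 (suc g))
          W′ m f = ∂ʳ² m f 0 1 g * f 0 0 (suc g) + ∂ʳ m f 0 1 g * ∂ʳ m f 0 0 (suc g)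
            + - (∂ʳ m f 0 1 g * ∂ʳ m f 0 0 (suc g) + f 0 1 g * ∂ʳ² m f 0 0 (suc g))

          -- The slope `b` belongs to the blue line and changes from crossing to crossing. A
          -- multiple of N + b M = 0, the tangency of the blue line, eliminates it and leaves an
          -- equation about the red line alone.
          W-ode-at : ∀ m b f → ∂ᵇ b f 0 0 g ≡ 0# →
            f 0 0 (suc g) * (∂ʳ² m (∂ᵇ b f) 0 0 g * f 0 0 (suc g)
              + - (∂ʳ m f 0 0 (suc g) * (∂ʳ m (∂ᵇ b f) 0 0 g + ∂ʳ m (∂ᵇ b f) 0 0 g))) ≡ 0# →
            W′ m f * f 0 0 (suc g) + - (W m f * (∂ʳ m f 0 0 (suc g) + ∂ʳ m f 0 0 (suc g))) ≡ 0#
          W-ode-at m b f ∂ᵇ≡0 eq = begin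
            W′ m f * M + - (W m f * (DM + DM))
              ≡⟨ solve 7 (λ b N M DN DM D²N D²M →
                   (D²N :* M :+ DN :* DM :- (DN :* DM :+ N :* D²M)) :* M :- (DN :* M :- N :* DM) :* (DM :+ DM)
                   := M :* ((D²N :+ b :* D²M) :* M :- DM :* (DN :+ b :* DM :+ (DN :+ b :* DM)))
                      :+ (N :+ b :* M) :* (DM :* (DM :+ DM) :- M :* D²M)) refl b N M DN DM D²N D²M ⟩
            M * ((D²N + b * D²M) * M + - (DM * (DN + b * DM + (DN + b * DM)))) + (N + b * M) * (DM * (DM + DM) + - (M * D²M))
              ≡⟨ cong₂ (λ p r → M * (p * M + - (DM * (r + r))) + (N + b * M) * (DM * (DM + DM) + - (M * D²M))) (sym D²-∂ᵇ) (sym D-∂ᵇ) ⟩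
            M * (∂ʳ² m (∂ᵇ b f) 0 0 g * M + - (DM * (∂ʳ m (∂ᵇ b f) 0 0 g + ∂ʳ m (∂ᵇ b f) 0 0 g)))
              + (N + b * M) * (DM * (DM + DM) + - (M * D²M))
              ≡⟨ cong₂ (λ p r → p + r * (DM * (DM + DM) + - (M * D²M))) eq ∂ᵇ≡0 ⟩
            0# + 0# * (DM * (DM + DM) + - (M * D²M))
              ≡⟨ trans (+-identityˡ _) (zeroˡ _) ⟩
            0# ∎
            where
            N   = f 0 1 g
            M   = f 0 0 (suc g)
            DN  = ∂ʳ m f 0 1 g
            DM  = ∂ʳ m f 0 0 (suc g)
            D²N = ∂ʳ² m f 0 1 g
            D²M = ∂ʳ² m f 0 0 (suc g)
            D-∂ᵇ : ∂ʳ m (∂ᵇ b f) 0 0 g ≡ DN + b * DM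
            D-∂ᵇ = solve 6 (λ m b p q r t → p :+ b :* q :+ m :* (r :+ b :* t) := p :+ m :* r :+ b :* (q :+ m :* t)) refl
              m b (f 1 1 g) (f 1 0 (suc g)) (f 0 1 (suc g)) (f 0 0 (suc (suc g)))
            D²-∂ᵇ : ∂ʳ² m (∂ᵇ b f) 0 0 g ≡ D²N + b * D²M
            D²-∂ᵇ = solve 8 (λ m b p p′ q q′ r r′ →
              p :+ b :* p′ :+ m :* (q :+ b :* q′) :+ m :* (q :+ b :* q′ :+ m :* (r :+ b :* r′))
              := p :+ m :* q :+ m :* (q :+ m :* r) :+ b :* (p′ :+ m :* q′ :+ m :* (q′ :+ m :* r′))) refl
              m b (f 2 1 g) (f 2 0 (suc g)) (f 1 1 (suc g)) (f 1 0 (suc (suc g))) (f 0 1 (suc (suc g))) (f 0 0 (suc (suc (suc g))))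

          module Line {x : X} (x∈V : x ∈ V) where
            jet : Carrier → ℕ → ℕ → ℕ → Carrier
            jet t α β γ = red α β γ x t

            Poly-W : ∀ {u} → Poly 1 u (λ _ → 1#) → Poly (E ℕ.+ E) (λ t → W (a x) (jet (u t))) (λ t → W′ (a x) (jet (u t)))
            Poly-W U = Poly-+ (Poly-* (Poly-∂ʳ-red x U 0 1 g) (Poly-red x U 0 0 (suc g)))
              (Poly-neg (Poly-* (Poly-red x U 0 1 g) (Poly-∂ʳ-red x U 0 0 (suc g))))

            -- Free of blue slopes, the left side is one polynomial of degree at most 3E on the red
            -- line, and it vanishes at more than 3E crossings.
            W-ode : ∀ t → W′ (a x) (jet t) * jet t 0 0 (suc g)
              + - (W (a x) (jet t) * (∂ʳ (a x) (jet t) 0 0 (suc g) + ∂ʳ (a x) (jet t) 0 0 (suc g))) ≡ 0#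
            W-ode = proj₁ (vanish-at-s (Poly-+ (Poly-weaken assoc (Poly-* pW′ pM)) (Poly-neg (Poly-weaken assoc
                (Poly-* (Poly-W Poly-id) (Poly-+ pDM pDM))))) x∈V
              (λ {x′} x′∈nb → W-ode-at (a x) (- a x′) (jet (s x′))
                (blue⇒red (λ f → ∂ᵇ (- a x′) f 0 0 g ≡ 0#) x∈V x′∈nb (∂blue (nb⊆V x∈V x′∈nb) (y x)))
                (flec′-zero (a x) (jet (s x′)) (∂ᵇ (- a x′) (jet (s x′))) (∂red x∈V (s x′)) (∂²red x∈V (s x′))
                  (blue⇒red (λ f → flec′ (a x) f (∂ᵇ (- a x′) f) ≡ 0#) x∈V x′∈nb
                    (flec-blue (nb⊆V x∈V x′∈nb) (a x) (y x))))))
              where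
              assoc : E ℕ.+ E ℕ.+ E ℕ.≤ treble E
              assoc = ℕₚ.≤-reflexive (ℕₚ.+-assoc E E E)
              pM  = Poly-red x Poly-id 0 0 (suc g)
              pN  = Poly-red x Poly-id 0 1 g
              pDM = Poly-∂ʳ-red x Poly-id 0 0 (suc g)
              pDN = Poly-∂ʳ-red x Poly-id 0 1 g
              pD²M = proj₂ (Poly-∂ʳ²-red x Poly-id 0 0 (suc g))
              pD²N = proj₂ (Poly-∂ʳ²-red x Poly-id 0 1 g)
              pW′ = Poly-+ (Poly-+ (Poly-* pD²N pM) (Poly-* pDN pDM)) (Poly-neg (Poly-+ (Poly-* pDN pDM) (Poly-* pN pD²M)))

            module _ {t₀ : Carrier} (M≢0 : jet t₀ 0 0 (suc g) ≢ 0#) where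
              -- Moves a point with T_z ≠ 0 to the origin, where `ode-unique` needs it.
              u : Carrier → Carrier
              u t = t₀ + t

              Poly-u : Poly 1 u (λ _ → 1#)
              Poly-u = Poly-cong (λ t → cong (t₀ +_) (sym (*-identityˡ t))) (λ _ → refl) (Poly-linear t₀ 1#)

              M N DM DN : Carrier → Carrier
              M t  = jet (u t) 0 0 (suc g)
              N t  = jet (u t) 0 1 g
              DM t = ∂ʳ (a x) (jet (u t)) 0 0 (suc g)
              DN t = ∂ʳ (a x) (jet (u t)) 0 1 g

              Poly-M : Poly E M DM
              Poly-M = Poly-red x Poly-u 0 0 (suc g)

              M0≢0 : M 0# ≢ 0#
              M0≢0 = subst (λ t → jet t 0 0 (suc g) ≢ 0#) (sym (+-identityʳ t₀)) M≢0

              -- Initial values at the shifted origin: μ = 1 / M, δ = (N / M)′ and - γ = N / M. In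
              -- the unshifted coordinate s, the expected value of N / M is κ + δ s.
              μ δ γ κ : Carrier
              μ = proj₁ (inverse (M 0#) M0≢0)
              δ = W (a x) (jet (u 0#)) * (μ * μ)
              γ = - (N 0# * μ)
              κ = - γ + - (δ * t₀)

              Mμ≡1 : M 0# * μ ≡ 1#
              Mμ≡1 = proj₂ (inverse (M 0#) M0≢0)

              1≤E : 1 ℕ.≤ E
              1≤E = ℕₚ.≤-trans (ℕₚ.n≢0⇒n>0 (λ D≡0 → contradiction few-lines
                (ℕₚ.≤⇒≯ (subst (λ n → n ℕ.* (D ℕ.* D) ℕ.≤ length V ℕ.* suc E) (sym D≡0) z≤n)))) (ℕₚ.m≤m+n D _)

              -- W and M² both solve X′ M = 2 M′ X, and δ makes W and δ M² agree at the origin.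
              W≡δM² : ∀ t → W (a x) (jet (u t)) + - (δ * (M t * M t)) ≡ 0#
              W≡δM² = ode-unique {H = λ t → W (a x) (jet (u t)) + - (δ * (M t * M t))}
                (Poly-+ (Poly-W Poly-u) (Poly-neg (Poly-scale δ (Poly-* Poly-M Poly-M)))) Poly-M
                (Poly-+ (Poly-∂ʳ-red x Poly-u 0 0 (suc g)) (Poly-∂ʳ-red x Poly-u 0 0 (suc g)))
                (subst (λ n → suc (suc n) ℕ.< q) (sym (ℕₚ.+-assoc E E E)) q-large)
                (λ t → x-y≡0⇒x≡y (trans
                  (solve 5 (λ W W′ M DM δ → (W′ :- δ :* (DM :* M :+ M :* DM)) :* M :- (W :- δ :* (M :* M)) :* (DM :+ DM)
                    := W′ :* M :- W :* (DM :+ DM)) refl (W (a x) (jet (u t))) (W′ (a x) (jet (u t))) (M t) (DM t) δ)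
                  (W-ode (u t))))
                M0≢0
                (begin
                  W₀ + - (W₀ * (μ * μ) * (M 0# * M 0#))
                    ≡⟨ solve 3 (λ W m μ → W :- W :* (μ :* μ) :* (m :* m) := W :- W :* (m :* μ) :* (m :* μ)) refl W₀ (M 0#) μ ⟩
                  W₀ + - (W₀ * (M 0# * μ) * (M 0# * μ))
                    ≡⟨ cong (λ t → W₀ + - (W₀ * t * t)) Mμ≡1 ⟩
                  W₀ + - (W₀ * 1# * 1#)
                    ≡⟨ cong (λ t → W₀ + - t) (trans (*-identityʳ _) (*-identityʳ _)) ⟩
                  W₀ + - W₀
                    ≡⟨ -‿inverseʳ _ ⟩
                  0# ∎)
                where
                W₀ = W (a x) (jet (u 0#))

              -- Second integration: (N / M)′ = W / M² = δ, with γ fixing the value at the origin.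
              N-linear : ∀ t → N t + (γ + - δ * t) * M t ≡ 0#
              N-linear = ode-unique {H = λ t → N t + (γ + - δ * t) * M t}
                (Poly-+ (Poly-weaken (ℕₚ.n≤1+n E) (Poly-red x Poly-u 0 1 g)) (Poly-* (Poly-linear γ (- δ)) Poly-M))
                Poly-M (Poly-∂ʳ-red x Poly-u 0 0 (suc g))
                -- The linear factor raises the degree to E + 1; `1≤E` gives 2E + 1 ≤ 3E.
                (ℕₚ.≤-<-trans (s≤s (s≤s (ℕₚ.≤-trans (ℕₚ.≤-reflexive (sym (ℕₚ.+-suc E E))) (ℕₚ.+-monoʳ-≤ E (ℕₚ.+-monoˡ-≤ E 1≤E))))) q-large)
                (λ t → x-y≡0⇒x≡y (trans
                  (solve 7 (λ N M DN DM γ δ t → (DN :+ (:- δ :* M :+ (γ :+ :- δ :* t) :* DM)) :* M :- (N :+ (γ :+ :- δ :* t) :* M) :* DM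
                    := DN :* M :- N :* DM :- δ :* (M :* M)) refl (N t) (M t) (DN t) (DM t) γ δ t)
                  (W≡δM² t)))
                M0≢0
                (begin
                  N 0# + (- (N 0# * μ) + - δ * 0#) * M 0#
                    ≡⟨ solve 4 (λ n μ δ m → n :+ (:- (n :* μ) :+ :- δ :* con (pos 0)) :* m := n :- n :* (m :* μ)) refl (N 0#) μ δ (M 0#) ⟩
                  N 0# + - (N 0# * (M 0# * μ))
                    ≡⟨ cong (λ t → N 0# + - t) (trans (cong (N 0# *_) Mμ≡1) (*-identityʳ _)) ⟩
                  N 0# + - N 0#
                    ≡⟨ -‿inverseʳ _ ⟩
                  0# ∎)

              -- The blue line of `x′` is tangent to the surface, so T_y = a x′ · T_z at the
              -- crossing, and `N-linear` gives T_y = (κ + δ s x′) T_z there. As T_z is nonzero of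
              -- degree at most E on this red line, few neighbours can be off the line.
              neighbour : ∀ {x′} → x′ ∈ nb x → a x′ ≢ κ + δ * s x′ → jet (s x′) 0 0 (suc g) ≡ 0#
              neighbour {x′} x′∈nb off = *-cancel-0 (λ eq → off (x-y≡0⇒x≡y eq)) (begin
                (a x′ + - (- γ + - (δ * t₀) + δ * s x′)) * M′
                  ≡⟨ solve 7 (λ a γ δ t s n m → (a :- (:- γ :- δ :* t :+ δ :* s)) :* m :=
                       n :+ (γ :+ :- δ :* (s :- t)) :* m :- (n :+ :- a :* m)) refl (a x′) γ δ t₀ (s x′) N′ M′ ⟩
                N′ + (γ + - δ * (s x′ + - t₀)) * M′ + - (N′ + - a x′ * M′)
                  ≡⟨ cong₂ (λ p r → p + - r) shifted (blue⇒red (λ f → ∂ᵇ (- a x′) f 0 0 g ≡ 0#) x∈V x′∈nb (∂blue (nb⊆V x∈V x′∈nb) (y x))) ⟩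
                0# + - 0#
                  ≡⟨ -‿inverseʳ 0# ⟩
                0# ∎)
                where
                N′ M′ : Carrier
                N′ = jet (s x′) 0 1 g
                M′ = jet (s x′) 0 0 (suc g)
                shifted : N′ + (γ + - δ * (s x′ + - t₀)) * M′ ≡ 0#
                shifted = subst (λ t → jet t 0 1 g + (γ + - δ * (s x′ + - t₀)) * jet t 0 0 (suc g) ≡ 0#)
                  (solve 2 (λ s t → t :+ (s :- t) := s) refl (s x′) t₀) (N-linear (s x′ + - t₀))

              few-exceptions : length (filter (λ x′ → ¬? (a x′ ≟ κ + δ * s x′)) (nb x)) ℕ.≤ E
              few-exceptions = ℕₚ.≮⇒≥ (λ many → M≢0 (proj₁ (Poly-vanish (Poly-red x Poly-id 0 0 (suc g)) (map s exceptions)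
                (unique-map s (λ x₁∈ x₂∈ → s-injective x∈V (proj₁ (∈-exceptions x₁∈)) (proj₁ (∈-exceptions x₂∈)))
                  (Uniqueₚ.filter⁺ off? (nb-unique x∈V)))
                (Allₚ.map⁺ (All.tabulate (λ x₁∈ → uncurry neighbour (∈-exceptions x₁∈))))
                (subst (E ℕ.<_) (sym (length-map s exceptions)) many)) t₀))
                where
                off? = λ x′ → ¬? (a x′ ≟ κ + δ * s x′)
                exceptions = filter off? (nb x)
                ∈-exceptions : ∀ {x′} → x′ ∈ exceptions → x′ ∈ nb x × a x′ ≢ κ + δ * s x′
                ∈-exceptions = ∈-filter⁻ off? {xs = nb x}

        Vanishing : ℕ → Set
        Vanishing g = ∀ x → x ∈ V → ∀ t → red 0 0 g x t ≡ 0#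

        NonVanishing : ℕ → Set
        NonVanishing g = ∃ λ x → x ∈ V × ∃ λ t → red 0 0 g x t ≢ 0#

        vanishing? : ∀ g → Vanishing g ⊎ NonVanishing g
        vanishing? g = search V (λ x∈ → x∈)
          where
          search : ∀ U → (∀ {x} → x ∈ U → x ∈ V) → (∀ x → x ∈ U → ∀ t → red 0 0 g x t ≡ 0#) ⊎ NonVanishing g
          search []      U⊆V = inj₁ (λ _ ())
          search (x ∷ U) U⊆V = [ (λ van → [ (λ vans → inj₁ (extend van vans)) , inj₂ ]′ (search U (U⊆V ∘ there)))
                               , (λ (t , ≢0) → inj₂ (x , U⊆V (here refl) , t , ≢0)) ]′
                               (Poly-zero? (Poly-red x Poly-id 0 0 g) 1+E<q)
            where
            extend : (∀ t → red 0 0 g x t ≡ 0#) → (∀ x → x ∈ U → ∀ t → red 0 0 g x t ≡ 0#) →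
              ∀ x′ → x′ ∈ x ∷ U → ∀ t → red 0 0 g x′ t ≡ 0#
            extend van vans _ (here refl)  = van
            extend van vans x′ (there x∈U) = vans x′ x∈U

        -- The second alternative provides the derivative to work with: it vanishes on all red
        -- lines, but its own z-derivative does not. For n = D the first is refuted by `flat⇒zero`.
        vanishing-order : Vanishing 0 → ∀ n →
          (∀ g → g ℕ.< suc n → Vanishing g) ⊎ ∃ λ g → Vanishing g × NonVanishing (suc g)
        vanishing-order van zero    = inj₁ (λ { _ (s≤s z≤n) → van })
        vanishing-order van (suc n) = [ (λ vans → [ (λ van′ → inj₁ (extend vans van′))
                                                  , (λ nonVan → inj₂ (n , vans n ℕₚ.≤-refl , nonVan)) ]′ (vanishing? (suc n)))
                                      , inj₂ ]′ (vanishing-order van n)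
          where
          extend : (∀ g → g ℕ.< suc n → Vanishing g) → Vanishing (suc n) → ∀ g → g ℕ.< suc (suc n) → Vanishing g
          extend vans van′ g (s≤s g≤1+n) with ℕₚ.m≤n⇒m<n∨m≡n g≤1+n
          ... | inj₁ g<1+n = vans g g<1+n
          ... | inj₂ refl  = van′

        -- The variables are removed in turn: z by Taylor expansion at each point of a red line, s
        -- because D parameters on that line are available, and y because the red lines of the
        -- neighbours of `x₀` have more than D distinct values `y`.
        flat⇒zero : ∀ {x₀} → x₀ ∈ V → (∀ g → g ℕ.< D → Vanishing g) → ∀ k i j → coeff k i j ≡ 0#
        flat⇒zero {x₀} x₀∈V vans k i = Σ-pw-roots D (coeff k i) (map y (nb x₀))
          (unique-map y (y-injective x₀∈V) (nb-unique x₀∈V))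
          (ℕₚ.≤-trans (ℕₚ.<⇒≤ (ℕₚ.≤-<-trans D≤3E (nb-large x₀∈V))) (ℕₚ.≤-reflexive (sym (length-map y (nb x₀)))))
          (λ t∈ → let x , x∈nb , t≡ = ∈-map⁻ y t∈ in subst (λ t → Jy 0 k i t ≡ 0#) (sym t≡) (Jy≡0 (nb⊆V x₀∈V x∈nb) i))
          where
          D<q : D ℕ.< q
          D<q = ℕₚ.<-trans (s≤s (ℕₚ.≤-trans D≤3E (ℕₚ.n≤1+n _))) q-large
          Jy≡0 : ∀ {x} → x ∈ V → ∀ i → Jy 0 k i (y x) ≡ 0#
          Jy≡0 {x} x∈V = Σ-pw-roots D _ (nonzeros D) (nonzeros-unique D<q) (ℕₚ.≤-reflexive (sym (length-applyUpTo (ι ∘ suc) D)))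
            (λ {t} _ → taylor D (λ k → Js 0 0 k t (y x)) (w x + a x * t) (ℕₚ.<⇒≤ D<q) (λ g<D → vans _ g<D x x∈V t) k)

      private
        -- Sample points with s = 1, ..., E + 1 on each red line: one more than the degree of the
        -- restriction of the polynomial.
        point : Fin (length V ℕ.* suc E) → X × Carrier
        point m = let i , k = remQuot {length V} (suc E) m in lookup V i , ι (suc (toℕ k))

        power : X × Carrier → Fin D × Fin D × Fin D → Carrier
        power (x , t) (k , i , j) = pw 0 (toℕ k) (w x + a x * t) * (pw 0 (toℕ i) t * pw 0 (toℕ j) (y x))

        exponents : Fin (D ℕ.* (D ℕ.* D)) → Fin D × Fin D × Fin D
        exponents n = let k , ij = remQuot {D} (D ℕ.* D) n in k , remQuot {D} D ij

        exponents-combine : ∀ k i j → exponents (combine k (combine i j)) ≡ (k , i , j)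
        exponents-combine k i j = trans
          (cong (λ (k , ij) → k , remQuot {D} D ij) (Finₚ.remQuot-combine {D} {D ℕ.* D} k (combine i j)))
          (cong (k ,_) (Finₚ.remQuot-combine {D} {D} i j))

        monomial : Fin (D ℕ.* (D ℕ.* D)) → X × Carrier → Carrier
        monomial n P = power P (exponents n)

        solution : ∃ λ (c : Fin (D ℕ.* (D ℕ.* D)) → Carrier) → (∃ λ n → c n ≢ 0#) ×
          (∀ m → Σ (D ℕ.* (D ℕ.* D)) (λ n → monomial n (point m) * c n) ≡ 0#)
        solution = kernel few-lines (λ m n → monomial n (point m))

        surface : Fin D → Fin D → Fin D → Carrier
        surface k i j = proj₁ solution (combine k (combine i j))

      open Surface surface

      private
        open Box D surface using (J)

        expand : ∀ x t → red 0 0 0 x t ≡ Σ (D ℕ.* (D ℕ.* D)) (λ n → monomial n (x , t) * proj₁ solution n)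
        expand x t = sym (begin
          Σ (D ℕ.* (D ℕ.* D)) (λ n → monomial n (x , t) * c n)
            ≡⟨ Σ-combine D (D ℕ.* D) _ ⟩
          Σ D (λ k → Σ (D ℕ.* D) (λ ij → monomial (combine k ij) (x , t) * c (combine k ij)))
            ≡⟨ Σ-cong D (λ k → Σ-combine D D _) ⟩
          Σ D (λ k → Σ D (λ i → Σ D (λ j → monomial (combine k (combine i j)) (x , t) * surface k i j)))
            ≡⟨ Σ-cong D (λ k → Σ-cong D (λ i → Σ-cong D (λ j →
                 trans (cong (λ e → power (x , t) e * surface k i j) (exponents-combine k i j)) (trans (*-assoc _ _ _) (cong (pz k *_) (*-assoc _ _ _)))))) ⟩
          Σ D (λ k → Σ D (λ i → Σ D (λ j → pz k * (ps i * (py j * surface k i j)))))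
            ≡⟨ Σ-cong D (λ k → trans (Σ-cong D (λ i → trans (Σ-*ˡ D (pz k) _) (cong (pz k *_) (Σ-*ˡ D (ps i) _)))) (Σ-*ˡ D (pz k) _)) ⟩
          red 0 0 0 x t ∎)
          where
          c = proj₁ solution
          pz ps py : Fin D → Carrier
          pz k = pw 0 (toℕ k) (w x + a x * t)
          ps i = pw 0 (toℕ i) t
          py j = pw 0 (toℕ j) (y x)

        surface-vanishing : Vanishing 0
        surface-vanishing x x∈V = proj₁ (Poly-vanish (Poly-red x Poly-id 0 0 0) (nonzeros (suc E)) (nonzeros-unique 1+E<q)
          (All.tabulate root) (ℕₚ.≤-reflexive (sym (length-applyUpTo (ι ∘ suc) (suc E)))))
          where
          root : ∀ {t} → t ∈ nonzeros (suc E) → red 0 0 0 x t ≡ 0#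
          root {t} t∈ with k , k<1+E , refl ← ∈-applyUpTo⁻ (ι ∘ suc) t∈ =
            trans (expand x t) (subst (λ P → Σ (D ℕ.* (D ℕ.* D)) (λ n → monomial n P * proj₁ solution n) ≡ 0#) at
              (proj₂ (proj₂ solution) (combine (Any.index x∈V) (Fin.fromℕ< k<1+E))))
            where
            at : point (combine (Any.index x∈V) (Fin.fromℕ< k<1+E)) ≡ (x , ι (suc k))
            at = trans
              (cong (λ (i , k) → lookup V i , ι (suc (toℕ k))) (Finₚ.remQuot-combine {length V} {suc E} (Any.index x∈V) (Fin.fromℕ< k<1+E)))
              (cong₂ _,_ (sym (Anyₚ.lookup-index x∈V)) (cong (ι ∘ suc) (Finₚ.toℕ-fromℕ< k<1+E)))

        surface-nonzero : ∃ λ k → ∃ λ i → ∃ λ j → surface k i j ≢ 0#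
        surface-nonzero = let n , c≢0 = proj₁ (proj₂ solution) ; k , ij = remQuot {D} (D ℕ.* D) n ; i , j = remQuot {D} D ij in
          k , i , j , λ eq → c≢0 (trans (cong (proj₁ solution) (sym (trans
            (cong (combine k) (Finₚ.combine-remQuot {D} D ij)) (Finₚ.combine-remQuot {D} (D ℕ.* D) n)))) eq)

      collinear-neighbours : ∀ {x₀} → x₀ ∈ V → ∃ λ x → x ∈ V × ∃ λ κ → ∃ λ δ →
        length (filter (λ x′ → ¬? (a x′ ≟ κ + δ * s x′)) (nb x)) ℕ.≤ E
      collinear-neighbours x₀∈V = [ flat , steep ]′ (vanishing-order surface-vanishing D)
        where
        Conclusion : Set
        Conclusion = ∃ λ x → x ∈ V × ∃ λ κ → ∃ λ δ → length (filter (λ x′ → ¬? (a x′ ≟ κ + δ * s x′)) (nb x)) ℕ.≤ E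
        flat : (∀ g → g ℕ.< suc D → Vanishing g) → Conclusion
        flat vans = let k , i , j , c≢0 = surface-nonzero in
          contradiction (flat⇒zero x₀∈V (λ g g<D → vans g (ℕₚ.m<n⇒m<1+n g<D)) k i j) c≢0
        steep : (∃ λ g → Vanishing g × NonVanishing (suc g)) → Conclusion
        steep (g , van , x , x∈V , t , M≢0) = x , x∈V , κ x∈V M≢0 , δ x∈V M≢0 , few-exceptions x∈V M≢0
          where
          open Level g van using (module Line)
          open Line using (κ; δ; few-exceptions)

  -- The prime field and its quadratic extension.

  commutativeRing : ∀ {A : Set} {_+_ _*_ : A → A → A} { -_ : A → A} {0# 1#} →
    (∀ x y z → (x + y) + z ≡ x + (y + z)) → (∀ x y → x + y ≡ y + x) → (∀ x → 0# + x ≡ x) → (∀ x → (- x) + x ≡ 0#) →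
    (∀ x y z → (x * y) * z ≡ x * (y * z)) → (∀ x y → x * y ≡ y * x) → (∀ x → 1# * x ≡ x) →
    (∀ x y z → x * (y + z) ≡ (x * y) + (x * z)) → IsCommutativeRing _≡_ _+_ _*_ -_ 0# 1#
  commutativeRing {_+_ = _+_} {_*_} { -_} +-assoc +-comm +-identityˡ -‿inverseˡ *-assoc *-comm *-identityˡ distribˡ = record
    { isRing = record
      { +-isAbelianGroup = record
        { isGroup = record
          { isMonoid = record
            { isSemigroup = record
              { isMagma = record { isEquivalence = isEquivalence ; ∙-cong = cong₂ _+_ }
              ; assoc = +-assoc }
            ; identity = +-identityˡ , λ x → trans (+-comm x _) (+-identityˡ x) }
          ; inverse = -‿inverseˡ , λ x → trans (+-comm x _) (-‿inverseˡ x)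
          ; ⁻¹-cong = cong -_ }
        ; comm = +-comm }
      ; *-cong = cong₂ _*_
      ; *-assoc = *-assoc
      ; *-identity = *-identityˡ , λ x → trans (*-comm x _) (*-identityˡ x)
      ; distrib = distribˡ , λ x y z → trans (*-comm _ x) (trans (distribˡ x y z) (cong₂ _+_ (*-comm x y) (*-comm x z))) }
    ; *-comm = *-comm }

  injective⇒surjective : ∀ {n} (f : Fin n → Fin n) → Injective _≡_ _≡_ f → ∀ y → ∃ λ x → f x ≡ y
  injective⇒surjective {suc n} f inj y with Finₚ.any? (λ x → f x Finₚ.≟ y)
  ... | yes found = found
  ... | no ¬found = contradiction
    (Finₚ.injective⇒≤ {f = λ x → punchOut (λ y≡fx → ¬found (x , sym y≡fx))} (λ {x} {x′} eq → inj (Finₚ.punchOut-injective {i = y} {f x} {f x′} _ _ eq)))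
    (ℕₚ.<⇒≱ (ℕₚ.n<1+n n))

  module PrimeField (p : ℕ) .{{_ : NonZero p}} (prime : Prime p) where
    open ≡-Reasoning

    [_] : ℕ → Fin p
    [ n ] = n mod p

    infixl 6 _⊕_
    infixl 7 _⊗_
    _⊕_ _⊗_ : Fin p → Fin p → Fin p
    x ⊕ y = [ toℕ x ℕ.+ toℕ y ]
    x ⊗ y = [ toℕ x ℕ.* toℕ y ]

    ⊖_ : Fin p → Fin p
    ⊖ x = [ p ℕ.∸ toℕ x ]

    toℕ-[] : ∀ n → toℕ [ n ] ≡ n % p
    toℕ-[] n = Finₚ.toℕ-fromℕ< (m%n<n n p)

    []-cong : ∀ {m n} → m % p ≡ n % p → [ m ] ≡ [ n ]
    []-cong {m} {n} eq = Finₚ.toℕ-injective (trans (toℕ-[] m) (trans eq (sym (toℕ-[] n))))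

    []-toℕ : ∀ x → [ toℕ x ] ≡ x
    []-toℕ x = Finₚ.toℕ-injective (trans (toℕ-[] (toℕ x)) (m<n⇒m%n≡m (Finₚ.toℕ<n x)))

    []-+ : ∀ m n → [ m ℕ.+ n ] ≡ [ m ] ⊕ [ n ]
    []-+ m n = []-cong (trans (%-distribˡ-+ m n p) (cong₂ (λ i j → (i ℕ.+ j) % p) (sym (toℕ-[] m)) (sym (toℕ-[] n))))

    []-* : ∀ m n → [ m ℕ.* n ] ≡ [ m ] ⊗ [ n ]
    []-* m n = []-cong (trans (%-distribˡ-* m n p) (cong₂ (λ i j → (i ℕ.* j) % p) (sym (toℕ-[] m)) (sym (toℕ-[] n))))

    by-representative : ∀ (P : Fin p → Set) → (∀ n → P [ n ]) → ∀ x → P x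
    by-representative P P[] x = subst P ([]-toℕ x) (P[] (toℕ x))

    private
      +-assoc : ∀ x y z → (x ⊕ y) ⊕ z ≡ x ⊕ (y ⊕ z)
      +-assoc = by-representative _ λ l → by-representative _ λ m → by-representative _ λ n → begin
        ([ l ] ⊕ [ m ]) ⊕ [ n ]    ≡⟨ cong (_⊕ [ n ]) (sym ([]-+ l m)) ⟩
        [ l ℕ.+ m ] ⊕ [ n ]        ≡⟨ sym ([]-+ (l ℕ.+ m) n) ⟩
        [ l ℕ.+ m ℕ.+ n ]          ≡⟨ cong [_] (ℕₚ.+-assoc l m n) ⟩
        [ l ℕ.+ (m ℕ.+ n) ]        ≡⟨ []-+ l (m ℕ.+ n) ⟩
        [ l ] ⊕ [ m ℕ.+ n ]        ≡⟨ cong ([ l ] ⊕_) ([]-+ m n) ⟩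
        [ l ] ⊕ ([ m ] ⊕ [ n ])    ∎

      *-assoc : ∀ x y z → (x ⊗ y) ⊗ z ≡ x ⊗ (y ⊗ z)
      *-assoc = by-representative _ λ l → by-representative _ λ m → by-representative _ λ n → begin
        ([ l ] ⊗ [ m ]) ⊗ [ n ]    ≡⟨ cong (_⊗ [ n ]) (sym ([]-* l m)) ⟩
        [ l ℕ.* m ] ⊗ [ n ]        ≡⟨ sym ([]-* (l ℕ.* m) n) ⟩
        [ l ℕ.* m ℕ.* n ]          ≡⟨ cong [_] (ℕₚ.*-assoc l m n) ⟩
        [ l ℕ.* (m ℕ.* n) ]        ≡⟨ []-* l (m ℕ.* n) ⟩
        [ l ] ⊗ [ m ℕ.* n ]        ≡⟨ cong ([ l ] ⊗_) ([]-* m n) ⟩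
        [ l ] ⊗ ([ m ] ⊗ [ n ])    ∎

      distribˡ : ∀ x y z → x ⊗ (y ⊕ z) ≡ (x ⊗ y) ⊕ (x ⊗ z)
      distribˡ = by-representative _ λ l → by-representative _ λ m → by-representative _ λ n → begin
        [ l ] ⊗ ([ m ] ⊕ [ n ])              ≡⟨ cong ([ l ] ⊗_) (sym ([]-+ m n)) ⟩
        [ l ] ⊗ [ m ℕ.+ n ]                  ≡⟨ sym ([]-* l (m ℕ.+ n)) ⟩
        [ l ℕ.* (m ℕ.+ n) ]                  ≡⟨ cong [_] (ℕₚ.*-distribˡ-+ l m n) ⟩
        [ l ℕ.* m ℕ.+ l ℕ.* n ]              ≡⟨ []-+ (l ℕ.* m) (l ℕ.* n) ⟩
        [ l ℕ.* m ] ⊕ [ l ℕ.* n ]            ≡⟨ cong₂ _⊕_ ([]-* l m) ([]-* l n) ⟩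
        ([ l ] ⊗ [ m ]) ⊕ ([ l ] ⊗ [ n ])    ∎

      identityˡ : ∀ x → [ 1 ] ⊗ x ≡ x
      identityˡ = by-representative _ λ n → trans (sym ([]-* 1 n)) (cong [_] (ℕₚ.*-identityˡ n))

      +-identityˡ : ∀ x → [ 0 ] ⊕ x ≡ x
      +-identityˡ = by-representative _ λ n → sym ([]-+ 0 n)

    []-∸ : ∀ x → [ p ℕ.∸ toℕ x ] ⊕ x ≡ [ 0 ]
    []-∸ x = begin
      [ p ℕ.∸ toℕ x ] ⊕ x               ≡⟨ cong ([ p ℕ.∸ toℕ x ] ⊕_) (sym ([]-toℕ x)) ⟩
      [ p ℕ.∸ toℕ x ] ⊕ [ toℕ x ]       ≡⟨ sym ([]-+ (p ℕ.∸ toℕ x) (toℕ x)) ⟩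
      [ p ℕ.∸ toℕ x ℕ.+ toℕ x ]         ≡⟨ cong [_] (ℕₚ.m∸n+n≡m (ℕₚ.<⇒≤ (Finₚ.toℕ<n x))) ⟩
      [ p ]                             ≡⟨ []-cong (trans (n%n≡0 p) (sym (m<n⇒m%n≡m 0<p))) ⟩
      [ 0 ]                             ∎
      where
      0<p : 0 ℕ.< p
      0<p = ℕₚ.≤-<-trans z≤n (Finₚ.toℕ<n x)

    []≢0 : ∀ {n} → 0 ℕ.< n → n ℕ.< p → [ n ] ≢ [ 0 ]
    []≢0 {n} 0<n n<p eq = ℕₚ.<⇒≢ 0<n (begin
      0          ≡⟨ sym (m<n⇒m%n≡m (ℕₚ.<-trans 0<n n<p)) ⟩
      0 % p      ≡⟨ sym (toℕ-[] 0) ⟩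
      toℕ [ 0 ]  ≡⟨ cong toℕ (sym eq) ⟩
      toℕ [ n ]  ≡⟨ toℕ-[] n ⟩
      n % p      ≡⟨ m<n⇒m%n≡m n<p ⟩
      n          ∎)

    private
      1<p : 1 ℕ.< p
      1<p = ℕ.nonTrivial⇒n>1 p {{prime⇒nonTrivial prime}}

      ring : IsCommutativeRing _≡_ _⊕_ _⊗_ ⊖_ [ 0 ] [ 1 ]
      ring = commutativeRing +-assoc (λ x y → cong [_] (ℕₚ.+-comm (toℕ x) (toℕ y))) +-identityˡ []-∸
        *-assoc (λ x y → cong [_] (ℕₚ.*-comm (toℕ x) (toℕ y))) identityˡ distribˡ

      zero-divisor : ∀ x y → x ⊗ y ≡ [ 0 ] → x ≡ [ 0 ] ⊎ y ≡ [ 0 ]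
      zero-divisor x y xy≡0 = Sum.[ inj₁ ∘ divisible x , inj₂ ∘ divisible y ]′
        (euclidsLemma (toℕ x) (toℕ y) prime (m%n≡0⇒n∣m _ p (begin
          (toℕ x ℕ.* toℕ y) % p   ≡⟨ sym (toℕ-[] _) ⟩
          toℕ (x ⊗ y)             ≡⟨ cong toℕ xy≡0 ⟩
          toℕ [ 0 ]               ≡⟨ toℕ-[] 0 ⟩
          0 % p                   ≡⟨ m<n⇒m%n≡m (ℕₚ.<-trans (s≤s z≤n) 1<p) ⟩
          0                       ∎)))
        where
        divisible : ∀ x → p ∣ toℕ x → x ≡ [ 0 ]
        divisible x p∣x with toℕ x in eq
        ... | zero  = trans (sym ([]-toℕ x)) (cong [_] eq)
        ... | suc n = contradiction (∣⇒≤ p∣x) (ℕₚ.<⇒≱ (subst (ℕ._< p) eq (Finₚ.toℕ<n x)))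

      ⊗-injective : ∀ x → x ≢ [ 0 ] → Injective _≡_ _≡_ (x ⊗_)
      ⊗-injective x x≢0 {y} {z} xy≡xz = begin
        y                    ≡⟨ sym (R.+-identityʳ y) ⟩
        y ⊕ [ 0 ]            ≡⟨ cong (y ⊕_) (sym (R.-‿inverseˡ z)) ⟩
        y ⊕ (⊖ z ⊕ z)        ≡⟨ sym (+-assoc y (⊖ z) z) ⟩
        (y ⊕ ⊖ z) ⊕ z        ≡⟨ cong (_⊕ z) y-z≡0 ⟩
        [ 0 ] ⊕ z            ≡⟨ +-identityˡ z ⟩
        z                    ∎
        where
        module R = IsCommutativeRing ring
        y-z≡0 : y ⊕ ⊖ z ≡ [ 0 ]
        y-z≡0 = Sum.[ (λ x≡0 → contradiction x≡0 x≢0) , (λ eq → eq) ]′ (zero-divisor x (y ⊕ ⊖ z) (begin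
          x ⊗ (y ⊕ ⊖ z)             ≡⟨ distribˡ x y (⊖ z) ⟩
          x ⊗ y ⊕ x ⊗ ⊖ z           ≡⟨ cong (_⊕ x ⊗ ⊖ z) xy≡xz ⟩
          x ⊗ z ⊕ x ⊗ ⊖ z           ≡⟨ sym (distribˡ x z (⊖ z)) ⟩
          x ⊗ (z ⊕ ⊖ z)             ≡⟨ cong (x ⊗_) (R.-‿inverseʳ z) ⟩
          x ⊗ [ 0 ]                 ≡⟨ R.zeroʳ x ⟩
          [ 0 ]                     ∎))

    𝔽ₚ : Field
    𝔽ₚ = record
      { Carrier = Fin p ; _+_ = _⊕_ ; _*_ = _⊗_ ; -_ = ⊖_ ; 0# = [ 0 ] ; 1# = [ 1 ]
      ; isCommutativeRing = ring
      ; 1≢0 = []≢0 (s≤s z≤n) 1<p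
      ; _≟_ = Finₚ._≟_
      -- Multiplication by a nonzero `x` is injective on a finite set, hence attains 1.
      ; inverse = λ x x≢0 → injective⇒surjective (x ⊗_) (⊗-injective x x≢0) [ 1 ] }

    open FieldTheory 𝔽ₚ using (ι)

    ι≡[] : ∀ n → ι n ≡ [ n ]
    ι≡[] zero    = refl
    ι≡[] (suc n) = trans (cong ([ 1 ] ⊕_) (ι≡[] n)) (sym ([]-+ 1 n))

    ι≢0 : ∀ {n} → 0 ℕ.< n → n ℕ.< p → ι n ≢ [ 0 ]
    ι≢0 {n} 0<n n<p eq = []≢0 0<n n<p (trans (sym (ι≡[] n)) eq)

    -- If every element had a root, choosing roots would be injective, since squaring undoes it, and
    -- therefore surjective. Then 1 and - 1 would both be the chosen root of 1.
    nonsquare : p ≢ 2 → ∃ λ g → ∀ x → x ⊗ x ≢ g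
    nonsquare p≢2 with Finₚ.any? (λ g → Finₚ.all? (λ x → ¬? (x ⊗ x Finₚ.≟ g)))
    ... | yes found = found
    ... | no ¬found = contradiction 1≡-1 1≢-1
      where
      open FieldTheory 𝔽ₚ using (solve; _:*_; :-_; _:=_; -‿inverseˡ)
      root : ∀ g → ∃ λ x → x ⊗ x ≡ g
      root g = decidable-stable (Finₚ.any? (λ x → x ⊗ x Finₚ.≟ g)) (λ ¬root → ¬found (g , λ x eq → ¬root (x , eq)))
      √ : Fin p → Fin p
      √ g = proj₁ (root g)
      √-surjective : ∀ y → ∃ λ g → √ g ≡ y
      √-surjective = injective⇒surjective √ (λ {g} {g′} eq → trans (sym (proj₂ (root g))) (trans (cong (λ x → x ⊗ x) eq) (proj₂ (root g′))))
      square-of : ∀ {g y} → √ g ≡ y → g ≡ y ⊗ y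
      square-of {g} eq = trans (sym (proj₂ (root g))) (cong (λ x → x ⊗ x) eq)
      1≡-1 : [ 1 ] ≡ ⊖ [ 1 ]
      1≡-1 with g , √g≡1 ← √-surjective [ 1 ] | g′ , √g′≡-1 ← √-surjective (⊖ [ 1 ]) = begin
        [ 1 ]      ≡⟨ sym √g≡1 ⟩
        √ g        ≡⟨ cong √ (trans (square-of √g≡1) (trans (solve 1 (λ o → o :* o := :- o :* :- o) refl [ 1 ]) (sym (square-of √g′≡-1)))) ⟩
        √ g′       ≡⟨ √g′≡-1 ⟩
        ⊖ [ 1 ]    ∎
      1≢-1 : [ 1 ] ≢ ⊖ [ 1 ]
      1≢-1 eq = []≢0 {2} (s≤s z≤n) (ℕₚ.≤∧≢⇒< 1<p (p≢2 ∘ sym)) (begin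
        [ 2 ]                ≡⟨ []-+ 1 1 ⟩
        [ 1 ] ⊕ [ 1 ]        ≡⟨ cong (_⊕ [ 1 ]) eq ⟩
        ⊖ [ 1 ] ⊕ [ 1 ]      ≡⟨ -‿inverseˡ [ 1 ] ⟩
        [ 0 ]                ∎)

  module QuadraticExtension (𝕂 : Field) (g : Field.Carrier 𝕂) (nonsquare : ∀ x → Field._*_ 𝕂 x x ≢ g) where
    open FieldTheory 𝕂
    open ≡-Reasoning

    private
      _+₂_ _*₂_ : Carrier × Carrier → Carrier × Carrier → Carrier × Carrier
      (x , y) +₂ (z , t) = x + z , y + t
      (x , y) *₂ (z , t) = x * z + g * (y * t) , x * t + y * z

      -₂_ : Carrier × Carrier → Carrier × Carrier
      -₂ (x , y) = - x , - y

      norm : Carrier → Carrier → Carrier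
      norm x y = x * x + - (g * (y * y))

      -- For y ≠ 0 a zero norm would make `g` the square of x / y.
      norm≢0 : ∀ {x y} → (x , y) ≢ (0# , 0#) → norm x y ≢ 0#
      norm≢0 {x} {y} xy≢0 n≡0 with y ≟ 0#
      ... | yes refl = xy≢0 (cong (_, 0#) (decidable-stable (x ≟ 0#) (λ x≢0 → *-≢0 x≢0 x≢0
              (trans (solve 2 (λ x g → x :* x := x :* x :- g :* (con (pos 0) :* con (pos 0))) refl x g) n≡0))))
      ... | no y≢0 with y⁻¹ , yy⁻¹≡1 ← inverse y y≢0 = nonsquare (x * y⁻¹) (x-y≡0⇒x≡y (begin
              x * y⁻¹ * (x * y⁻¹) + - g
                ≡⟨ cong (λ t → x * y⁻¹ * (x * y⁻¹) + - t) (sym (trans (cong (g *_) (trans (cong (_* (y * y⁻¹)) yy⁻¹≡1) (trans (*-identityˡ _) yy⁻¹≡1))) (*-identityʳ g))) ⟩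
              x * y⁻¹ * (x * y⁻¹) + - (g * (y * y⁻¹ * (y * y⁻¹)))
                ≡⟨ solve 4 (λ x y z g → x :* z :* (x :* z) :- g :* (y :* z :* (y :* z)) := (x :* x :- g :* (y :* y)) :* (z :* z)) refl x y y⁻¹ g ⟩
              norm x y * (y⁻¹ * y⁻¹)     ≡⟨ cong (_* (y⁻¹ * y⁻¹)) n≡0 ⟩
              0# * (y⁻¹ * y⁻¹)           ≡⟨ zeroˡ _ ⟩
              0#                         ∎))

      inverse₂ : ∀ z → z ≢ (0# , 0#) → ∃ λ z⁻¹ → z *₂ z⁻¹ ≡ (1# , 0#)
      inverse₂ (x , y) xy≢0 with n⁻¹ , nn⁻¹≡1 ← inverse (norm x y) (norm≢0 xy≢0) = (x * n⁻¹ , - y * n⁻¹) , cong₂ _,_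
        (trans (solve 4 (λ x y n g → x :* (x :* n) :+ g :* (y :* (:- y :* n)) := (x :* x :- g :* (y :* y)) :* n) refl x y n⁻¹ g) nn⁻¹≡1)
        (solve 3 (λ x y n → x :* (:- y :* n) :+ y :* (x :* n) := con (pos 0)) refl x y n⁻¹)

    𝔽 : Field
    𝔽 = record
      { Carrier = Carrier × Carrier ; _+_ = _+₂_ ; _*_ = _*₂_ ; -_ = -₂_ ; 0# = 0# , 0# ; 1# = 1# , 0#
      ; isCommutativeRing = commutativeRing
          (λ _ _ _ → cong₂ _,_ (+-assoc _ _ _) (+-assoc _ _ _))
          (λ _ _ → cong₂ _,_ (+-comm _ _) (+-comm _ _))
          (λ _ → cong₂ _,_ (+-identityˡ _) (+-identityˡ _))
          (λ _ → cong₂ _,_ (-‿inverseˡ _) (-‿inverseˡ _))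
          (λ (a , b) (c , d) (e , f) → cong₂ _,_
            (solve 7 (λ a b c d e f g → (a :* c :+ g :* (b :* d)) :* e :+ g :* ((a :* d :+ b :* c) :* f)
              := a :* (c :* e :+ g :* (d :* f)) :+ g :* (b :* (c :* f :+ d :* e))) refl a b c d e f g)
            (solve 7 (λ a b c d e f g → (a :* c :+ g :* (b :* d)) :* f :+ (a :* d :+ b :* c) :* e
              := a :* (c :* f :+ d :* e) :+ b :* (c :* e :+ g :* (d :* f))) refl a b c d e f g))
          (λ (a , b) (c , d) → cong₂ _,_
            (solve 5 (λ a b c d g → a :* c :+ g :* (b :* d) := c :* a :+ g :* (d :* b)) refl a b c d g)
            (solve 4 (λ a b c d → a :* d :+ b :* c := c :* b :+ d :* a) refl a b c d))
          (λ (a , b) → cong₂ _,_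
            (trans (cong₂ _+_ (*-identityˡ a) (trans (cong (g *_) (zeroˡ b)) (zeroʳ g))) (+-identityʳ a))
            (trans (cong₂ _+_ (*-identityˡ b) (zeroˡ a)) (+-identityʳ b)))
          (λ (a , b) (c , d) (e , f) → cong₂ _,_
            (solve 7 (λ a b c d e f g → a :* (c :+ e) :+ g :* (b :* (d :+ f))
              := a :* c :+ g :* (b :* d) :+ (a :* e :+ g :* (b :* f))) refl a b c d e f g)
            (solve 6 (λ a b c d e f → a :* (d :+ f) :+ b :* (c :+ e)
              := a :* d :+ b :* c :+ (a :* f :+ b :* e)) refl a b c d e f))
      ; 1≢0 = 1≢0 ∘ cong proj₁
      ; _≟_ = ≡-dec _≟_ _≟_
      ; inverse = inverse₂ }

    ι₂ : ∀ n → FieldTheory.ι 𝔽 n ≡ (ι n , 0#)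
    ι₂ zero    = refl
    ι₂ (suc n) = trans (cong ((1# , 0#) +₂_) (ι₂ n)) (cong (1# + ι n ,_) (+-identityˡ 0#))

  length-filter-split : ∀ {A : Set} {P : A → Set} (P? : Decidable P) xs →
    length (filter P? xs) ℕ.+ length (filter (λ x → ¬? (P? x)) xs) ≡ length xs
  length-filter-split P? []       = refl
  length-filter-split P? (x ∷ xs) with P? x
  ... | yes _ = cong suc (length-filter-split P? xs)
  ... | no  _ = trans (ℕₚ.+-suc _ _) (cong suc (length-filter-split P? xs))

  -- The numerical constants.

  module Arithmetic (h : ℕ) (1≤h : 1 ℕ.≤ h) where
    open import Data.Nat using (_+_; _*_; _≤_; _<_)
    open ℕₚ.≤-Reasoning
    open +-*-Solver

    n H D E : ℕ
    n = h * h
    H = h * (h * h)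
    D = H + H
    E = D + (D + D)

    1≤H : 1 ≤ H
    1≤H = ℕₚ.*-mono-≤ 1≤h (ℕₚ.*-mono-≤ 1≤h 1≤h)

    n≤H : n ≤ H
    n≤H = ℕₚ.≤-trans (ℕₚ.≤-reflexive (sym (ℕₚ.*-identityˡ n))) (ℕₚ.*-monoˡ-≤ n 1≤h)

    pair-energy : ∀ {L e} → 41 * L ≤ H → n * n * (n * n) ≤ L * e → 41 * (H * n) ≤ e
    pair-energy {L} {e} small le = ℕₚ.*-cancelˡ-≤ H {{ℕ.>-nonZero 1≤H}} (begin
      H * (41 * (H * n))       ≡⟨ solve 1 (λ h → let H = h :* (h :* h) ; n = h :* h in
                                    H :* (con 41 :* (H :* n)) := con 41 :* (n :* n :* (n :* n))) refl h ⟩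
      41 * (n * n * (n * n))   ≤⟨ ℕₚ.*-monoʳ-≤ 41 le ⟩
      41 * (L * e)             ≡⟨ sym (ℕₚ.*-assoc 41 L e) ⟩
      41 * L * e               ≤⟨ ℕₚ.*-monoˡ-≤ e small ⟩
      H * e                    ∎)

    -- In units of H³ = n³ H: the total is at least 41, degenerate pairs take at most 2 · 2 n⁴ ≤ 4,
    -- and the dense core with degrees above 18 H needs more than 36. As 36 + 4 < 41, the constant
    -- 41 suffices.
    many-edges : ∀ {total e d} → n * (n * (41 * (H * n))) ≤ total → total ≤ e + (d + d) → d ≤ n * (n * (n * (n * 2))) →
      2 * (E + (E + E)) * (n * (n * n)) < e
    many-edges {total} {e} {d} lower upper degenerate = ℕₚ.+-cancelʳ-< (4 * (H * H * H)) _ _ (begin-strict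
      2 * (E + (E + E)) * (n * (n * n)) + 4 * (H * H * H)
        ≡⟨ solve 1 (λ h → let H = h :* (h :* h) ; n = h :* h ; D = H :+ H ; E = D :+ (D :+ D) in
             con 2 :* (E :+ (E :+ E)) :* (n :* (n :* n)) :+ con 4 :* (H :* H :* H) := con 40 :* (H :* H :* H)) refl h ⟩
      40 * (H * H * H)
        <⟨ ℕₚ.*-monoˡ-< (H * H * H) {{ℕ.>-nonZero (ℕₚ.*-mono-≤ (ℕₚ.*-mono-≤ 1≤H 1≤H) 1≤H)}} (ℕₚ.n<1+n 40) ⟩
      41 * (H * H * H)
        ≡⟨ solve 1 (λ h → let H = h :* (h :* h) ; n = h :* h in
             con 41 :* (H :* H :* H) := n :* (n :* (con 41 :* (H :* n)))) refl h ⟩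
      n * (n * (41 * (H * n)))                      ≤⟨ ℕₚ.≤-trans lower upper ⟩
      e + (d + d)                                   ≤⟨ ℕₚ.+-monoʳ-≤ e (ℕₚ.+-mono-≤ degenerate degenerate) ⟩
      e + (n * (n * (n * (n * 2))) + n * (n * (n * (n * 2))))
        ≡⟨ cong (e +_) (solve 1 (λ h → let H = h :* (h :* h) ; n = h :* h in
             n :* (n :* (n :* (n :* con 2))) :+ n :* (n :* (n :* (n :* con 2))) := con 4 :* (H :* H :* n)) refl h) ⟩
      e + 4 * (H * H * n)                           ≤⟨ ℕₚ.+-monoʳ-≤ e (ℕₚ.*-monoʳ-≤ 4 (ℕₚ.*-monoʳ-≤ (H * H) n≤H)) ⟩
      e + 4 * (H * H * H)                           ∎)

    -- Origin of D = 2 H: as n³ = H², there are at most H² (6 H + 1) ≤ 7 H³ conditions, against 8 H³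
    -- coefficients.
    few-lines : ∀ {m} → m ≤ n * (n * n) → m * suc E < D * (D * D)
    few-lines {m} m≤ = begin-strict
      m * suc E                          ≤⟨ ℕₚ.*-monoˡ-≤ (suc E) m≤ ⟩
      n * (n * n) * suc E
        ≡⟨ solve 1 (λ h → let H = h :* (h :* h) ; n = h :* h ; D = H :+ H ; E = D :+ (D :+ D) in
             n :* (n :* n) :* (con 1 :+ E) := H :* H :* con 1 :+ con 6 :* (H :* H :* H)) refl h ⟩
      H * H * 1 + 6 * (H * H * H)        ≤⟨ ℕₚ.+-monoˡ-≤ _ (ℕₚ.*-monoʳ-≤ (H * H) 1≤H) ⟩
      H * H * H + 6 * (H * H * H)        <⟨ ℕₚ.*-monoˡ-< (H * H * H) {{ℕ.>-nonZero (ℕₚ.*-mono-≤ (ℕₚ.*-mono-≤ 1≤H 1≤H) 1≤H)}} (ℕₚ.n<1+n 7) ⟩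
      8 * (H * H * H)
        ≡⟨ solve 1 (λ H → con 8 :* (H :* H :* H) := (H :+ H) :* ((H :+ H) :* (H :+ H))) refl H ⟩
      D * (D * D)                        ∎

    q-large : ∀ {q} → 40 * H ≤ q → 2 + (E + (E + E)) < q
    q-large {q} 40H≤q = begin-strict
      2 + (E + (E + E))
        ≡⟨ solve 1 (λ H → let D = H :+ H ; E = D :+ (D :+ D) in con 2 :+ (E :+ (E :+ E)) := con 2 :* con 1 :+ con 18 :* H) refl H ⟩
      2 * 1 + 18 * H      ≤⟨ ℕₚ.+-monoˡ-≤ (18 * H) (ℕₚ.*-monoʳ-≤ 2 1≤H) ⟩
      2 * H + 18 * H      ≡⟨ sym (ℕₚ.*-distribʳ-+ H 2 18) ⟩
      20 * H              <⟨ ℕₚ.*-monoˡ-< H {{ℕ.>-nonZero 1≤H}} (ℕₚ.m<m+n 20 {20} (s≤s z≤n)) ⟩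
      40 * H              ≤⟨ 40H≤q ⟩
      q                   ∎

    few-neighbours : ∀ {m c e} → c + e ≡ m → c ≤ n * 2 → e ≤ E → m ≤ E + (E + E)
    few-neighbours {m} {c} {e} eq c≤ e≤ = begin
      m                 ≡⟨ sym eq ⟩
      c + e             ≤⟨ ℕₚ.+-mono-≤ (ℕₚ.≤-trans c≤ (ℕₚ.*-monoˡ-≤ 2 n≤H)) e≤ ⟩
      H * 2 + E         ≤⟨ ℕₚ.+-monoˡ-≤ E (ℕₚ.≤-trans (ℕₚ.≤-reflexive (solve 1 (λ H → H :* con 2 := H :+ H) refl H)) (ℕₚ.m≤m+n D _)) ⟩
      E + E             ≤⟨ ℕₚ.+-monoʳ-≤ E (ℕₚ.m≤m+n E E) ⟩
      E + (E + E)       ∎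

  -- The incidence form on triples.

  module Triples (𝕂 : Field) where
    open FieldTheory 𝕂
    open ≡-Reasoning

    Triple : Set
    Triple = Carrier × Carrier × Carrier

    a v w : Triple → Carrier
    a (x , d , e) = x
    v (x , d , e) = (e + - d) + (e + - d)
    w (x , d , e) = d * d + - (e * e)

    form : Triple → Triple → Carrier
    form x x′ = a x * v x′ + a x′ * v x + (w x + w x′)

    form-sym : ∀ x x′ → form x x′ ≡ form x′ x
    form-sym x x′ = solve 6 (λ a v w a′ v′ w′ → a :* v′ :+ a′ :* v :+ (w :+ w′) := a′ :* v :+ a :* v′ :+ (w′ :+ w)) refl
      (a x) (v x) (w x) (a x′) (v x′) (w x′)

    distance : Carrier → Carrier → Carrier → Carrier → Carrier
    distance a b c d = (a + - c) * (a + - c) + (b + - d) * (b + - d)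

    -- After a² and b² cancel, `a` multiplies only c′ - c and `b` only d′ - d. Grouping `a` with d,
    -- d′ and `b` with c, c′ therefore leaves mixed terms of the form a v′ + a′ v only.
    distance-form : ∀ a b c c′ d d′ → distance a b c d + - distance a b c′ d′ ≡ form (a , d , d′) (b , c , c′)
    distance-form = solve 6 (λ a b c c′ d d′ →
      (a :- c) :* (a :- c) :+ (b :- d) :* (b :- d) :- ((a :- c′) :* (a :- c′) :+ (b :- d′) :* (b :- d′)) :=
      a :* ((c′ :- c) :+ (c′ :- c)) :+ b :* ((d′ :- d) :+ (d′ :- d)) :+ (d :* d :- d′ :* d′ :+ (c :* c :- c′ :* c′))) refl

    x≡y⇒x-y≡0 : ∀ {x y} → x ≡ y → x + - y ≡ 0#
    x≡y⇒x-y≡0 {x} refl = -‿inverseʳ x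

    product-0 : ∀ {x y} → x * y ≡ 0# → x ≡ 0# ⊎ y ≡ 0#
    product-0 {x} {y} eq with x ≟ 0#
    ... | yes x≡0 = inj₁ x≡0
    ... | no  x≢0 = inj₂ (*-cancel-0 x≢0 eq)

    -- With equal second and third entries the form factors as (c′ - c)(2 a - c - c′).
    degenerate-form : ∀ {a b c c′ d} → form (a , d , d) (b , c , c′) ≡ 0# → c ≡ c′ ⊎ a + a + - c ≡ c′
    degenerate-form {a} {b} {c} {c′} {d} eq = [ (λ p → inj₁ (sym (x-y≡0⇒x≡y p))) , (λ p → inj₂ (x-y≡0⇒x≡y p)) ]′
      (product-0 (trans
        (solve 5 (λ a b c c′ d → (c′ :- c) :* (a :+ a :- c :- c′) :=
          a :* ((c′ :- c) :+ (c′ :- c)) :+ b :* ((d :- d) :+ (d :- d)) :+ (d :* d :- d :* d :+ (c :* c :- c′ :* c′))) refl a b c c′ d)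
        eq))

    -- Exchanges the two solutions c′ of `form x (b , c , c′) ≡ 0#`, whose sum is 2 a x.
    reflect : Carrier → Triple → Triple
    reflect x (b , c , c′) = b , c , x + x + - c′

    form-fibre : ∀ {x b c c₁ c₂} → form x (b , c , c₁) ≡ 0# → form x (b , c , c₂) ≡ 0# → c₂ ≡ c₁ ⊎ c₂ ≡ a x + a x + - c₁
    form-fibre {x , d , e} {b} {c} {c₁} {c₂} eq₁ eq₂ = [ (λ p → inj₁ (sym (x-y≡0⇒x≡y p))) , (λ p → inj₂ (sym (x-y≡0⇒x≡y p))) ]′
      (product-0 (begin
        (c₁ + - c₂) * (x + x + - c₁ + - c₂)
          ≡⟨ solve 7 (λ x d e b c c₁ c₂ →
               let form = λ c′ → x :* ((c′ :- c) :+ (c′ :- c)) :+ b :* ((e :- d) :+ (e :- d)) :+ (d :* d :- e :* e :+ (c :* c :- c′ :* c′))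
               in (c₁ :- c₂) :* (x :+ x :- c₁ :- c₂) := form c₁ :- form c₂) refl x d e b c c₁ c₂ ⟩
        form (x , d , e) (b , c , c₁) + - form (x , d , e) (b , c , c₂)
          ≡⟨ cong₂ (λ p r → p + - r) eq₁ eq₂ ⟩
        0# + - 0#
          ≡⟨ -‿inverseʳ 0# ⟩
        0# ∎))

    reflection-fibre : ∀ x x₁ x₂ → form x x₁ ≡ 0# → form x x₂ ≡ 0# → a x₁ ≡ a x₂ → proj₁ (proj₂ x₁) ≡ proj₁ (proj₂ x₂) →
      x₂ ≡ x₁ ⊎ x₂ ≡ reflect (a x) x₁
    reflection-fibre x (b , c , c₁) (_ , _ , c₂) eq₁ eq₂ refl refl =
      [ (λ p → inj₁ (cong (λ t → b , c , t) p)) , (λ p → inj₂ (cong (λ t → b , c , t) p)) ]′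
        (form-fibre {x} {b} {c} {c₁} {c₂} eq₁ eq₂)

    module _ (1+1≢0 : 1# + 1# ≢ 0#) where

      halve : ∀ {x} → x + x ≡ 0# → x ≡ 0#
      halve {x} eq = *-cancel-0 1+1≢0 (trans (distribʳ x 1# 1#) (trans (cong₂ _+_ (*-identityˡ x) (*-identityˡ x)) eq))

      -- With `a` and `v` fixed, the form fixes `w` = - (e - d)(e + d). Now `v` gives e - d, and
      -- where that is nonzero `w` gives e + d.
      determined : ∀ {x x₁ x₂} → form x x₁ ≡ 0# → form x x₂ ≡ 0# → proj₁ (proj₂ x₁) ≢ proj₂ (proj₂ x₁) →
        a x₁ ≡ a x₂ → v x₁ ≡ v x₂ → x₁ ≡ x₂
      determined {x} {b , d₁ , e₁} {_ , d₂ , e₂} eq₁ eq₂ d₁≢e₁ refl v₁≡v₂ = cong (b ,_) (cong₂ _,_ d₁≡d₂ e₁≡e₂)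
        where
        δ σ : Carrier
        δ = (e₁ + - d₁) + - (e₂ + - d₂)
        σ = (d₁ + e₁) + - (d₂ + e₂)
        δ≡0 : δ ≡ 0#
        δ≡0 = halve (trans (solve 2 (λ p r → p :- r :+ (p :- r) := p :+ p :- (r :+ r)) refl (e₁ + - d₁) (e₂ + - d₂)) (x≡y⇒x-y≡0 v₁≡v₂))
        w₁≡w₂ : w (b , d₁ , e₁) + - w (b , d₂ , e₂) ≡ 0#
        w₁≡w₂ = begin
          w₁ + - w₂
            ≡⟨ solve 8 (λ a v w b v₁ w₁ v₂ w₂ → w₁ :- w₂ := (a :* v₁ :+ b :* v :+ (w :+ w₁)) :- (a :* v₂ :+ b :* v :+ (w :+ w₂)) :- a :* (v₁ :- v₂))
                 refl (a x) (v x) (w x) b v₁ w₁ v₂ w₂ ⟩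
          form x (b , d₁ , e₁) + - form x (b , d₂ , e₂) + - (a x * (v₁ + - v₂))
            ≡⟨ cong₂ (λ p r → p + - (a x * r)) (cong₂ (λ p r → p + - r) eq₁ eq₂) (x≡y⇒x-y≡0 v₁≡v₂) ⟩
          0# + - 0# + - (a x * 0#)
            ≡⟨ solve 1 (λ a → con (pos 0) :- con (pos 0) :- a :* con (pos 0) := con (pos 0)) refl (a x) ⟩
          0# ∎
          where
          v₁ = v (b , d₁ , e₁)
          v₂ = v (b , d₂ , e₂)
          w₁ = w (b , d₁ , e₁)
          w₂ = w (b , d₂ , e₂)
        σ≡0 : σ ≡ 0#
        σ≡0 = *-cancel-0 (λ e-d≡0 → d₁≢e₁ (sym (x-y≡0⇒x≡y e-d≡0))) (begin
          (e₁ + - d₁) * σ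
            ≡⟨ solve 4 (λ d₁ e₁ d₂ e₂ → (e₁ :- d₁) :* ((d₁ :+ e₁) :- (d₂ :+ e₂)) :=
                 :- ((d₁ :* d₁ :- e₁ :* e₁) :- (d₂ :* d₂ :- e₂ :* e₂)) :- ((e₁ :- d₁) :- (e₂ :- d₂)) :* (d₂ :+ e₂)) refl d₁ e₁ d₂ e₂ ⟩
          - (w (b , d₁ , e₁) + - w (b , d₂ , e₂)) + - (δ * (d₂ + e₂))
            ≡⟨ cong₂ (λ p r → - p + - (r * (d₂ + e₂))) w₁≡w₂ δ≡0 ⟩
          - 0# + - (0# * (d₂ + e₂))
            ≡⟨ solve 1 (λ x → :- con (pos 0) :- con (pos 0) :* x := con (pos 0)) refl (d₂ + e₂) ⟩
          0# ∎)
        e₁≡e₂ : e₁ ≡ e₂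
        e₁≡e₂ = x-y≡0⇒x≡y (halve (begin
          e₁ + - e₂ + (e₁ + - e₂)
            ≡⟨ solve 4 (λ d₁ e₁ d₂ e₂ → e₁ :- e₂ :+ (e₁ :- e₂) := ((e₁ :- d₁) :- (e₂ :- d₂)) :+ ((d₁ :+ e₁) :- (d₂ :+ e₂))) refl d₁ e₁ d₂ e₂ ⟩
          δ + σ        ≡⟨ cong₂ _+_ δ≡0 σ≡0 ⟩
          0# + 0#      ≡⟨ +-identityˡ 0# ⟩
          0# ∎))
        d₁≡d₂ : d₁ ≡ d₂
        d₁≡d₂ = x-y≡0⇒x≡y (begin
          d₁ + - d₂
            ≡⟨ solve 4 (λ d₁ e₁ d₂ e₂ → d₁ :- d₂ := ((d₁ :+ e₁) :- (d₂ :+ e₂)) :- (e₁ :- e₂)) refl d₁ e₁ d₂ e₂ ⟩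
          σ + - (e₁ + - e₂)
            ≡⟨ cong₂ (λ p r → p + - r) σ≡0 (x≡y⇒x-y≡0 e₁≡e₂) ⟩
          0# + - 0#    ≡⟨ -‿inverseʳ 0# ⟩
          0# ∎)

  -- From few distances to a dense configuration, and the contradiction.

  module FewDistances (𝕂 : Field) where
    open FieldTheory 𝕂
    open Triples 𝕂

    module Pins
      (g : Carrier) (nonsquare : ∀ x → x * x ≢ g)
      (q : ℕ) (char : ∀ {k} → 0 ℕ.< k → k ℕ.< q → ι k ≢ 0#)
      (h : ℕ) (1≤h : 1 ℕ.≤ h) (40h³≤q : 40 ℕ.* (h ℕ.* (h ℕ.* h)) ℕ.≤ q)
      (As : List Carrier) (As-unique : Unique As) (|As| : length As ≡ h ℕ.* h)
      (Δ : Carrier → Carrier → List Carrier) (Δ-unique : ∀ a b → Unique (Δ a b))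
      (distance∈Δ : ∀ {a b c d} → a ∈ As → b ∈ As → c ∈ As → d ∈ As → distance a b c d ∈ Δ a b)
      (few : ∀ {a b} → a ∈ As → b ∈ As → 41 ℕ.* length (Δ a b) ℕ.≤ h ℕ.* (h ℕ.* h))
      where
      open Arithmetic h 1≤h

      private
        Pairs : List (Carrier × Carrier)
        Pairs = cartesianProduct As As

        Ts : List Triple
        Ts = cartesianProduct As Pairs

        Ts-unique : Unique Ts
        Ts-unique = Uniqueₚ.cartesianProduct⁺ As-unique (Uniqueₚ.cartesianProduct⁺ As-unique As-unique)

        |Pairs| : length Pairs ≡ n ℕ.* n
        |Pairs| = trans (length-cartesian As As) (cong₂ ℕ._*_ |As| |As|)

        |Ts| : length Ts ≡ n ℕ.* (n ℕ.* n)
        |Ts| = trans (length-cartesian As Pairs) (cong₂ ℕ._*_ |As| |Pairs|)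

        ∑Ts : ∀ f → ∑ Ts f ≡ ∑ As (λ a → ∑ As (λ d → ∑ As (λ e → f (a , d , e))))
        ∑Ts f = trans (∑-cartesian As Pairs f) (∑-cong As (λ a → ∑-cartesian As As (λ de → f (a , de))))

        ∑As-≤ : ∀ {c f} → (∀ x → f x ℕ.≤ c) → ∑ As f ℕ.≤ n ℕ.* c
        ∑As-≤ le = ℕₚ.≤-trans (∑-≤ As (λ {x} _ → le x)) (ℕₚ.≤-reflexive (cong (ℕ._* _) |As|))

        Q : Triple → Triple → ℕ
        Q x x′ = 𝟙 (form x x′ ≟ 0#)

        Q-sym : ∀ x x′ → Q x x′ ≡ Q x′ x
        Q-sym x x′ = cong (λ t → 𝟙 (t ≟ 0#)) (form-sym x x′)

        total : ℕ
        total = ∑ Ts (λ x → ∑ Ts (Q x))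

        pair-coincidences : Carrier → Carrier → ℕ
        pair-coincidences a b = ∑ Pairs (λ (d , c) → ∑ Pairs (λ (d′ , c′) → 𝟙 (distance a b c d ≟ distance a b c′ d′)))

        -- Reorders the six summation variables from pins and pairs of targets into (a, d, d′) and
        -- (b, c, c′).
        total-pairs : ∑ As (λ a → ∑ As (pair-coincidences a)) ≡ total
        total-pairs = trans (∑-cong As λ a → trans
            (∑-cong As λ b → trans (∑-cartesian As As _) (∑-cong As λ d → trans
              (∑-cong As λ c → trans (∑-cartesian As As _) (∑-cong As λ d′ → ∑-cong As λ c′ →
                𝟙-cong (distance a b c d ≟ distance a b c′ d′) (form (a , d , d′) (b , c , c′) ≟ 0#)
                  (λ eq → trans (sym (distance-form a b c c′ d d′)) (x≡y⇒x-y≡0 eq))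
                  (λ eq → x-y≡0⇒x≡y (trans (distance-form a b c c′ d d′) eq))))
              (∑-swap As As _)))
            (trans (∑-swap As As _) (∑-cong As λ d → trans (∑-swap As As _) (∑-cong As λ d′ → sym (∑Ts (Q (a , d , d′)))))))
          (sym (∑Ts (λ x → ∑ Ts (Q x))))

        total-lower : n ℕ.* (n ℕ.* (41 ℕ.* (H ℕ.* n))) ℕ.≤ total
        total-lower = begin
          n ℕ.* (n ℕ.* (41 ℕ.* (H ℕ.* n)))                         ≡⟨ cong₂ (λ i j → i ℕ.* (j ℕ.* (41 ℕ.* (H ℕ.* n)))) (sym |As|) (sym |As|) ⟩
          length As ℕ.* (length As ℕ.* (41 ℕ.* (H ℕ.* n)))         ≤⟨ ∑-≥ As (λ a∈ → ∑-≥ As (λ b∈ → pinned a∈ b∈)) ⟩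
          ∑ As (λ a → ∑ As (pair-coincidences a))                 ≡⟨ total-pairs ⟩
          total                                                    ∎
          where
          open ℕₚ.≤-Reasoning
          pinned : ∀ {a b} → a ∈ As → b ∈ As → 41 ℕ.* (H ℕ.* n) ℕ.≤ pair-coincidences a b
          pinned {a} {b} a∈ b∈ = pair-energy {length (Δ a b)} {pair-coincidences a b} (few a∈ b∈)
            (subst (λ m → m ℕ.* m ℕ.≤ length (Δ a b) ℕ.* pair-coincidences a b) |Pairs|
              (energy _≟_ Pairs (Δ a b) (λ (d , c) → distance a b c d) (Δ-unique a b)
                (λ dc∈ → let d∈ , c∈ = ∈-cartesianProduct⁻ As As dc∈ in distance∈Δ a∈ b∈ c∈ d∈)))

        degenerate : Triple → Triple → ℕ
        degenerate x@(_ , d , e) x′ = 𝟙 (d ≟ e) ℕ.* Q x x′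

        -- The condition d = e leaves n² first triples; for each choice of b and c,
        -- `degenerate-form` leaves at most two values of c′.
        degenerate-upper : ∑ Ts (λ x → ∑ Ts (degenerate x)) ℕ.≤ n ℕ.* (n ℕ.* (n ℕ.* (n ℕ.* 2)))
        degenerate-upper = begin
          ∑ Ts (λ x → ∑ Ts (degenerate x))
            ≡⟨ ∑Ts _ ⟩
          ∑ As (λ a → ∑ As (λ d → ∑ As (λ e → ∑ Ts (degenerate (a , d , e)))))
            ≡⟨ ∑-cong As (λ a → ∑-cong As (λ d → ∑-cong As (λ e → ∑-*ˡ Ts (𝟙 (d ≟ e)) (Q (a , d , e))))) ⟩
          ∑ As (λ a → ∑ As (λ d → ∑ As (λ e → 𝟙 (d ≟ e) ℕ.* ∑ Ts (Q (a , d , e)))))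
            ≤⟨ ∑As-≤ (λ a → ∑As-≤ (λ d → ℕₚ.≤-trans (∑-𝟙-≤ _≟_ As-unique d (λ e → ∑ Ts (Q (a , d , e)))) (partners a d))) ⟩
          n ℕ.* (n ℕ.* (n ℕ.* (n ℕ.* 2))) ∎
          where
          open ℕₚ.≤-Reasoning
          pointwise : ∀ a d b c c′ → Q (a , d , d) (b , c , c′) ℕ.≤ 𝟙 (c ≟ c′) ℕ.+ 𝟙 (a + a + - c ≟ c′)
          pointwise a d b c c′ with form (a , d , d) (b , c , c′) ≟ 0#
          ... | no  _  = z≤n
          ... | yes eq = [ (λ p → ℕₚ.≤-trans (ℕₚ.≤-reflexive (sym (𝟙-yes (c ≟ c′) p))) (ℕₚ.m≤m+n _ _))
                         , (λ p → ℕₚ.≤-trans (ℕₚ.≤-reflexive (sym (𝟙-yes (a + a + - c ≟ c′) p))) (ℕₚ.m≤n+m _ _)) ]′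
                         (degenerate-form {a} {b} {c} {c′} {d} eq)
          partners : ∀ a d → ∑ Ts (Q (a , d , d)) ℕ.≤ n ℕ.* (n ℕ.* 2)
          partners a d = begin
            ∑ Ts (Q (a , d , d))     ≡⟨ ∑Ts _ ⟩
            ∑ As (λ b → ∑ As (λ c → ∑ As (λ c′ → Q (a , d , d) (b , c , c′))))
              ≤⟨ ∑As-≤ (λ b → ∑As-≤ (λ c → begin
                   ∑ As (λ c′ → Q (a , d , d) (b , c , c′))                 ≤⟨ ∑-mono As (λ {c′} _ → pointwise a d b c c′) ⟩
                   ∑ As (λ c′ → 𝟙 (c ≟ c′) ℕ.+ 𝟙 (a + a + - c ≟ c′))        ≡⟨ ∑-+ As _ _ ⟩
                   _                                                        ≤⟨ ℕₚ.+-mono-≤ (∑-𝟙-≤1 _≟_ As-unique c) (∑-𝟙-≤1 _≟_ As-unique (a + a + - c)) ⟩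
                   2                                                        ∎)) ⟩
            n ℕ.* (n ℕ.* 2)          ∎

        -- A triple with d = d′ has v = w = 0, so its lines forget d. Excluding these triples makes
        -- `determined` applicable to neighbours.
        R : Triple → Triple → Set
        R x@(_ , d , e) x′@(_ , d′ , e′) = form x x′ ≡ 0# × d ≢ e × d′ ≢ e′

        R? : ∀ x x′ → Dec (R x x′)
        R? x@(_ , d , e) x′@(_ , d′ , e′) = (form x x′ ≟ 0#) ×-dec ¬? (d ≟ e) ×-dec ¬? (d′ ≟ e′)

        adj : Triple → Triple → ℕ
        adj x x′ = 𝟙 (R? x x′)

        R-sym : ∀ {x x′} → R x x′ → R x′ x
        R-sym {x} {x′} (eq , d≢e , d′≢e′) = trans (form-sym x′ x) eq , d′≢e′ , d≢e

        adj-sym : ∀ x x′ → adj x x′ ≡ adj x′ x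
        adj-sym x x′ = 𝟙-cong (R? x x′) (R? x′ x) R-sym R-sym

        Q≤adj : ∀ x x′ → Q x x′ ℕ.≤ adj x x′ ℕ.+ (degenerate x x′ ℕ.+ degenerate x′ x)
        Q≤adj x@(_ , d , e) x′@(_ , d′ , e′) = cases (form x x′ ≟ 0#) (d ≟ e) (d′ ≟ e′)
          where
          open ℕₚ.≤-Reasoning
          cases : Dec (form x x′ ≡ 0#) → Dec (d ≡ e) → Dec (d′ ≡ e′) → Q x x′ ℕ.≤ adj x x′ ℕ.+ (degenerate x x′ ℕ.+ degenerate x′ x)
          cases (no ¬eq) _ _ = ℕₚ.≤-trans (ℕₚ.≤-reflexive (𝟙-no (form x x′ ≟ 0#) ¬eq)) z≤n
          cases (yes eq) (yes d≡e) _ = begin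
            Q x x′                             ≡⟨ sym (ℕₚ.*-identityˡ (Q x x′)) ⟩
            1 ℕ.* Q x x′                       ≡⟨ cong (ℕ._* Q x x′) (sym (𝟙-yes (d ≟ e) d≡e)) ⟩
            degenerate x x′                    ≤⟨ ℕₚ.m≤m+n (degenerate x x′) (degenerate x′ x) ⟩
            degenerate x x′ ℕ.+ degenerate x′ x ≤⟨ ℕₚ.m≤n+m _ (adj x x′) ⟩
            adj x x′ ℕ.+ (degenerate x x′ ℕ.+ degenerate x′ x) ∎
          cases (yes eq) (no _) (yes d′≡e′) = begin
            Q x x′                             ≡⟨ Q-sym x x′ ⟩
            Q x′ x                             ≡⟨ sym (ℕₚ.*-identityˡ (Q x′ x)) ⟩
            1 ℕ.* Q x′ x                       ≡⟨ cong (ℕ._* Q x′ x) (sym (𝟙-yes (d′ ≟ e′) d′≡e′)) ⟩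
            degenerate x′ x                    ≤⟨ ℕₚ.m≤n+m (degenerate x′ x) (degenerate x x′) ⟩
            degenerate x x′ ℕ.+ degenerate x′ x ≤⟨ ℕₚ.m≤n+m _ (adj x x′) ⟩
            adj x x′ ℕ.+ (degenerate x x′ ℕ.+ degenerate x′ x) ∎
          cases (yes eq) (no d≢e) (no d′≢e′) = begin
            Q x x′                             ≡⟨ 𝟙-yes (form x x′ ≟ 0#) eq ⟩
            1                                  ≡⟨ sym (𝟙-yes (R? x x′) (eq , d≢e , d′≢e′)) ⟩
            adj x x′                           ≤⟨ ℕₚ.m≤m+n (adj x x′) _ ⟩
            adj x x′ ℕ.+ (degenerate x x′ ℕ.+ degenerate x′ x) ∎

        edges degenerate-edges : ℕ
        edges            = ∑ Ts (λ x → ∑ Ts (adj x))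
        degenerate-edges = ∑ Ts (λ x → ∑ Ts (degenerate x))

        total-upper : total ℕ.≤ edges ℕ.+ (degenerate-edges ℕ.+ degenerate-edges)
        total-upper = begin
          total
            ≤⟨ ∑-mono Ts (λ {x} _ → ∑-mono Ts (λ {x′} _ → Q≤adj x x′)) ⟩
          ∑ Ts (λ x → ∑ Ts (λ x′ → adj x x′ ℕ.+ (degenerate x x′ ℕ.+ degenerate x′ x)))
            ≡⟨ ∑-cong Ts (λ x → trans (∑-+ Ts (adj x) (λ x′ → degenerate x x′ ℕ.+ degenerate x′ x))
                 (cong (∑ Ts (adj x) ℕ.+_) (∑-+ Ts (degenerate x) (λ x′ → degenerate x′ x)))) ⟩
          ∑ Ts (λ x → ∑ Ts (adj x) ℕ.+ (∑ Ts (degenerate x) ℕ.+ ∑ Ts (λ x′ → degenerate x′ x)))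
            ≡⟨ trans (∑-+ Ts (λ x → ∑ Ts (adj x)) (λ x → ∑ Ts (degenerate x) ℕ.+ ∑ Ts (λ x′ → degenerate x′ x)))
                 (cong (edges ℕ.+_) (∑-+ Ts (λ x → ∑ Ts (degenerate x)) (λ x → ∑ Ts (λ x′ → degenerate x′ x)))) ⟩
          edges ℕ.+ (degenerate-edges ℕ.+ ∑ Ts (λ x → ∑ Ts (λ x′ → degenerate x′ x)))
            ≡⟨ cong (λ s → edges ℕ.+ (degenerate-edges ℕ.+ s)) (∑-swap Ts Ts (λ x x′ → degenerate x′ x)) ⟩
          edges ℕ.+ (degenerate-edges ℕ.+ degenerate-edges) ∎
          where open ℕₚ.≤-Reasoning

        open Core adj adj-sym (E ℕ.+ (E ℕ.+ E))

        dense : Dense Ts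
        dense = dense-core (length Ts) Ts ℕₚ.≤-refl (subst (λ l → 2 ℕ.* (E ℕ.+ (E ℕ.+ E)) ℕ.* l ℕ.< edges) (sym |Ts|)
          (many-edges {total} {edges} {degenerate-edges} total-lower total-upper degenerate-upper))

        open Dense dense renaming (unique to core-unique)

        nb : Triple → List Triple
        nb x = filter (R? x) core

        ∈nb⁻ : ∀ {x x′} → x′ ∈ nb x → x′ ∈ core × R x x′
        ∈nb⁻ {x} = ∈-filter⁻ (R? x) {xs = core}

        nb-unique : ∀ x → Unique (nb x)
        nb-unique x = Uniqueₚ.filter⁺ (R? x) (core-unique Ts-unique)

        nb-large : ∀ {x} → x ∈ core → E ℕ.+ (E ℕ.+ E) ℕ.< length (nb x)
        nb-large {x} x∈ = ℕₚ.<-≤-trans (degree> x∈) (ℕₚ.≤-reflexive (sym (length-filter≡∑ (R? x) core)))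

        1+1≢0 : 1# + 1# ≢ 0#
        1+1≢0 eq = char {2} (s≤s z≤n) (ℕₚ.≤-<-trans (ℕₚ.m≤m+n 2 _) (q-large 40h³≤q)) (trans (cong (1# +_) (+-identityʳ 1#)) eq)

        nb-determined : ∀ {x x₁ x₂} → x₁ ∈ nb x → x₂ ∈ nb x → a x₁ ≡ a x₂ → v x₁ ≡ v x₂ → x₁ ≡ x₂
        nb-determined x₁∈ x₂∈ = let _ , eq₁ , _ , d₁≢e₁ = ∈nb⁻ x₁∈ ; _ , eq₂ , _ = ∈nb⁻ x₂∈ in
          determined 1+1≢0 eq₁ eq₂ d₁≢e₁

        module QE = QuadraticExtension 𝕂 g nonsquare
        module 𝔽 = FieldTheory QE.𝔽

        τ : 𝔽.Carrier
        τ = 0# , 1#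

        embed : Carrier → 𝔽.Carrier
        embed x = x , 0#

        sₓ yₓ : Triple → 𝔽.Carrier
        sₓ x = embed (v x) 𝔽.+ 𝔽.- (τ 𝔽.* embed (a x))
        yₓ x = embed (v x) 𝔽.+ τ 𝔽.* embed (a x)

        -- In the basis 1, τ the two coordinates are v and - a, so one element of the extension
        -- carries the pair that identifies a neighbour.
        sₓ≡ : ∀ x → sₓ x ≡ (v x , - a x)
        sₓ≡ x = cong₂ _,_
          (solve 4 (λ v a g i → v :- (con (pos 0) :* a :+ g :* (i :* con (pos 0))) := v) refl (v x) (a x) g 1#)
          (trans (solve 2 (λ a i → con (pos 0) :- (con (pos 0) :* con (pos 0) :+ i :* a) := :- (i :* a)) refl (a x) 1#)
            (cong -_ (*-identityˡ (a x))))

        yₓ≡ : ∀ x → yₓ x ≡ (v x , a x)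
        yₓ≡ x = cong₂ _,_
          (solve 4 (λ v a g i → v :+ (con (pos 0) :* a :+ g :* (i :* con (pos 0))) := v) refl (v x) (a x) g 1#)
          (trans (solve 2 (λ a i → con (pos 0) :+ (con (pos 0) :* con (pos 0) :+ i :* a) := i :* a) refl (a x) 1#)
            (*-identityˡ (a x)))

        s-injective : ∀ {x x₁ x₂} → x₁ ∈ nb x → x₂ ∈ nb x → sₓ x₁ ≡ sₓ x₂ → x₁ ≡ x₂
        s-injective {x₁ = x₁} {x₂} x₁∈ x₂∈ eq = nb-determined x₁∈ x₂∈
          (trans (sym (neg-neg _)) (trans (cong (-_ ∘ proj₂) coordinates) (neg-neg _))) (cong proj₁ coordinates)
          where
          coordinates : (v x₁ , - a x₁) ≡ (v x₂ , - a x₂)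
          coordinates = trans (sym (sₓ≡ x₁)) (trans eq (sₓ≡ x₂))
          neg-neg : ∀ t → - (- t) ≡ t
          neg-neg = solve 1 (λ t → :- (:- t) := t) refl

        y-injective : ∀ {x x₁ x₂} → x₁ ∈ nb x → x₂ ∈ nb x → yₓ x₁ ≡ yₓ x₂ → x₁ ≡ x₂
        y-injective {x₁ = x₁} {x₂} x₁∈ x₂∈ eq = nb-determined x₁∈ x₂∈ (cong proj₂ coordinates) (cong proj₁ coordinates)
          where
          coordinates : (v x₁ , a x₁) ≡ (v x₂ , a x₂)
          coordinates = trans (sym (yₓ≡ x₁)) (trans eq (yₓ≡ x₂))

        crossing : ∀ {x x′} → x′ ∈ nb x →
          embed (a x) 𝔽.* embed (v x′) 𝔽.+ embed (a x′) 𝔽.* embed (v x) 𝔽.+ (embed (w x) 𝔽.+ embed (w x′)) ≡ 𝔽.0#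
        crossing {x} {x′} x′∈ = cong₂ _,_
          (trans (solve 7 (λ a v w a′ v′ w′ g → let o = con (pos 0) in
              a :* v′ :+ g :* (o :* o) :+ (a′ :* v :+ g :* (o :* o)) :+ (w :+ w′) := a :* v′ :+ a′ :* v :+ (w :+ w′)) refl
              (a x) (v x) (w x) (a x′) (v x′) (w x′) g)
            (proj₁ (proj₂ (∈nb⁻ x′∈))))
          (solve 4 (λ a v a′ v′ → let o = con (pos 0) in a :* o :+ o :* v′ :+ (a′ :* o :+ o :* v) :+ (o :+ o) := o) refl
            (a x) (v x) (a x′) (v x′))

        char₂ : ∀ {k} → 0 ℕ.< k → k ℕ.< q → 𝔽.ι k ≢ 𝔽.0#
        char₂ {k} 0<k k<q eq = char 0<k k<q (cong proj₁ (trans (sym (QE.ι₂ k)) eq))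

        collinear-neighbours : ∃ λ x → x ∈ core × ∃ λ κ → ∃ λ δ →
          length (filter (λ x′ → ¬? (embed (a x′) 𝔽.≟ κ 𝔽.+ δ 𝔽.* sₓ x′)) (nb x)) ℕ.≤ E
        collinear-neighbours = Incidence.Configuration.collinear-neighbours QE.𝔽 q char₂
          (embed ∘ a) (embed ∘ v) (embed ∘ w) τ core nb D
          (λ _ x′∈ → proj₁ (∈nb⁻ x′∈)) (λ _ → crossing) (λ _ → nb-unique _)
          (λ _ → s-injective) (λ _ → y-injective) nb-large
          (q-large 40h³≤q) (few-lines (ℕₚ.≤-trans length≤ (ℕₚ.≤-reflexive |Ts|))) (proj₂ vertex)

        module _ (x : Triple) (κ δ : 𝔽.Carrier) where

          collinear? : ∀ x′ → Dec (embed (a x′) ≡ κ 𝔽.+ δ 𝔽.* sₓ x′)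
          collinear? x′ = embed (a x′) 𝔽.≟ κ 𝔽.+ δ 𝔽.* sₓ x′

          U : List Triple
          U = filter collinear? (nb x)

          U-unique : Unique U
          U-unique = Uniqueₚ.filter⁺ collinear? (nb-unique x)

          ∈U⁻ : ∀ {x′} → x′ ∈ U → x′ ∈ nb x × embed (a x′) ≡ κ 𝔽.+ δ 𝔽.* sₓ x′
          ∈U⁻ = ∈-filter⁻ collinear? {xs = nb x}

          coordinates∈ : ∀ {b c c′} → (b , c , c′) ∈ U → b ∈ As × c ∈ As
          coordinates∈ x′∈ = let b∈ , cc′∈ = ∈-cartesianProduct⁻ As Pairs (core⊆ (proj₁ (∈nb⁻ (proj₁ (∈U⁻ x′∈))))) in
            b∈ , proj₁ (∈-cartesianProduct⁻ As As cc′∈)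

          form≡0 : ∀ {x′} → x′ ∈ U → form x x′ ≡ 0#
          form≡0 x′∈ = proj₁ (proj₂ (∈nb⁻ (proj₁ (∈U⁻ x′∈))))

          -- All these neighbours share the same `a`. Fixing also c leaves a quadratic for the last
          -- entry, with roots exchanged by `reflect`.
          U-small-horizontal : δ ≡ 𝔽.0# → length U ℕ.≤ length As ℕ.* 2
          U-small-horizontal δ≡0 = length-fibres _≟_ (proj₁ ∘ proj₂) U As (proj₂ ∘ coordinates∈) (λ c →
            length≤2 (reflect (a x)) (Uniqueₚ.filter⁺ (λ u → proj₁ (proj₂ u) ≟ c) U-unique) (λ {x₁} {x₂} x₁∈ x₂∈ →
              let x₁∈U , c₁≡c = ∈-filter⁻ (λ u → proj₁ (proj₂ u) ≟ c) {xs = U} x₁∈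
                  x₂∈U , c₂≡c = ∈-filter⁻ (λ u → proj₁ (proj₂ u) ≟ c) {xs = U} x₂∈
              in reflection-fibre x x₁ x₂ (form≡0 x₁∈U) (form≡0 x₂∈U) (same-a x₁∈U x₂∈U) (trans c₁≡c (sym c₂≡c))))
            where
            a≡κ : ∀ {x′} → x′ ∈ U → embed (a x′) ≡ κ
            a≡κ {x′} x′∈ = trans (proj₂ (∈U⁻ x′∈)) (𝔽.affine-constant δ≡0 (sₓ x′))
            same-a : ∀ {x₁ x₂} → x₁ ∈ U → x₂ ∈ U → a x₁ ≡ a x₂
            same-a x₁∈ x₂∈ = cong proj₁ (trans (a≡κ x₁∈) (sym (a≡κ x₂∈)))

          -- Now `a x′` determines `sₓ x′` and hence `x′`. Fibres have at most one element,
          -- expressed by the identity in place of a reflection.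
          U-small-sloped : δ ≢ 𝔽.0# → length U ℕ.≤ length As ℕ.* 2
          U-small-sloped δ≢0 = length-fibres _≟_ a U As (proj₁ ∘ coordinates∈) (λ b →
            length≤2 (λ x → x) (Uniqueₚ.filter⁺ (λ u → a u ≟ b) U-unique) (λ x₁∈ x₂∈ →
              let x₁∈U , a₁≡b = ∈-filter⁻ (λ u → a u ≟ b) {xs = U} x₁∈
                  x₂∈U , a₂≡b = ∈-filter⁻ (λ u → a u ≟ b) {xs = U} x₂∈
              in inj₁ (same x₂∈U x₁∈U (trans a₂≡b (sym a₁≡b)))))
            where
            same : ∀ {x₁ x₂} → x₁ ∈ U → x₂ ∈ U → a x₁ ≡ a x₂ → x₁ ≡ x₂
            same x₁∈ x₂∈ a₁≡a₂ = s-injective (proj₁ (∈U⁻ x₁∈)) (proj₁ (∈U⁻ x₂∈))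
              (𝔽.affine-injective δ≢0 (trans (sym (proj₂ (∈U⁻ x₁∈))) (trans (cong embed a₁≡a₂) (proj₂ (∈U⁻ x₂∈)))))

          U-small : length U ℕ.≤ n ℕ.* 2
          U-small = subst (λ l → length U ℕ.≤ l ℕ.* 2) |As| (cases (δ 𝔽.≟ 𝔽.0#))
            where
            cases : Dec (δ ≡ 𝔽.0#) → length U ℕ.≤ length As ℕ.* 2
            cases (yes δ≡0) = U-small-horizontal δ≡0
            cases (no  δ≢0) = U-small-sloped δ≢0

      contradictory : ⊥
      contradictory = let x , x∈ , κ , δ , exceptions = collinear-neighbours in
        ℕₚ.<⇒≱ (nb-large x∈) (few-neighbours (length-filter-split (collinear? x κ δ) (nb x)) (U-small x κ δ) exceptions)

open import Data.Nat using (_+_; _*_; _^_; _∸_; _≤_; _<_; _⊓_; _≤?_; >-nonZero)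
open import Data.Nat.Properties
open import Data.Fin.Subset using (Subset; _∈_; ∣_∣; Nonempty; inside; outside)
open import Data.Fin.Subset.Properties using (_∈?_)
open import Data.List using (take)
open import Data.List.Properties using (length-take)
import Data.List.Membership.Propositional as List
open import Data.List.Membership.Propositional.Properties using (∈-map⁺; ∈-map⁻)
open import Data.Product using (Σ)
open import Data.Vec using ([]; _∷_; here; there)
open import Data.Vec.Properties using (lookup∘tabulate; lookup⇒[]=)
open PinnedDistances

-- Transfer to subsets of `Fin p`.

elements : ∀ {n} → Subset n → List (Fin n)
elements []            = []
elements (inside  ∷ S) = zero ∷ map suc (elements S)
elements (outside ∷ S) = map suc (elements S)

length-elements : ∀ {n} (S : Subset n) → length (elements S) ≡ ∣ S ∣
length-elements []            = refl
length-elements (inside  ∷ S) = cong suc (trans (length-map suc (elements S)) (length-elements S))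
length-elements (outside ∷ S) = trans (length-map suc (elements S)) (length-elements S)

elements-unique : ∀ {n} (S : Subset n) → Unique (elements S)
elements-unique []            = []
elements-unique (inside  ∷ S) = Allₚ.map⁺ (All.universal (λ _ ()) (elements S)) ∷ Uniqueₚ.map⁺ Finₚ.suc-injective (elements-unique S)
elements-unique (outside ∷ S) = Uniqueₚ.map⁺ Finₚ.suc-injective (elements-unique S)

∈-elements⁺ : ∀ {n} {S : Subset n} {x} → x ∈ S → x List.∈ elements S
∈-elements⁺ {S = inside  ∷ S} here        = here refl
∈-elements⁺ {S = inside  ∷ S} (there x∈S) = there (∈-map⁺ suc (∈-elements⁺ x∈S))
∈-elements⁺ {S = outside ∷ S} (there x∈S) = ∈-map⁺ suc (∈-elements⁺ x∈S)

∈-elements⁻ : ∀ {n} (S : Subset n) {x} → x List.∈ elements S → x ∈ S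
∈-elements⁻ (inside  ∷ S) (here refl) = here
∈-elements⁻ (inside  ∷ S) (there x∈)  with y , y∈ , refl ← ∈-map⁻ suc x∈ = there (∈-elements⁻ S y∈)
∈-elements⁻ (outside ∷ S) x∈          with y , y∈ , refl ← ∈-map⁻ suc x∈ = there (∈-elements⁻ S y∈)

∈-take⁻ : ∀ {A : Set} n (xs : List A) {x} → x List.∈ take n xs → x List.∈ xs
∈-take⁻ (suc n) (y ∷ xs) (here refl) = here refl
∈-take⁻ (suc n) (y ∷ xs) (there x∈)  = there (∈-take⁻ n xs x∈)

∈⇒1≤∣∣ : ∀ {n} {S : Subset n} {x} → x ∈ S → 1 ≤ ∣ S ∣
∈⇒1≤∣∣ {S = S} x∈S = subst (1 ≤_) (length-elements S) (nonempty (∈-elements⁺ x∈S))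
  where
  nonempty : ∀ {A : Set} {x : A} {xs} → x List.∈ xs → 1 ≤ length xs
  nonempty (here _)  = s≤s z≤n
  nonempty (there _) = s≤s z≤n

largest : ∀ {P : ℕ → Set} → (∀ n → Dec (P n)) → P 0 → ∀ {m} → ¬ P m → ∃ λ n → P n × ¬ P (suc n)
largest P? P0 {zero}  ¬P0 = contradiction P0 ¬P0
largest P? P0 {suc m} ¬P  with P? m
... | yes Pm = m , Pm , ¬P
... | no ¬Pm = largest P? P0 ¬Pm

module _ (p : ℕ) .{{_ : NonZero p}} (prime : Prime p) (p≢2 : p ≢ 2) where
  open PrimeField p prime
  open Triples 𝔽ₚ using (distance)

  distance≡dist : ∀ a b c d → toℕ (distance a b c d) ≡ dist p a b c d
  distance≡dist a b c d = trans (cong toℕ (sym (trans ([]-+ _ _) (cong₂ _⊕_ (square a c) (square b d))))) (toℕ-[] _)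
    where
    difference : ∀ a c → [ toℕ a + (p ∸ toℕ c) ] ≡ a ⊕ ⊖ c
    difference a c = trans ([]-+ (toℕ a) (p ∸ toℕ c)) (cong (_⊕ ⊖ c) ([]-toℕ a))
    square : ∀ a c → [ (toℕ a + (p ∸ toℕ c)) ^ 2 ] ≡ (a ⊕ ⊖ c) ⊗ (a ⊕ ⊖ c)
    square a c = trans (cong (λ m → [ (toℕ a + (p ∸ toℕ c)) * m ]) (*-identityʳ _))
      (trans ([]-* _ _) (cong₂ _⊗_ (difference a c) (difference a c)))

  distance∈pinnedΔ : ∀ {A a b c d} → c ∈ A → d ∈ A → distance a b c d ∈ pinnedΔ p A a b
  distance∈pinnedΔ {A} {a} {b} {c} {d} c∈A d∈A = lookup⇒[]= t (pinnedΔ p A a b)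
    (trans (lookup∘tabulate _ t) (dec-true (Finₚ.any? _) (c , d , (c∈A , d∈A) , sym (distance≡dist a b c d))))
    where
    t : Fin p
    t = distance a b c d

  large-pinnedΔ : ∀ (A : Subset p) h → 1 ≤ h → 40 * (h * (h * h)) ≤ p → h * h ≤ ∣ A ∣ →
    ∃ λ a → ∃ λ b → a ∈ A × b ∈ A × h * (h * h) ≤ 41 * ∣ pinnedΔ p A a b ∣
  large-pinnedΔ A h 1≤h 40h³≤p h²≤|A| with Finₚ.any? (λ a → Finₚ.any? (λ b →
    a ∈? A ×-dec b ∈? A ×-dec (h * (h * h) ≤? 41 * ∣ pinnedΔ p A a b ∣)))
  ... | yes found = found
  -- The failed finite search supplies `few` for every pin in the subset `As` of size h²; distances
  -- within `As` are among those within `A`.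
  ... | no ¬found = contradiction (FewDistances.Pins.contradictory 𝔽ₚ (proj₁ (nonsquare p≢2)) (proj₂ (nonsquare p≢2)) p ι≢0
      h 1≤h 40h³≤p As (Uniqueₚ.take⁺ (h * h) (elements-unique A))
      (trans (length-take (h * h) (elements A)) (m≤n⇒m⊓n≡m (≤-trans h²≤|A| (≤-reflexive (sym (length-elements A))))))
      (λ a b → elements (pinnedΔ p A a b)) (λ a b → elements-unique (pinnedΔ p A a b))
      (λ _ _ c∈ d∈ → ∈-elements⁺ (distance∈pinnedΔ {A} (As⊆A c∈) (As⊆A d∈)))
      (λ {a} {b} a∈ b∈ → ≤-trans (≤-reflexive (cong (41 *_) (length-elements (pinnedΔ p A a b))))
        (<⇒≤ (≰⇒> (λ large → ¬found (a , b , As⊆A a∈ , As⊆A b∈ , large)))))) λ ()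
    where
    As : List (Fin p)
    As = take (h * h) (elements A)
    As⊆A : ∀ {x} → x List.∈ As → x ∈ A
    As⊆A x∈ = ∈-elements⁻ A (∈-take⁻ (h * h) (elements A) x∈)

-- Choice of h and the absolute constant.

module _ {h L : ℕ} (c : ℕ) (large : 320 * 41 ≤ c) (1≤h : 1 ≤ h) (h³≤41L : h * (h * h) ≤ 41 * L) where
  open ≤-Reasoning
  open +-*-Solver

  -- 41 from large-pinnedΔ; 320 = 40 · 8 since (1 + h)³ ≤ 8 h³.
  320h³≤cL : 320 * (h * (h * h)) ≤ c * L
  320h³≤cL = begin
    320 * (h * (h * h)) ≤⟨ *-monoʳ-≤ 320 h³≤41L ⟩
    320 * (41 * L)      ≡⟨ sym (*-assoc 320 41 L) ⟩
    320 * 41 * L        ≤⟨ *-monoˡ-≤ L large ⟩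
    c * L               ∎

  1+h≤2h : suc h ≤ h + h
  1+h≤2h = +-monoˡ-≤ h 1≤h

  bound-by-p : ∀ {p} → p < 40 * (suc h * (suc h * suc h)) → p ^ 2 ≤ (c * L) ^ 2
  bound-by-p {p} p< = ^-monoˡ-≤ 2 (begin
    p                                      ≤⟨ <⇒≤ p< ⟩
    40 * (suc h * (suc h * suc h))         ≤⟨ *-monoʳ-≤ 40 (*-mono-≤ 1+h≤2h (*-mono-≤ 1+h≤2h 1+h≤2h)) ⟩
    40 * ((h + h) * ((h + h) * (h + h)))
      ≡⟨ cong (40 *_) (solve 1 (λ h → (h :+ h) :* ((h :+ h) :* (h :+ h)) := con 8 :* (h :* (h :* h))) refl h) ⟩
    40 * (8 * (h * (h * h)))               ≡⟨ sym (*-assoc 40 8 (h * (h * h))) ⟩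
    320 * (h * (h * h))                    ≤⟨ 320h³≤cL ⟩
    c * L                                  ∎)

  bound-by-A : ∀ {N} → N < suc h * suc h → N ^ 3 ≤ (c * L) ^ 2
  bound-by-A {N} N< = begin
    N ^ 3                        ≤⟨ ^-monoˡ-≤ 3 (≤-trans (<⇒≤ N<) (*-mono-≤ 1+h≤2h 1+h≤2h)) ⟩
    ((h + h) * (h + h)) ^ 3
      ≡⟨ solve 1 (λ h → ((h :+ h) :* (h :+ h)) :^ 3 := (con 8 :* (h :* (h :* h))) :^ 2) refl h ⟩
    (8 * (h * (h * h))) ^ 2      ≤⟨ ^-monoˡ-≤ 2 (≤-trans (*-monoˡ-≤ (h * (h * h)) (m≤m+n 8 312)) 320h³≤cL) ⟩
    (c * L) ^ 2                  ∎

-- Squaring turns the exponent 3/2 into an integer; `c` is the reciprocal of the constant sought.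
Pinned : ℕ → (p : ℕ) .{{_ : NonZero p}} → Subset p → Set
Pinned c p A = ∃ λ a → ∃ λ b → a ∈ A × b ∈ A × ((p ^ 2) ⊓ (∣ A ∣ ^ 3) ≤ (c * ∣ pinnedΔ p A a b ∣) ^ 2)

-- Take h maximal with h² ≤ |A| and 40 h³ ≤ p. Whichever condition fails at h + 1 bounds |A|³ or p²
-- by a constant times h⁶, because 1 + h ≤ 2 h.
pinned : ∀ c → 320 * 41 ≤ c → (p : ℕ) .{{_ : NonZero p}} → Prime p → p ≢ 2 → (A : Subset p) → Nonempty A → Pinned c p A
pinned c c-large p p-prime p≢2 A (a₀ , a₀∈A) = go (largest Fits? (z≤n , z≤n) {suc p} too-large)
  where
  Fits : ℕ → Set
  Fits h = h * h ≤ ∣ A ∣ × 40 * (h * (h * h)) ≤ p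
  Fits? : ∀ h → Dec (Fits h)
  Fits? h = (h * h ≤? ∣ A ∣) ×-dec (40 * (h * (h * h)) ≤? p)
  too-large : ¬ Fits (suc p)
  too-large (_ , le) = <⇒≱ (n<1+n p) (≤-trans (≤-trans (m≤m*n (suc p) (suc p * suc p)) (m≤n*m (suc p * (suc p * suc p)) 40)) le)
  go : (∃ λ h → Fits h × ¬ Fits (suc h)) → Pinned c p A
  -- If already h = 1 fails, then p < 40 because `A` is nonempty. The distance from `a₀` to itself
  -- makes the pinned set nonempty, and 40 ≤ c settles the bound.
  go (zero , _ , ¬fits) with 40 ≤? p
  ... | yes 40≤p = contradiction (∈⇒1≤∣∣ a₀∈A , 40≤p) ¬fits
  ... | no 40≰p  = a₀ , a₀ , a₀∈A , a₀∈A , ≤-trans (m⊓n≤m (p ^ 2) (∣ A ∣ ^ 3)) (^-monoˡ-≤ 2 (≤-trans (<⇒≤ (≰⇒> 40≰p))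
    (≤-trans (≤-trans (m≤m+n 40 13080) c-large) (m≤m*n c ∣ pinnedΔ p A a₀ a₀ ∣
      {{>-nonZero (∈⇒1≤∣∣ (distance∈pinnedΔ p p-prime p≢2 {A} {a₀} {a₀} a₀∈A a₀∈A))}}))))
  go (suc h , (h²≤|A| , 40h³≤p) , ¬fits)
    with a , b , a∈A , b∈A , large ← large-pinnedΔ p p-prime p≢2 A (suc h) (s≤s z≤n) 40h³≤p h²≤|A|
    with suc (suc h) * suc (suc h) ≤? ∣ A ∣
  ... | no small = a , b , a∈A , b∈A , ≤-trans (m⊓n≤n (p ^ 2) (∣ A ∣ ^ 3)) (bound-by-A c c-large (s≤s z≤n) large (≰⇒> small))
  ... | yes fits = a , b , a∈A , b∈A , ≤-trans (m⊓n≤m (p ^ 2) (∣ A ∣ ^ 3))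
    (bound-by-p c c-large (s≤s z≤n) large (≰⇒> (λ fits′ → ¬fits (fits , fits′))))

theorem1p1 : Σ ℕ λ k →
    (p : ℕ) .{{_ : NonZero p}} → Prime p → p ≢ 2 →
    (A : Subset p) → Nonempty A →
    ∃ λ a → ∃ λ b → a ∈ A × b ∈ A ×
    ((p ^ 2) ⊓ (∣ A ∣ ^ 3) ≤ (suc k * ∣ pinnedΔ p A a b ∣) ^ 2)
theorem1p1 = 13119 , pinned (suc 13119) ≤-refl
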